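{- Let $E$ be an elliptic curve over $\mathbb{Q}_2$ with good ordinary reduction. Then $\mathbb{Q}_2(E[2])$ is $\mathbb{Q}_2$-isomorphic to one of the following fields: (i) $\mathbb{Q}_2$, (ii) the unramified quadratic extension $\mathbb{Q}_4$ of $\mathbb{Q}_2$, (iii) $L_1:=\mathbb{Q}_2[X]/(X^2+2X+2)$, (iv) $L_2:=\mathbb{Q}_2[X]/(X^2+2X+6)$. If $\mathbb{Q}_2(E[2])$ is (isomorphic to) one of $\mathbb{Q}_4, L_1, L_2$, then $\mathbb{Q}_2(P)=\mathbb{Q}_2$ for exactly two elements $P$ of $E[2]$ and $\mathbb{Q}_2(P)=\mathbb{Q}_2(E[2])$ for the other two elements $P$ of $E[2]$.
   Context: $E[2]$ is the group (of order 4, including the origin) of 2-torsion points of $E(\overline{\mathbb{Q}}_2)$; $\mathbb{Q}_2(P)$ (resp. $\mathbb{Q}_2(E[2])$) is the field generated over $\mathbb{Q}_2$ by the coordinates of $P$ (resp. of all points of $E[2]$), with $\mathbb{Q}_2(O)=\mathbb{Q}_2$ for the origin $O$. Good ordinary reduction means good reduction $\bar{E}$ with $\bar{E}(\overline{\mathbb{F}}_2)[2]\neq 0$. -}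

module Defs where

open import Algebra.Apartness.Bundles using (HeytingField; HeytingCommutativeRing)
open import Algebra.Bundles using (CommutativeRing; RawRing)
open import Algebra.Definitions using (Invertible)
import Algebra.Definitions.RawSemiring
import Algebra.Morphism.Construct.Identity
open import Algebra.Morphism.Structures using (IsRingHomomorphism; IsRingIsomorphism)
import Algebra.Properties.Ring
import Algebra.Properties.Semiring.Exp
import Algebra.Solver.CommutativeMonoid
import Algebra.Solver.Ring.NaturalCoefficients.Default
open import Algebra.Structures using (IsCommutativeRing)
open import Data.Empty using (⊥; ⊥-elim)
open import Data.Integer as ℤ using (ℤ; +_; 0ℤ; 1ℤ)
open import Data.Integer.Divisibility.Signed as ℤ∣ using (_∣_; _∣?_; divides)
import Data.Integer.DivMod as ℤD
import Data.Integer.Properties as ℤₚ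
open import Data.Integer.Tactic.RingSolver using (solve-∀)
open import Data.List using (List; []; _∷_; _++_; [_]; map)
open import Data.Nat as ℕ using (ℕ; zero; suc)
import Data.Nat.Divisibility as ℕ∣
import Data.Nat.Properties as ℕₚ
open import Data.Product using (_,_; _×_; Σ; ∃-syntax; proj₁; proj₂)
open import Data.Sum using (_⊎_; inj₁; inj₂)
open import Data.Vec.Functional using (Vector)
open import Function using (_∘_; id)
open import Level using (Level; Lift; 0ℓ; _⊔_)
open import Relation.Binary.Bundles using (Setoid)
open import Relation.Binary.Definitions using (Tight)
open import Relation.Binary.PropositionalEquality as ≡ using (_≡_; _≢_; cong)
import Relation.Binary.Reasoning.Setoid
open import Relation.Binary.Structures using (IsApartnessRelation; IsEquivalence)
open import Relation.Nullary using (¬_; Dec; yes; no)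
open import Relation.Nullary.Decidable using (decidable-stable)
open import Relation.Unary using (Pred)

private variable
  a c c′ k k₁ k₂ ℓ ℓ′ ℓ₁ ℓ₂ p : Level

infix 8 2^_

2^_ : ℕ → ℤ
2^ n = (+ 2) ℤ.^ n

infix 4 _≡_mod2^_

record _≡_mod2^_ (a b : ℤ) (n : ℕ) : Set where
  constructor mk
  field
    2^∣- : 2^ n ∣ a ℤ.- b

open _≡_mod2^_

along : ∀ {i a b} → a ≡ b → i ∣ a → i ∣ b
along ≡.refl d = d

opaque
  mod-reflexive : ∀ {n a b} → a ≡ b → a ≡ b mod2^ n
  mod-reflexive {a = a} ≡.refl = mk (divides 0ℤ (ℤₚ.+-inverseʳ a))

  mod-sym : ∀ {n a b} → a ≡ b mod2^ n → b ≡ a mod2^ n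
  mod-sym {a = a} {b} (mk p) = mk (along (lem a b) (ℤ∣.∣m⇒∣-m p))
    where
    lem : ∀ a b → ℤ.- (a ℤ.- b) ≡ b ℤ.- a
    lem = solve-∀

  mod-trans : ∀ {n a b c} → a ≡ b mod2^ n → b ≡ c mod2^ n → a ≡ c mod2^ n
  mod-trans {a = a} {b} {c} (mk p) (mk q) = mk (along (lem a b c) (ℤ∣.∣m∣n⇒∣m+n p q))
    where
    lem : ∀ a b c → (a ℤ.- b) ℤ.+ (b ℤ.- c) ≡ a ℤ.- c
    lem = solve-∀

  mod-+ : ∀ {n a a′ b b′} → a ≡ a′ mod2^ n → b ≡ b′ mod2^ n → a ℤ.+ b ≡ a′ ℤ.+ b′ mod2^ n
  mod-+ {a = a} {a′} {b} {b′} (mk p) (mk q) = mk (along (lem a a′ b b′) (ℤ∣.∣m∣n⇒∣m+n p q))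
    where
    lem : ∀ a a′ b b′ → (a ℤ.- a′) ℤ.+ (b ℤ.- b′) ≡ (a ℤ.+ b) ℤ.- (a′ ℤ.+ b′)
    lem = solve-∀

  mod-* : ∀ {n a a′ b b′} → a ≡ a′ mod2^ n → b ≡ b′ mod2^ n → a ℤ.* b ≡ a′ ℤ.* b′ mod2^ n
  mod-* {a = a} {a′} {b} {b′} (mk p) (mk q) =
    mk (along (lem a a′ b b′) (ℤ∣.∣m∣n⇒∣m+n (ℤ∣.∣m⇒∣m*n b p) (ℤ∣.∣n⇒∣m*n a′ q)))
    where
    lem : ∀ a a′ b b′ → (a ℤ.- a′) ℤ.* b ℤ.+ a′ ℤ.* (b ℤ.- b′) ≡ a ℤ.* b ℤ.- a′ ℤ.* b′
    lem = solve-∀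

  mod-neg : ∀ {n a a′} → a ≡ a′ mod2^ n → ℤ.- a ≡ ℤ.- a′ mod2^ n
  mod-neg {a = a} {a′} (mk p) = mk (along (lem a a′) (ℤ∣.∣m⇒∣-m p))
    where
    lem : ∀ a a′ → ℤ.- (a ℤ.- a′) ≡ (ℤ.- a) ℤ.- (ℤ.- a′)
    lem = solve-∀

  mod-weaken : ∀ {n a b} → a ≡ b mod2^ (suc n) → a ≡ b mod2^ n
  mod-weaken (mk p) = mk (ℤ∣.∣-trans (ℤ∣.∣n⇒∣m*n (+ 2) ℤ∣.∣-refl) p)

  mod-0⇒∣ : ∀ {n a} → a ≡ 0ℤ mod2^ n → 2^ n ∣ a
  mod-0⇒∣ {a = a} (mk p) = along (ℤₚ.+-identityʳ a) p

  ∣⇒mod-0 : ∀ {n a} → 2^ n ∣ a → a ≡ 0ℤ mod2^ n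
  ∣⇒mod-0 {a = a} p = mk (along (≡.sym (ℤₚ.+-identityʳ a)) p)

-- ℤ₂ is the inverse limit of the rings ℤ/2ⁿ, each class in ℤ/2ⁿ being given by an integer.
record ℤ₂-Carrier : Set where
  constructor mkℤ₂
  field
    approx   : ℕ → ℤ
    coherent : ∀ n → approx (suc n) ≡ approx n mod2^ n

open ℤ₂-Carrier public

infix 4 _≈₂_

record _≈₂_ (x y : ℤ₂-Carrier) : Set where
  constructor mk≈₂
  field
    at : ∀ n → approx x n ≡ approx y n mod2^ n

open _≈₂_ public

infix 8 -₂_
infixl 7 _*₂_
infixl 6 _+₂_

_+₂_ _*₂_ : ℤ₂-Carrier → ℤ₂-Carrier → ℤ₂-Carrier
x +₂ y = mkℤ₂ (λ n → approx x n ℤ.+ approx y n) (λ n → mod-+ (coherent x n) (coherent y n))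
x *₂ y = mkℤ₂ (λ n → approx x n ℤ.* approx y n) (λ n → mod-* (coherent x n) (coherent y n))

-₂_ : ℤ₂-Carrier → ℤ₂-Carrier
-₂ x = mkℤ₂ (λ n → ℤ.- approx x n) (λ n → mod-neg (coherent x n))

0₂ 1₂ : ℤ₂-Carrier
0₂ = mkℤ₂ (λ _ → 0ℤ) (λ n → mod-reflexive ≡.refl)
1₂ = mkℤ₂ (λ _ → 1ℤ) (λ n → mod-reflexive ≡.refl)

opaque
  ℤ₂-isCommutativeRing : IsCommutativeRing _≈₂_ _+₂_ _*₂_ -₂_ 0₂ 1₂
  ℤ₂-isCommutativeRing = record
    { isRing = record
      { +-isAbelianGroup = record
        { isGroup = record
          { isMonoid = record
            { isSemigroup = record
              { isMagma = record
                { isEquivalence = record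
                  { refl = mk≈₂ λ n → mod-reflexive ≡.refl
                  ; sym = λ p → mk≈₂ λ n → mod-sym (at p n)
                  ; trans = λ p q → mk≈₂ λ n → mod-trans (at p n) (at q n)
                  }
                ; ∙-cong = λ p q → mk≈₂ λ n → mod-+ (at p n) (at q n)
                }
              ; assoc = λ x y z → mk≈₂ λ n → mod-reflexive (ℤₚ.+-assoc (approx x n) (approx y n) (approx z n))
              }
            ; identity = (λ x → mk≈₂ λ n → mod-reflexive (ℤₚ.+-identityˡ (approx x n)))
                       , (λ x → mk≈₂ λ n → mod-reflexive (ℤₚ.+-identityʳ (approx x n)))
            }
          ; inverse = (λ x → mk≈₂ λ n → mod-reflexive (ℤₚ.+-inverseˡ (approx x n)))
                    , (λ x → mk≈₂ λ n → mod-reflexive (ℤₚ.+-inverseʳ (approx x n)))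
          ; ⁻¹-cong = λ p → mk≈₂ λ n → mod-neg (at p n)
          }
        ; comm = λ x y → mk≈₂ λ n → mod-reflexive (ℤₚ.+-comm (approx x n) (approx y n))
        }
      ; *-cong = λ p q → mk≈₂ λ n → mod-* (at p n) (at q n)
      ; *-assoc = λ x y z → mk≈₂ λ n → mod-reflexive (ℤₚ.*-assoc (approx x n) (approx y n) (approx z n))
      ; *-identity = (λ x → mk≈₂ λ n → mod-reflexive (ℤₚ.*-identityˡ (approx x n)))
                   , (λ x → mk≈₂ λ n → mod-reflexive (ℤₚ.*-identityʳ (approx x n)))
      ; distrib = (λ x y z → mk≈₂ λ n → mod-reflexive (ℤₚ.*-distribˡ-+ (approx x n) (approx y n) (approx z n)))
                , (λ x y z → mk≈₂ λ n → mod-reflexive (ℤₚ.*-distribʳ-+ (approx x n) (approx y n) (approx z n)))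
      }
    ; *-comm = λ x y → mk≈₂ λ n → mod-reflexive (ℤₚ.*-comm (approx x n) (approx y n))
    }

ℤ₂ : CommutativeRing 0ℓ 0ℓ
ℤ₂ = record
  { Carrier = ℤ₂-Carrier
  ; _≈_ = _≈₂_
  ; _+_ = _+₂_
  ; _*_ = _*₂_
  ; -_ = -₂_
  ; 0# = 0₂
  ; 1# = 1₂
  ; isCommutativeRing = ℤ₂-isCommutativeRing
  }

module ℤ₂ = CommutativeRing ℤ₂

2ℤ₂ : ℤ₂-Carrier
2ℤ₂ = ℤ₂.1# ℤ₂.+ ℤ₂.1#

module ℤ₂^ = Algebra.Properties.Semiring.Exp ℤ₂.semiring
open ℤ₂^ using () renaming (_^_ to _^₂_)

-- z ≢0 says that z is nonzero modulo some 2ⁿ.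
_≢0 : ℤ₂-Carrier → Set
z ≢0 = ∃[ n ] ¬ (2^ n ∣ approx z n)

opaque
  2∤1 : ¬ (+ 2 ∣ 1ℤ)
  2∤1 d with ℕ∣.∣1⇒≡1 (ℤ∣.∣⇒∣ᵤ d)
  ... | ()

  1∣ : ∀ a → 1ℤ ∣ a
  1∣ a = divides a (≡.sym (ℤₚ.*-identityʳ a))

  mod-1 : ∀ {a b} → a ≡ b mod2^ 0
  mod-1 = mk (1∣ _)

  2^-nonZero : ∀ n → ℤ.NonZero (2^ n)
  2^-nonZero n = ℤ.≢-nonZero (go n)
    where
    go : ∀ n → 2^ n ≢ 0ℤ
    go zero ()
    go (suc n) eq = go n (ℤₚ.*-cancelˡ-≡ (+ 2) (2^ n) 0ℤ eq)

  2^∣2^⇒⊥ : ∀ n → ¬ (2^ suc n ∣ 2^ n)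
  2^∣2^⇒⊥ n d = 2∤1 (ℤ∣.*-cancelʳ-∣ (2^ n) {{2^-nonZero n}} (along (≡.sym (ℤₚ.*-identityˡ (2^ n))) d))

  approx-2^ : ∀ k n → approx (2ℤ₂ ^₂ k) n ≡ 2^ k
  approx-2^ zero n = ≡.refl
  approx-2^ (suc k) n = cong (+ 2 ℤ.*_) (approx-2^ k n)

  2∣₁ : ∀ z n → approx z (suc n) ≡ approx z 1 mod2^ 1
  2∣₁ z zero = mod-reflexive {1} ≡.refl
  2∣₁ z (suc n) = mod-trans {1} (weaken n (coherent z (suc n))) (2∣₁ z n)
    where
    weaken : ∀ n {a b} → a ≡ b mod2^ (suc n) → a ≡ b mod2^ 1
    weaken zero p = p
    weaken (suc n) p = weaken n (mod-weaken {suc n} p)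

  2*-cancel : ∀ {x y} → x ℤ₂.* 2ℤ₂ ≈₂ y ℤ₂.* 2ℤ₂ → x ≈₂ y
  2*-cancel {x} {y} p = mk≈₂ λ n →
    mod-trans {n} (mod-sym {n} (coherent x n)) (mod-trans {n} (halve n (at p (suc n))) (coherent y n))
    where
    lem : ∀ a b → a ℤ.* + 2 ℤ.- b ℤ.* + 2 ≡ + 2 ℤ.* (a ℤ.- b)
    lem = solve-∀
    halve : ∀ n {a b} → a ℤ.* + 2 ≡ b ℤ.* + 2 mod2^ suc n → a ≡ b mod2^ n
    halve n {a} {b} (mk q) = mk (ℤ∣.*-cancelˡ-∣ (+ 2) (along (lem a b) q))

-- The inverse of an odd z is the sum of the geometric series Σ (1 - z)ⁱ.
module OddInverse (z : ℤ₂-Carrier) (odd : ¬ (+ 2 ∣ approx z 1)) where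
  private
    geom : ℤ → ℕ → ℤ
    geom a zero = 0ℤ
    geom a (suc n) = 1ℤ ℤ.+ (1ℤ ℤ.- a) ℤ.* geom a n

    lem₀ : ∀ a g → a ℤ.* (1ℤ ℤ.+ (1ℤ ℤ.- a) ℤ.* g) ℤ.- 1ℤ ≡ (1ℤ ℤ.- a) ℤ.* (a ℤ.* g ℤ.- 1ℤ)
    lem₀ = solve-∀

    1-odd : ∀ a → ¬ (+ 2 ∣ a) → + 2 ∣ 1ℤ ℤ.- a
    1-odd a ¬p with a ℤD.% + 2 | ℤD.n%d<d a (+ 2) | ℤD.a≡a%n+[a/n]*n a (+ 2)
    ... | zero | _ | q = ⊥-elim (¬p (divides (a ℤD./ + 2) (≡.trans q (ℤₚ.+-identityˡ _))))
    ... | suc zero | _ | q = divides (ℤ.- (a ℤD./ + 2)) (≡.trans (cong (λ t → 1ℤ ℤ.- t) q) (l (a ℤD./ + 2)))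
      where
      l : ∀ b → 1ℤ ℤ.- (1ℤ ℤ.+ b ℤ.* + 2) ≡ (ℤ.- b) ℤ.* + 2
      l = solve-∀
    ... | suc (suc m) | ℕ.s≤s (ℕ.s≤s ()) | _

    geom-inv : ∀ a → + 2 ∣ 1ℤ ℤ.- a → ∀ n → a ℤ.* geom a n ≡ 1ℤ mod2^ n
    geom-inv a p zero = mod-1
    geom-inv a p (suc n) = mk (along (≡.sym (lem₀ a (geom a n)))
      (ℤ∣.∣-trans (ℤ∣.*-monoʳ-∣ (+ 2) (2^∣- (geom-inv a p n))) (ℤ∣.*-monoˡ-∣ (a ℤ.* geom a n ℤ.- 1ℤ) p)))

    inv : ∀ n → approx z n ℤ.* geom (approx z n) n ≡ 1ℤ mod2^ n
    inv zero = mod-1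
    inv (suc n) = geom-inv (approx z (suc n)) (1-odd _ odd′) (suc n)
      where
      odd′ : ¬ (+ 2 ∣ approx z (suc n))
      odd′ d = odd (mod-0⇒∣ {1} (mod-trans {1} (mod-sym {1} (2∣₁ z n)) (∣⇒mod-0 {1} d)))

    unique : ∀ n {a w w′} → a ℤ.* w ≡ 1ℤ mod2^ n → a ℤ.* w′ ≡ 1ℤ mod2^ n → w ≡ w′ mod2^ n
    unique n {a} {w} {w′} (mk p) (mk q) =
      mk (along (l a w w′) (ℤ∣.∣m∣n⇒∣m+n (ℤ∣.∣n⇒∣m*n w′ p) (ℤ∣.∣m⇒∣-m (ℤ∣.∣n⇒∣m*n w q))))
      where
      l : ∀ a w w′ → w′ ℤ.* (a ℤ.* w ℤ.- 1ℤ) ℤ.+ ℤ.- (w ℤ.* (a ℤ.* w′ ℤ.- 1ℤ)) ≡ w ℤ.- w′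
      l = solve-∀

  opaque
    inverse : ℤ₂-Carrier
    inverse = mkℤ₂ (λ n → geom (approx z n) n) λ n →
      unique n {approx z n}
        (mod-trans {n} (mod-* {n} (mod-sym {n} (coherent z n)) (mod-reflexive {n} ≡.refl)) (mod-weaken {n} (inv (suc n))))
        (inv n)

    isInverse : z ℤ₂.* inverse ≈₂ ℤ₂.1#
    isInverse = mk≈₂ inv

opaque
  halve : ∀ z → + 2 ∣ approx z 1 → ∃[ h ] (∀ n → approx h n ℤ.* + 2 ≡ approx z (suc n))
  halve z 2∣z = mkℤ₂ q coh , λ n → ≡.sym (q-eq n)
    where
    2∣z⁺ : ∀ n → + 2 ∣ approx z (suc n)
    2∣z⁺ n = mod-0⇒∣ {1} (mod-trans {1} (2∣₁ z n) (∣⇒mod-0 {1} 2∣z))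
    q : ℕ → ℤ
    q n = ℤ∣.quotient (2∣z⁺ n)
    q-eq : ∀ n → approx z (suc n) ≡ q n ℤ.* + 2
    q-eq n = ℤ∣._∣_.equality (2∣z⁺ n)
    lem : ∀ a b → a ℤ.* + 2 ℤ.- b ℤ.* + 2 ≡ + 2 ℤ.* (a ℤ.- b)
    lem = solve-∀
    coh : ∀ n → q (suc n) ≡ q n mod2^ n
    coh n = mk (ℤ∣.*-cancelˡ-∣ (+ 2)
      (along (≡.trans (≡.cong₂ ℤ._-_ (q-eq (suc n)) (q-eq n)) (lem (q (suc n)) (q n)))
        (2^∣- (coherent z (suc n)))))

  half≈ : ∀ z h → (∀ n → approx h n ℤ.* + 2 ≡ approx z (suc n)) → z ≈₂ 2ℤ₂ ℤ₂.* h
  half≈ z h h-eq = mk≈₂ λ m → mod-trans (mod-sym (coherent z m))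
    (mod-reflexive (≡.trans (≡.sym (h-eq m)) (ℤₚ.*-comm (approx h m) (+ 2))))

  half≢0 : ∀ z h → (∀ n → approx h n ℤ.* + 2 ≡ approx z (suc n)) →
           ∀ n → ¬ (2^ suc n ∣ approx z (suc n)) → ¬ (2^ n ∣ approx h n)
  half≢0 z h h-eq n ¬p d = ¬p (along (≡.trans (ℤₚ.*-comm (+ 2) (approx h n)) (h-eq n)) (ℤ∣.*-monoʳ-∣ (+ 2) d))

  half-inv : ∀ z h w j → z ≈₂ 2ℤ₂ ℤ₂.* h → h ℤ₂.* w ≈₂ 2ℤ₂ ^₂ j → z ℤ₂.* w ≈₂ 2ℤ₂ ^₂ suc j
  half-inv z h w j z≈2h hw =
    ℤ₂.trans (ℤ₂.*-congʳ z≈2h) (ℤ₂.trans (ℤ₂.*-assoc 2ℤ₂ h w) (ℤ₂.*-congˡ hw))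

  ≢0⇒∣2^ : ∀ z → z ≢0 → ∃[ j ] ∃[ w ] z ℤ₂.* w ≈₂ 2ℤ₂ ^₂ j
  ≢0⇒∣2^ z (n₀ , ¬p₀) = go z n₀ ¬p₀
    where
    go : ∀ z n → ¬ (2^ n ∣ approx z n) → ∃[ j ] ∃[ w ] z ℤ₂.* w ≈₂ 2ℤ₂ ^₂ j
    double : ∀ z h → z ≈₂ 2ℤ₂ ℤ₂.* h → ∃[ j ] ∃[ w ] h ℤ₂.* w ≈₂ 2ℤ₂ ^₂ j → ∃[ j ] ∃[ w ] z ℤ₂.* w ≈₂ 2ℤ₂ ^₂ j
    double z h e (j , w , hw) = suc j , w , half-inv z h w j e hw
    step : ∀ z n → ¬ (2^ suc n ∣ approx z (suc n)) → Dec (+ 2 ∣ approx z 1) → ∃[ j ] ∃[ w ] z ℤ₂.* w ≈₂ 2ℤ₂ ^₂ j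
    go z zero ¬p = ⊥-elim (¬p (1∣ _))
    go z (suc n) ¬p = step z n ¬p (+ 2 ∣? approx z 1)
    step z n ¬p (no odd) = 0 , OddInverse.inverse z odd , OddInverse.isInverse z odd
    step z n ¬p (yes 2∣z) =
      let h , h-eq = halve z 2∣z in
      double z h (half≈ z h h-eq) (go h n (half≢0 z h h-eq n ¬p))

  ∣2^⇒≢0 : ∀ z j w → z ℤ₂.* w ≈₂ 2ℤ₂ ^₂ j → z ≢0
  ∣2^⇒≢0 z j w eq = suc j , λ d → 2^∣2^⇒⊥ j
    (along (approx-2^ j (suc j))
      (mod-0⇒∣ {suc j} (mod-trans {suc j} (mod-sym {suc j} (at eq (suc j))) (∣⇒mod-0 {suc j} (ℤ∣.∣m⇒∣m*n _ d)))))

module Quotient (R : CommutativeRing c ℓ) (m : CommutativeRing.Carrier R) where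
  open CommutativeRing R
  open Algebra.Properties.Ring ring
  private
    module ≈ = Relation.Binary.Reasoning.Setoid setoid

  infix 4 _≈ₘ_

  record _≈ₘ_ (x y : Carrier) : Set (c ⊔ ℓ) where
    constructor multiple
    field
      quotient : Carrier
      equality : x - y ≈ quotient * m

  private
    open import Algebra.Solver.CommutativeMonoid +-commutativeMonoid using (solve; _⊜_; _⊕_)

    -‿+ : ∀ x y → - (x + y) ≈ - x + - y
    -‿+ x y = sym (-‿+-comm x y)

    ≈⇒≈ₘ : ∀ {x y} → x ≈ y → x ≈ₘ y
    ≈⇒≈ₘ {x} {y} p = multiple 0# (trans (x≈y⇒x∙y⁻¹≈ε p) (sym (zeroˡ m)))

    symₘ : ∀ {x y} → x ≈ₘ y → y ≈ₘ x
    symₘ {x} {y} (multiple q p) = multiple (- q) (≈.begin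
      y - x         ≈.≈⟨ ⁻¹-anti-homo‿- x y ⟨
      - (x - y)     ≈.≈⟨ -‿cong p ⟩
      - (q * m)     ≈.≈⟨ -‿distribˡ-* q m ⟩
      - q * m       ≈.∎)

    transₘ : ∀ {x y z} → x ≈ₘ y → y ≈ₘ z → x ≈ₘ z
    transₘ {x} {y} {z} (multiple q p) (multiple r s) = multiple (q + r) (≈.begin
      x - z               ≈.≈⟨ +-congʳ (sym (trans (+-assoc x (- y) y) (trans (+-congˡ (-‿inverseˡ y)) (+-identityʳ x)))) ⟩
      x - y + y - z       ≈.≈⟨ +-assoc (x - y) y (- z) ⟩
      x - y + (y - z)     ≈.≈⟨ +-cong p s ⟩
      q * m + r * m       ≈.≈⟨ distribʳ m q r ⟨
      (q + r) * m         ≈.∎)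

    +-congₘ : ∀ {x x′ y y′} → x ≈ₘ x′ → y ≈ₘ y′ → x + y ≈ₘ x′ + y′
    +-congₘ {x} {x′} {y} {y′} (multiple q p) (multiple r s) = multiple (q + r) (≈.begin
      x + y - (x′ + y′)        ≈.≈⟨ +-congˡ (-‿+ x′ y′) ⟩
      x + y + (- x′ - y′)      ≈.≈⟨ solve 4 (λ a b c d → (a ⊕ b) ⊕ (c ⊕ d) ⊜ (a ⊕ c) ⊕ (b ⊕ d)) refl x y (- x′) (- y′) ⟩
      x - x′ + (y - y′)        ≈.≈⟨ +-cong p s ⟩
      q * m + r * m            ≈.≈⟨ distribʳ m q r ⟨
      (q + r) * m              ≈.∎)

    -‿congₘ : ∀ {x x′} → x ≈ₘ x′ → - x ≈ₘ - x′
    -‿congₘ {x} {x′} (multiple q p) = multiple (- q) (≈.begin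
      - x - - x′     ≈.≈⟨ -‿+ x (- x′) ⟨
      - (x - x′)     ≈.≈⟨ -‿cong p ⟩
      - (q * m)      ≈.≈⟨ -‿distribˡ-* q m ⟩
      - q * m        ≈.∎)

    *-congˡₘ : ∀ {x y y′} → y ≈ₘ y′ → x * y ≈ₘ x * y′
    *-congˡₘ {x} {y} {y′} (multiple q p) = multiple (x * q) (≈.begin
      x * y - x * y′       ≈.≈⟨ +-congˡ (-‿distribʳ-* x y′) ⟩
      x * y + x * - y′     ≈.≈⟨ distribˡ x y (- y′) ⟨
      x * (y - y′)         ≈.≈⟨ *-congˡ p ⟩
      x * (q * m)          ≈.≈⟨ *-assoc x q m ⟨
      x * q * m            ≈.∎)

    *-congₘ : ∀ {x x′ y y′} → x ≈ₘ x′ → y ≈ₘ y′ → x * y ≈ₘ x′ * y′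
    *-congₘ {x} {x′} {y} {y′} p q =
      transₘ (*-congˡₘ q) (transₘ (≈⇒≈ₘ (*-comm x y′)) (transₘ (*-congˡₘ p) (≈⇒≈ₘ (*-comm y′ x′))))

  opaque
    ≈ₘ-isCommutativeRing : IsCommutativeRing _≈ₘ_ _+_ _*_ -_ 0# 1#
    ≈ₘ-isCommutativeRing = record
      { isRing = record
        { +-isAbelianGroup = record
          { isGroup = record
            { isMonoid = record
              { isSemigroup = record
                { isMagma = record
                  { isEquivalence = record { refl = ≈⇒≈ₘ refl ; sym = symₘ ; trans = transₘ }
                  ; ∙-cong = +-congₘ
                  }
                ; assoc = λ x y z → ≈⇒≈ₘ (+-assoc x y z)
                }
              ; identity = (λ x → ≈⇒≈ₘ (+-identityˡ x)) , (λ x → ≈⇒≈ₘ (+-identityʳ x))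
              }
            ; inverse = (λ x → ≈⇒≈ₘ (-‿inverseˡ x)) , (λ x → ≈⇒≈ₘ (-‿inverseʳ x))
            ; ⁻¹-cong = -‿congₘ
            }
          ; comm = λ x y → ≈⇒≈ₘ (+-comm x y)
          }
        ; *-cong = *-congₘ
        ; *-assoc = λ x y z → ≈⇒≈ₘ (*-assoc x y z)
        ; *-identity = (λ x → ≈⇒≈ₘ (*-identityˡ x)) , (λ x → ≈⇒≈ₘ (*-identityʳ x))
        ; distrib = (λ x y z → ≈⇒≈ₘ (distribˡ x y z)) , (λ x y z → ≈⇒≈ₘ (distribʳ x y z))
        }
      ; *-comm = λ x y → ≈⇒≈ₘ (*-comm x y)
      }

  quotientRing : CommutativeRing c (c ⊔ ℓ)
  quotientRing = record
    { Carrier = Carrier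
    ; _≈_ = _≈ₘ_
    ; _+_ = _+_
    ; _*_ = _*_
    ; -_ = -_
    ; 0# = 0#
    ; 1# = 1#
    ; isCommutativeRing = ≈ₘ-isCommutativeRing
    }

-- R[1/π]; cancel says that π is not a zero divisor.
module Localisation (R : CommutativeRing c ℓ) (π : CommutativeRing.Carrier R)
  (cancel : ∀ {x y} → CommutativeRing._≈_ R (CommutativeRing._*_ R x π) (CommutativeRing._*_ R y π) → CommutativeRing._≈_ R x y)
  where
  open CommutativeRing R
  open Algebra.Properties.Ring ring
  open Algebra.Properties.Semiring.Exp semiring
  private
    open import Algebra.Solver.Ring.NaturalCoefficients.Default commutativeSemiring using (solve; _:*_; _:+_; _:=_)
    module ≈ = Relation.Binary.Reasoning.Setoid setoid

  infix 6 _/π^_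
  infix 4 _≈π_

  -- Without η, so that arithmetic on variables does not unfold.
  record Fraction : Set c where
    no-eta-equality
    pattern
    constructor _/π^_
    field
      num : Carrier
      exp : ℕ

  open Fraction public

  record _≈π_ (x y : Fraction) : Set ℓ where
    constructor cross
    field
      uncross : num x * π ^ exp y ≈ num y * π ^ exp x

  open _≈π_ public

  private
    cancel^ : ∀ k {x y} → x * π ^ k ≈ y * π ^ k → x ≈ y
    cancel^ zero {x} {y} p = trans (sym (*-identityʳ x)) (trans p (*-identityʳ y))
    cancel^ (suc k) {x} {y} p =
      cancel (cancel^ k (trans (*-assoc x π (π ^ k)) (trans p (sym (*-assoc y π (π ^ k))))))

    split : ∀ a k l → a * π ^ (k ℕ.+ l) ≈ a * (π ^ k * π ^ l)
    split a k l = *-congˡ (^-homo-* π k l)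

    infixl 6 _+π_
    infixl 7 _*π_

    _+π_ _*π_ : Fraction → Fraction → Fraction
    (a /π^ k) +π (b /π^ l) = (a * π ^ l + b * π ^ k) /π^ (k ℕ.+ l)
    (a /π^ k) *π (b /π^ l) = (a * b) /π^ (k ℕ.+ l)

    -π_ : Fraction → Fraction
    -π (a /π^ k) = (- a) /π^ k

    transπ : ∀ {x y z} → x ≈π y → y ≈π z → x ≈π z
    transπ {a /π^ k} {b /π^ l} {c /π^ m} (cross p) (cross q) = cross (cancel^ l (≈.begin
      a * π ^ m * π ^ l     ≈.≈⟨ swap a (π ^ m) (π ^ l) ⟩
      a * π ^ l * π ^ m     ≈.≈⟨ *-congʳ p ⟩
      b * π ^ k * π ^ m     ≈.≈⟨ swap b (π ^ k) (π ^ m) ⟩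
      b * π ^ m * π ^ k     ≈.≈⟨ *-congʳ q ⟩
      c * π ^ l * π ^ k     ≈.≈⟨ swap c (π ^ l) (π ^ k) ⟩
      c * π ^ k * π ^ l     ≈.∎))
      where
      swap : ∀ a b c → a * b * c ≈ a * c * b
      swap = solve 3 (λ a b c → a :* b :* c := a :* c :* b) refl

    +-congπ : ∀ {x x′ y y′} → x ≈π x′ → y ≈π y′ → x +π y ≈π x′ +π y′
    +-congπ {a /π^ k} {a′ /π^ k′} {b /π^ l} {b′ /π^ l′} (cross p) (cross q) = cross (≈.begin
      (a * π ^ l + b * π ^ k) * π ^ (k′ ℕ.+ l′)
        ≈.≈⟨ split _ k′ l′ ⟩
      (a * π ^ l + b * π ^ k) * (π ^ k′ * π ^ l′)
        ≈.≈⟨ lem a b (π ^ k) (π ^ k′) (π ^ l) (π ^ l′) ⟩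
      (a * π ^ k′) * (π ^ l * π ^ l′) + (b * π ^ l′) * (π ^ k * π ^ k′)
        ≈.≈⟨ +-cong (*-congʳ p) (*-congʳ q) ⟩
      (a′ * π ^ k) * (π ^ l * π ^ l′) + (b′ * π ^ l) * (π ^ k * π ^ k′)
        ≈.≈⟨ lem′ a′ b′ (π ^ k) (π ^ k′) (π ^ l) (π ^ l′) ⟩
      (a′ * π ^ l′ + b′ * π ^ k′) * (π ^ k * π ^ l)
        ≈.≈⟨ split _ k l ⟨
      (a′ * π ^ l′ + b′ * π ^ k′) * π ^ (k ℕ.+ l)
        ≈.∎)
      where
      lem : ∀ a b k k′ l l′ → (a * l + b * k) * (k′ * l′) ≈ (a * k′) * (l * l′) + (b * l′) * (k * k′)
      lem = solve 6 (λ a b k k′ l l′ → (a :* l :+ b :* k) :* (k′ :* l′) := (a :* k′) :* (l :* l′) :+ (b :* l′) :* (k :* k′)) refl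
      lem′ : ∀ a b k k′ l l′ → (a * k) * (l * l′) + (b * l) * (k * k′) ≈ (a * l′ + b * k′) * (k * l)
      lem′ = solve 6 (λ a b k k′ l l′ → (a :* k) :* (l :* l′) :+ (b :* l) :* (k :* k′) := (a :* l′ :+ b :* k′) :* (k :* l)) refl

    *-congπ : ∀ {x x′ y y′} → x ≈π x′ → y ≈π y′ → x *π y ≈π x′ *π y′
    *-congπ {a /π^ k} {a′ /π^ k′} {b /π^ l} {b′ /π^ l′} (cross p) (cross q) = cross (≈.begin
      (a * b) * π ^ (k′ ℕ.+ l′)            ≈.≈⟨ split _ k′ l′ ⟩
      (a * b) * (π ^ k′ * π ^ l′)          ≈.≈⟨ lem a b (π ^ k′) (π ^ l′) ⟩
      (a * π ^ k′) * (b * π ^ l′)          ≈.≈⟨ *-cong p q ⟩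
      (a′ * π ^ k) * (b′ * π ^ l)          ≈.≈⟨ lem a′ b′ (π ^ k) (π ^ l) ⟨
      (a′ * b′) * (π ^ k * π ^ l)          ≈.≈⟨ split _ k l ⟨
      (a′ * b′) * π ^ (k ℕ.+ l)            ≈.∎)
      where
      lem : ∀ a b k l → (a * b) * (k * l) ≈ (a * k) * (b * l)
      lem = solve 4 (λ a b k l → (a :* b) :* (k :* l) := (a :* k) :* (b :* l)) refl

    -‿congπ : ∀ {x x′} → x ≈π x′ → -π x ≈π -π x′
    -‿congπ {a /π^ k} {a′ /π^ k′} (cross p) = cross
      (trans (sym (-‿distribˡ-* a (π ^ k′))) (trans (-‿cong p) (-‿distribˡ-* a′ (π ^ k))))

    exact : ∀ {a b k l} → a ≈ b → k ≡ l → a /π^ k ≈π b /π^ l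
    exact p ≡.refl = cross (*-congʳ p)

    +-assocπ : ∀ x y z → (x +π y) +π z ≈π x +π (y +π z)
    +-assocπ (a /π^ k) (b /π^ l) (c /π^ m) = exact (≈.begin
      (a * π ^ l + b * π ^ k) * π ^ m + c * π ^ (k ℕ.+ l)
        ≈.≈⟨ +-congˡ (split c k l) ⟩
      (a * π ^ l + b * π ^ k) * π ^ m + c * (π ^ k * π ^ l)
        ≈.≈⟨ lem a b c (π ^ k) (π ^ l) (π ^ m) ⟩
      a * (π ^ l * π ^ m) + (b * π ^ m + c * π ^ l) * π ^ k
        ≈.≈⟨ +-congʳ (split a l m) ⟨
      a * π ^ (l ℕ.+ m) + (b * π ^ m + c * π ^ l) * π ^ k ≈.∎)
      (ℕₚ.+-assoc k l m)
      where
      lem : ∀ a b c k l m → (a * l + b * k) * m + c * (k * l) ≈ a * (l * m) + (b * m + c * l) * k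
      lem = solve 6 (λ a b c k l m → (a :* l :+ b :* k) :* m :+ c :* (k :* l) := a :* (l :* m) :+ (b :* m :+ c :* l) :* k) refl

    distribˡπ : ∀ x y z → x *π (y +π z) ≈π (x *π y) +π (x *π z)
    distribˡπ (a /π^ k) (b /π^ l) (c /π^ m) = cross (≈.begin
      (a * (b * π ^ m + c * π ^ l)) * π ^ ((k ℕ.+ l) ℕ.+ (k ℕ.+ m))
        ≈.≈⟨ split₂ _ ⟩
      (a * (b * π ^ m + c * π ^ l)) * ((π ^ k * π ^ l) * (π ^ k * π ^ m))
        ≈.≈⟨ lem a b c (π ^ k) (π ^ l) (π ^ m) ⟩
      (a * b * (π ^ k * π ^ m) + a * c * (π ^ k * π ^ l)) * (π ^ k * (π ^ l * π ^ m))
        ≈.≈⟨ *-cong (+-cong (split (a * b) k m) (split (a * c) k l)) (trans (^-homo-* π k (l ℕ.+ m)) (*-congˡ (^-homo-* π l m))) ⟨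
      (a * b * π ^ (k ℕ.+ m) + a * c * π ^ (k ℕ.+ l)) * π ^ (k ℕ.+ (l ℕ.+ m))
        ≈.∎)
      where
      split₂ : ∀ t → t * π ^ ((k ℕ.+ l) ℕ.+ (k ℕ.+ m)) ≈ t * ((π ^ k * π ^ l) * (π ^ k * π ^ m))
      split₂ t = trans (split t (k ℕ.+ l) (k ℕ.+ m)) (*-congˡ (*-cong (^-homo-* π k l) (^-homo-* π k m)))
      lem : ∀ a b c k l m → (a * (b * m + c * l)) * ((k * l) * (k * m)) ≈ (a * b * (k * m) + a * c * (k * l)) * (k * (l * m))
      lem = solve 6 (λ a b c k l m → (a :* (b :* m :+ c :* l)) :* ((k :* l) :* (k :* m)) := (a :* b :* (k :* m) :+ a :* c :* (k :* l)) :* (k :* (l :* m))) refl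

    +-commπ : ∀ x y → x +π y ≈π y +π x
    +-commπ (a /π^ k) (b /π^ l) = exact (+-comm _ _) (ℕₚ.+-comm k l)

    *-commπ : ∀ x y → x *π y ≈π y *π x
    *-commπ (a /π^ k) (b /π^ l) = exact (*-comm _ _) (ℕₚ.+-comm k l)

    0π 1π : Fraction
    0π = 0# /π^ 0
    1π = 1# /π^ 0

    +-identityˡπ : ∀ x → 0π +π x ≈π x
    +-identityˡπ (a /π^ k) = exact
      (trans (+-cong (zeroˡ (π ^ k)) (*-identityʳ a)) (+-identityˡ a)) ≡.refl

    *-identityˡπ : ∀ x → 1π *π x ≈π x
    *-identityˡπ (a /π^ k) = exact (*-identityˡ a) ≡.refl

    -‿inverseˡπ : ∀ x → (-π x) +π x ≈π 0π
    -‿inverseˡπ (a /π^ k) = cross (*-cong₀ (trans (sym (distribʳ (π ^ k) (- a) a)) (trans (*-congʳ (-‿inverseˡ a)) (zeroˡ (π ^ k)))))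
      where
      *-cong₀ : ∀ {t u v} → t ≈ 0# → t * u ≈ 0# * v
      *-cong₀ {t} {u} {v} p = trans (*-congʳ p) (trans (zeroˡ u) (sym (zeroˡ v)))

  opaque
    π-isCommutativeRing : IsCommutativeRing _≈π_ _+π_ _*π_ -π_ 0π 1π
    π-isCommutativeRing = record
      { isRing = record
        { +-isAbelianGroup = record
          { isGroup = record
            { isMonoid = record
              { isSemigroup = record
                { isMagma = record
                  { isEquivalence = record { refl = cross refl ; sym = λ p → cross (sym (uncross p)) ; trans = transπ }
                  ; ∙-cong = +-congπ
                  }
                ; assoc = +-assocπ
                }
              ; identity = +-identityˡπ , λ x → transπ (+-commπ x 0π) (+-identityˡπ x)
              }
            ; inverse = -‿inverseˡπ , λ x → transπ (+-commπ x (-π x)) (-‿inverseˡπ x)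
            ; ⁻¹-cong = -‿congπ
            }
          ; comm = +-commπ
          }
        ; *-cong = *-congπ
        ; *-assoc = λ { (a /π^ k) (b /π^ l) (c /π^ m) → exact (*-assoc a b c) (ℕₚ.+-assoc k l m) }
        ; *-identity = *-identityˡπ , λ x → transπ (*-commπ x 1π) (*-identityˡπ x)
        ; distrib = distribˡπ , λ x y z → transπ (*-commπ (y +π z) x) (transπ (distribˡπ x y z) (+-congπ (*-commπ x y) (*-commπ x z)))
        }
      ; *-comm = *-commπ
      }

  fractionRing : CommutativeRing c ℓ
  fractionRing = record
    { Carrier = Fraction
    ; _≈_ = _≈π_
    ; _+_ = _+π_
    ; _*_ = _*π_
    ; -_ = -π_
    ; 0# = 0π
    ; 1# = 1π
    ; isCommutativeRing = π-isCommutativeRing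
    }

ringOf : HeytingField c ℓ₁ ℓ₂ → CommutativeRing c ℓ₁
ringOf K = HeytingCommutativeRing.commutativeRing (HeytingField.heytingCommutativeRing K)

-- A local ring in which non-units vanish, with x # y meaning that x - y is a unit.
module LocalRingField
  (R : CommutativeRing c ℓ)
  (Unit : Pred (CommutativeRing.Carrier R) ℓ′)
  where
  open CommutativeRing R
  open Algebra.Properties.Ring ring
  module _
    (unit⇒inverse : ∀ x → Unit x → ∃[ y ] x * y ≈ 1#)
    (inverse⇒unit : ∀ x y → x * y ≈ 1# → Unit x)
    (local : ∀ x y → Unit (x + y) → Unit x ⊎ Unit y)
    (nonunit⇒0 : ∀ x → ¬ Unit x → x ≈ 0#)
    (0-nonunit : ¬ Unit 0#)
    where
    private
      resp : ∀ {x y} → x ≈ y → Unit x → Unit y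
      resp p u = let z , q = unit⇒inverse _ u in inverse⇒unit _ z (trans (*-congʳ (sym p)) q)

      neg : ∀ {x} → Unit x → Unit (- x)
      neg {x} u = let z , q = unit⇒inverse _ u in
        inverse⇒unit _ (- z) (trans (sym (-‿distribˡ-* x (- z)))
          (trans (-‿cong (sym (-‿distribʳ-* x z))) (trans (-‿involutive (x * z)) q)))

      telescope : ∀ x y z → x - y ≈ (x - z) + (z - y)
      telescope x y z = sym (trans (+-assoc x (- z) (z - y))
        (+-congˡ (trans (sym (+-assoc (- z) z (- y))) (trans (+-congʳ (-‿inverseˡ z)) (+-identityˡ (- y))))))

      _#_ : Carrier → Carrier → Set ℓ′
      x # y = Unit (x - y)

    opaque
      #-isApartnessRelation : IsApartnessRelation _≈_ _#_
      #-isApartnessRelation = record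
        { irrefl = λ p u → 0-nonunit (resp (x≈y⇒x∙y⁻¹≈ε p) u)
        ; sym = λ {x} {y} u → resp (⁻¹-anti-homo‿- x y) (neg u)
        ; cotrans = λ {x} {y} u z → local (x - z) (z - y) (resp (telescope x y z) u)
        }

      #⇒invertible : ∀ {x y} → x # y → Invertible _≈_ 1# _*_ (x - y)
      #⇒invertible u = let z , q = unit⇒inverse _ u in z , trans (*-comm z _) q , q

      invertible⇒# : ∀ {x y} → Invertible _≈_ 1# _*_ (x - y) → x # y
      invertible⇒# (z , _ , q) = inverse⇒unit _ z q

      #-tight : Tight _≈_ _#_
      #-tight x y =
          (λ ¬u → x∙y⁻¹≈ε⇒x≈y x y (nonunit⇒0 (x - y) ¬u))
        , (λ p u → 0-nonunit (resp (x≈y⇒x∙y⁻¹≈ε p) u))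

    heytingField : HeytingField c ℓ ℓ′
    heytingField = record
      { isHeytingField = record
        { isHeytingCommutativeRing = record
          { isCommutativeRing = isCommutativeRing
          ; isApartnessRelation = #-isApartnessRelation
          ; #⇒invertible = #⇒invertible
          ; invertible⇒# = invertible⇒#
          }
        ; tight = #-tight
        }
      }

module ℚ₂-Fractions = Localisation ℤ₂ 2ℤ₂ 2*-cancel
open ℚ₂-Fractions public using (num; exp) renaming (_/π^_ to _/2^_)

module _ where
  open CommutativeRing ℚ₂-Fractions.fractionRing
  open ℚ₂-Fractions using (cross; uncross)
  private
    open Algebra.Properties.Semiring.Exp ℤ₂.semiring using (_^_; ^-homo-*)

    opaque
      unit⇒inverse : ∀ x → num x ≢0 → ∃[ y ] x * y ≈ 1#
      unit⇒inverse (z /2^ k) u =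
        let j , w , zw≈2^j = ≢0⇒∣2^ z u in
        (w ℤ₂.* 2ℤ₂ ^ k) /2^ j ,
        cross (ℤ₂.trans (ℤ₂.*-identityʳ _) (ℤ₂.trans (ℤ₂.sym (ℤ₂.*-assoc z w (2ℤ₂ ^ k)))
          (ℤ₂.trans (ℤ₂.*-congʳ zw≈2^j) (ℤ₂.trans (ℤ₂.*-comm (2ℤ₂ ^ j) (2ℤ₂ ^ k))
            (ℤ₂.trans (ℤ₂.sym (^-homo-* 2ℤ₂ k j)) (ℤ₂.sym (ℤ₂.*-identityˡ _)))))))

      inverse⇒unit : ∀ x y → x * y ≈ 1# → num x ≢0
      inverse⇒unit (z /2^ k) (w /2^ l) (cross p) =
        ∣2^⇒≢0 z (k ℕ.+ l) w (ℤ₂.trans (ℤ₂.sym (ℤ₂.*-identityʳ _)) (ℤ₂.trans p (ℤ₂.*-identityˡ _)))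

      local : ∀ x y → num (x + y) ≢0 → num x ≢0 ⊎ num y ≢0
      local (a /2^ k) (b /2^ l) (n , ¬p) with 2^ n ℤ∣.∣? approx a n
      ... | no ¬a = inj₁ (n , ¬a)
      ... | yes a∣ = inj₂ (n , λ b∣ → ¬p (ℤ∣.∣m∣n⇒∣m+n (ℤ∣.∣m⇒∣m*n _ a∣) (ℤ∣.∣m⇒∣m*n _ b∣)))

      nonunit⇒0 : ∀ x → ¬ (num x ≢0) → x ≈ 0#
      nonunit⇒0 (a /2^ k) ¬u = cross (ℤ₂.trans (ℤ₂.*-congʳ a≈0) (ℤ₂.trans (ℤ₂.zeroˡ _) (ℤ₂.sym (ℤ₂.zeroˡ _))))
        where
        a≈0 : a ≈₂ ℤ₂.0#
        a≈0 = mk≈₂ λ n → ∣⇒mod-0 (decidable-stable (2^ n ℤ∣.∣? approx a n) λ ¬d → ¬u (n , ¬d))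

      0-nonunit : ¬ (num 0# ≢0)
      0-nonunit (n , ¬d) = ¬d (ℤ∣.divides ℤ.0ℤ ≡.refl)

  ℚ₂ : HeytingField 0ℓ 0ℓ 0ℓ
  ℚ₂ = LocalRingField.heytingField ℚ₂-Fractions.fractionRing (λ x → num x ≢0)
         unit⇒inverse inverse⇒unit local nonunit⇒0 0-nonunit

module ℚ₂ = HeytingField ℚ₂

ℤ₂→ℚ₂ : ℤ₂.Carrier → ℚ₂.Carrier
ℤ₂→ℚ₂ z = z /2^ 0

-- The residue field 𝔽₂ = ℤ₂/(2); on underlying elements the reduction map is the identity.
module _ where
  open Quotient ℤ₂ 2ℤ₂ using (_≈ₘ_; multiple; quotientRing)
  open CommutativeRing quotientRing
  private
    even⇒0 : ∀ x → (ℤ.+ 2) ℤ∣.∣ approx x 1 → x ≈ 0#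
    even⇒0 x d = let h , h-eq = halve x d in
      multiple h (ℤ₂.trans (ℤ₂.trans (ℤ₂.+-congˡ -0#≈0#) (ℤ₂.+-identityʳ x)) (ℤ₂.trans (half≈ x h h-eq) (ℤ₂.*-comm 2ℤ₂ h)))
      where open Algebra.Properties.Ring ℤ₂.ring using (-0#≈0#)

    0⇒even : ∀ x y → x ≈ y → approx x 1 ≡ approx y 1 mod2^ 1
    0⇒even x y (multiple q p) = mk (2∣- (approx x 1 ℤ.- approx y 1) (at p 1))
      where
      2∣- : ∀ a → a ≡ approx q 1 ℤ.* ℤ.+ 2 mod2^ 1 → (ℤ.+ 2) ℤ∣.∣ a
      2∣- a e = mod-0⇒∣ {1} (mod-trans e (∣⇒mod-0 (ℤ∣.divides (approx q 1) ≡.refl)))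

    Odd : Pred Carrier 0ℓ
    Odd x = ¬ ((ℤ.+ 2) ℤ∣.∣ approx x 1)

    ≈⇒≈ₘ : ∀ {x y} → x ≈₂ y → x ≈ y
    ≈⇒≈ₘ {x} {y} p = multiple ℤ₂.0# (ℤ₂.trans (x≈y⇒x∙y⁻¹≈ε p) (ℤ₂.sym (ℤ₂.zeroˡ 2ℤ₂)))
      where open Algebra.Properties.Ring ℤ₂.ring using (x≈y⇒x∙y⁻¹≈ε)

    opaque
      unit⇒inverse : ∀ x → Odd x → ∃[ y ] x * y ≈ 1#
      unit⇒inverse x odd = OddInverse.inverse x odd , ≈⇒≈ₘ (OddInverse.isInverse x odd)

      inverse⇒unit : ∀ x y → x * y ≈ 1# → Odd x
      inverse⇒unit x y p d = 2∤1 (mod-0⇒∣ {1} (mod-trans (mod-sym (0⇒even (x * y) 1# p)) (∣⇒mod-0 (ℤ∣.∣m⇒∣m*n (approx y 1) d))))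

      local : ∀ x y → Odd (x + y) → Odd x ⊎ Odd y
      local x y odd with (ℤ.+ 2) ℤ∣.∣? approx x 1
      ... | no ¬x = inj₁ ¬x
      ... | yes x∣ = inj₂ λ y∣ → odd (ℤ∣.∣m∣n⇒∣m+n x∣ y∣)
      nonunit⇒0 : ∀ x → ¬ Odd x → x ≈ 0#
      nonunit⇒0 x ¬odd = even⇒0 x (decidable-stable ((ℤ.+ 2) ℤ∣.∣? approx x 1) ¬odd)

      0-nonunit : ¬ Odd 0#
      0-nonunit odd = odd (ℤ∣.divides ℤ.0ℤ ≡.refl)

  𝔽₂ : HeytingField 0ℓ 0ℓ 0ℓ
  𝔽₂ = LocalRingField.heytingField quotientRing Odd unit⇒inverse inverse⇒unit local
         nonunit⇒0 0-nonunit

module 𝔽₂ = HeytingField 𝔽₂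

module Polynomial (R : CommutativeRing c ℓ) where
  open CommutativeRing R
  private
    module ≈ = Relation.Binary.Reasoning.Setoid setoid
    open Algebra.Properties.Ring ring using (-0#≈0#)

  -- Coefficients, constant term first; trailing zeros are immaterial.
  Poly : Set c
  Poly = List Carrier

  coeff : Poly → ℕ → Carrier
  coeff [] n = 0#
  coeff (a ∷ f) zero = a
  coeff (a ∷ f) (ℕ.suc n) = coeff f n

  infix 4 _≈ₚ_

  record _≈ₚ_ (f g : Poly) : Set ℓ where
    constructor coeffwise
    field
      coeff≈ : ∀ n → coeff f n ≈ coeff g n

  open _≈ₚ_ public

  infix 8 -ₚ_
  infixl 6 _+ₚ_
  infixl 7 _*ₚ_ _·ₚ_

  _+ₚ_ : Poly → Poly → Poly
  [] +ₚ g = g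
  (a ∷ f) +ₚ [] = a ∷ f
  (a ∷ f) +ₚ (b ∷ g) = (a + b) ∷ (f +ₚ g)

  -ₚ_ : Poly → Poly
  -ₚ_ = map (-_)

  _·ₚ_ : Carrier → Poly → Poly
  a ·ₚ f = map (a *_) f

  _*ₚ_ : Poly → Poly → Poly
  [] *ₚ g = []
  (a ∷ f) *ₚ g = a ·ₚ g +ₚ (0# ∷ f *ₚ g)

  eval : Poly → Carrier → Carrier
  eval [] x = 0#
  eval (a ∷ f) x = a + x * eval f x

  private
    coeff-+ : ∀ f g n → coeff (f +ₚ g) n ≈ coeff f n + coeff g n
    coeff-+ [] g n = sym (+-identityˡ _)
    coeff-+ (a ∷ f) [] n = sym (+-identityʳ _)
    coeff-+ (a ∷ f) (b ∷ g) zero = refl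
    coeff-+ (a ∷ f) (b ∷ g) (ℕ.suc n) = coeff-+ f g n

    coeff-neg : ∀ f n → coeff (-ₚ f) n ≈ - coeff f n
    coeff-neg [] n = sym -0#≈0#
    coeff-neg (a ∷ f) zero = refl
    coeff-neg (a ∷ f) (ℕ.suc n) = coeff-neg f n

    coeff-· : ∀ a f n → coeff (a ·ₚ f) n ≈ a * coeff f n
    coeff-· a [] n = sym (zeroʳ a)
    coeff-· a (b ∷ f) zero = refl
    coeff-· a (b ∷ f) (ℕ.suc n) = coeff-· a f n

    reflₚ : ∀ {f} → f ≈ₚ f
    reflₚ = coeffwise λ n → refl

    symₚ : ∀ {f g} → f ≈ₚ g → g ≈ₚ f
    symₚ p = coeffwise λ n → sym (coeff≈ p n)

    transₚ : ∀ {f g h} → f ≈ₚ g → g ≈ₚ h → f ≈ₚ h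
    transₚ p q = coeffwise λ n → trans (coeff≈ p n) (coeff≈ q n)

    polySetoid : Setoid c ℓ
    polySetoid = record { Carrier = Poly ; _≈_ = _≈ₚ_ ; isEquivalence = record { refl = reflₚ ; sym = symₚ ; trans = transₚ } }

    module ≋ = Relation.Binary.Reasoning.Setoid polySetoid

    +-congₚ : ∀ {f f′ g g′} → f ≈ₚ f′ → g ≈ₚ g′ → f +ₚ g ≈ₚ f′ +ₚ g′
    +-congₚ {f} {f′} {g} {g′} p q = coeffwise λ n →
      trans (coeff-+ f g n) (trans (+-cong (coeff≈ p n) (coeff≈ q n)) (sym (coeff-+ f′ g′ n)))

    +-assocₚ : ∀ f g h → (f +ₚ g) +ₚ h ≈ₚ f +ₚ (g +ₚ h)
    +-assocₚ f g h = coeffwise λ n → ≈.begin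
      coeff ((f +ₚ g) +ₚ h) n                ≈.≈⟨ trans (coeff-+ (f +ₚ g) h n) (+-congʳ (coeff-+ f g n)) ⟩
      coeff f n + coeff g n + coeff h n      ≈.≈⟨ +-assoc _ _ _ ⟩
      coeff f n + (coeff g n + coeff h n)    ≈.≈⟨ trans (coeff-+ f (g +ₚ h) n) (+-congˡ (coeff-+ g h n)) ⟨
      coeff (f +ₚ (g +ₚ h)) n                ≈.∎

    +-commₚ : ∀ f g → f +ₚ g ≈ₚ g +ₚ f
    +-commₚ f g = coeffwise λ n → trans (coeff-+ f g n) (trans (+-comm _ _) (sym (coeff-+ g f n)))

    +-identityʳₚ : ∀ f → f +ₚ [] ≈ₚ f
    +-identityʳₚ [] = reflₚ
    +-identityʳₚ (a ∷ f) = reflₚ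

    -‿congₚ : ∀ {f g} → f ≈ₚ g → -ₚ f ≈ₚ -ₚ g
    -‿congₚ {f} {g} p = coeffwise λ n → trans (coeff-neg f n) (trans (-‿cong (coeff≈ p n)) (sym (coeff-neg g n)))

    -‿inverseˡₚ : ∀ f → -ₚ f +ₚ f ≈ₚ []
    -‿inverseˡₚ f = coeffwise λ n →
      trans (coeff-+ (-ₚ f) f n) (trans (+-congʳ (coeff-neg f n)) (-‿inverseˡ (coeff f n)))

    interchange : ∀ f g h k → (f +ₚ g) +ₚ (h +ₚ k) ≈ₚ (f +ₚ h) +ₚ (g +ₚ k)
    interchange f g h k = coeffwise λ n → ≈.begin
      coeff ((f +ₚ g) +ₚ (h +ₚ k)) n
        ≈.≈⟨ trans (coeff-+ (f +ₚ g) (h +ₚ k) n) (+-cong (coeff-+ f g n) (coeff-+ h k n)) ⟩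
      (coeff f n + coeff g n) + (coeff h n + coeff k n)
        ≈.≈⟨ solve 4 (λ a b c d → (a ⊕ b) ⊕ (c ⊕ d) ⊜ (a ⊕ c) ⊕ (b ⊕ d)) refl _ _ _ _ ⟩
      (coeff f n + coeff h n) + (coeff g n + coeff k n)
        ≈.≈⟨ trans (coeff-+ (f +ₚ h) (g +ₚ k) n) (+-cong (coeff-+ f h n) (coeff-+ g k n)) ⟨
      coeff ((f +ₚ h) +ₚ (g +ₚ k)) n
        ≈.∎
      where open Algebra.Solver.CommutativeMonoid +-commutativeMonoid using (solve; _⊜_; _⊕_)

    ∷-cong : ∀ {a b f g} → a ≈ b → f ≈ₚ g → a ∷ f ≈ₚ b ∷ g
    ∷-cong p q = coeffwise λ { zero → p ; (ℕ.suc n) → coeff≈ q n }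

    ·-cong : ∀ {a b f g} → a ≈ b → f ≈ₚ g → a ·ₚ f ≈ₚ b ·ₚ g
    ·-cong {a} {b} {f} {g} p q = coeffwise λ n →
      trans (coeff-· a f n) (trans (*-cong p (coeff≈ q n)) (sym (coeff-· b g n)))

    ·-distribˡ : ∀ a f g → a ·ₚ (f +ₚ g) ≈ₚ a ·ₚ f +ₚ a ·ₚ g
    ·-distribˡ a f g = coeffwise λ n → ≈.begin
      coeff (a ·ₚ (f +ₚ g)) n            ≈.≈⟨ trans (coeff-· a (f +ₚ g) n) (*-congˡ (coeff-+ f g n)) ⟩
      a * (coeff f n + coeff g n)        ≈.≈⟨ distribˡ a _ _ ⟩
      a * coeff f n + a * coeff g n      ≈.≈⟨ trans (coeff-+ (a ·ₚ f) (a ·ₚ g) n) (+-cong (coeff-· a f n) (coeff-· a g n)) ⟨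
      coeff (a ·ₚ f +ₚ a ·ₚ g) n         ≈.∎

    ·-assoc : ∀ a b f → a ·ₚ (b ·ₚ f) ≈ₚ (a * b) ·ₚ f
    ·-assoc a b f = coeffwise λ n →
      trans (coeff-· a (b ·ₚ f) n) (trans (*-congˡ (coeff-· b f n))
        (trans (sym (*-assoc a b _)) (sym (coeff-· (a * b) f n))))

    0·ₚ : ∀ f → 0# ·ₚ f ≈ₚ []
    0·ₚ f = coeffwise λ n → trans (coeff-· 0# f n) (zeroˡ _)

    1·ₚ : ∀ f → 1# ·ₚ f ≈ₚ f
    1·ₚ f = coeffwise λ n → trans (coeff-· 1# f n) (*-identityˡ _)

    0∷[] : 0# ∷ [] ≈ₚ []
    0∷[] = coeffwise λ { zero → refl ; (ℕ.suc n) → refl }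

    shift-+ : ∀ f g → 0# ∷ (f +ₚ g) ≈ₚ (0# ∷ f) +ₚ (0# ∷ g)
    shift-+ f g = ∷-cong (sym (+-identityʳ 0#)) reflₚ

    shift-· : ∀ a f → a ·ₚ (0# ∷ f) ≈ₚ 0# ∷ a ·ₚ f
    shift-· a f = ∷-cong (zeroʳ a) reflₚ

    *-zeroʳₚ : ∀ f → f *ₚ [] ≈ₚ []
    *-zeroʳₚ [] = reflₚ
    *-zeroʳₚ (a ∷ f) = transₚ (∷-cong refl (*-zeroʳₚ f)) 0∷[]

    *-congʳ′ : ∀ f {g g′} → g ≈ₚ g′ → f *ₚ g ≈ₚ f *ₚ g′
    *-congʳ′ [] p = reflₚ
    *-congʳ′ (a ∷ f) p = +-congₚ (·-cong refl p) (∷-cong refl (*-congʳ′ f p))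

    *-∷ʳ : ∀ f b g → f *ₚ (b ∷ g) ≈ₚ b ·ₚ f +ₚ (0# ∷ f *ₚ g)
    *-∷ʳ [] b g = symₚ 0∷[]
    *-∷ʳ (a ∷ f) b g = ∷-cong (+-congʳ (*-comm a b)) (≋.begin
      a ·ₚ g +ₚ f *ₚ (b ∷ g)                      ≋.≈⟨ +-congₚ (reflₚ {a ·ₚ g}) (*-∷ʳ f b g) ⟩
      a ·ₚ g +ₚ (b ·ₚ f +ₚ (0# ∷ f *ₚ g))         ≋.≈⟨ +-assocₚ (a ·ₚ g) (b ·ₚ f) (0# ∷ f *ₚ g) ⟨
      (a ·ₚ g +ₚ b ·ₚ f) +ₚ (0# ∷ f *ₚ g)         ≋.≈⟨ +-congₚ (+-commₚ (a ·ₚ g) (b ·ₚ f)) reflₚ ⟩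
      (b ·ₚ f +ₚ a ·ₚ g) +ₚ (0# ∷ f *ₚ g)         ≋.≈⟨ +-assocₚ (b ·ₚ f) (a ·ₚ g) (0# ∷ f *ₚ g) ⟩
      b ·ₚ f +ₚ (a ·ₚ g +ₚ (0# ∷ f *ₚ g))         ≋.∎)

    *-commₚ : ∀ f g → f *ₚ g ≈ₚ g *ₚ f
    *-commₚ [] g = symₚ (*-zeroʳₚ g)
    *-commₚ (a ∷ f) g = transₚ (+-congₚ (reflₚ {a ·ₚ g}) (∷-cong refl (*-commₚ f g))) (symₚ (*-∷ʳ g a f))

    *-congₚ : ∀ {f f′ g g′} → f ≈ₚ f′ → g ≈ₚ g′ → f *ₚ g ≈ₚ f′ *ₚ g′
    *-congₚ {f} {f′} {g} {g′} p q = transₚ (*-congʳ′ f q)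
      (transₚ (*-commₚ f g′) (transₚ (*-congʳ′ g′ p) (*-commₚ g′ f′)))

    *-distribˡₚ : ∀ f g h → f *ₚ (g +ₚ h) ≈ₚ f *ₚ g +ₚ f *ₚ h
    *-distribˡₚ [] g h = reflₚ
    *-distribˡₚ (a ∷ f) g h = ≋.begin
      a ·ₚ (g +ₚ h) +ₚ (0# ∷ f *ₚ (g +ₚ h))
        ≋.≈⟨ +-congₚ (·-distribˡ a g h) (transₚ (∷-cong refl (*-distribˡₚ f g h)) (shift-+ (f *ₚ g) (f *ₚ h))) ⟩
      (a ·ₚ g +ₚ a ·ₚ h) +ₚ ((0# ∷ f *ₚ g) +ₚ (0# ∷ f *ₚ h))
        ≋.≈⟨ interchange (a ·ₚ g) (a ·ₚ h) (0# ∷ f *ₚ g) (0# ∷ f *ₚ h) ⟩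
      (a ·ₚ g +ₚ (0# ∷ f *ₚ g)) +ₚ (a ·ₚ h +ₚ (0# ∷ f *ₚ h))
        ≋.∎

    *-distribʳₚ : ∀ f g h → (g +ₚ h) *ₚ f ≈ₚ g *ₚ f +ₚ h *ₚ f
    *-distribʳₚ f g h = transₚ (*-commₚ (g +ₚ h) f)
      (transₚ (*-distribˡₚ f g h) (+-congₚ (*-commₚ f g) (*-commₚ f h)))

    ·-*-assoc : ∀ a f g → (a ·ₚ f) *ₚ g ≈ₚ a ·ₚ (f *ₚ g)
    ·-*-assoc a [] g = reflₚ
    ·-*-assoc a (b ∷ f) g = ≋.begin
      (a * b) ·ₚ g +ₚ (0# ∷ (a ·ₚ f) *ₚ g)
        ≋.≈⟨ +-congₚ (symₚ (·-assoc a b g)) (transₚ (∷-cong refl (·-*-assoc a f g)) (symₚ (shift-· a (f *ₚ g)))) ⟩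
      a ·ₚ (b ·ₚ g) +ₚ a ·ₚ (0# ∷ f *ₚ g)
        ≋.≈⟨ ·-distribˡ a (b ·ₚ g) (0# ∷ f *ₚ g) ⟨
      a ·ₚ (b ·ₚ g +ₚ (0# ∷ f *ₚ g))
        ≋.∎

    *-assocₚ : ∀ f g h → (f *ₚ g) *ₚ h ≈ₚ f *ₚ (g *ₚ h)
    *-assocₚ [] g h = reflₚ
    *-assocₚ (a ∷ f) g h = ≋.begin
      (a ·ₚ g +ₚ (0# ∷ f *ₚ g)) *ₚ h
        ≋.≈⟨ *-distribʳₚ h (a ·ₚ g) (0# ∷ f *ₚ g) ⟩
      (a ·ₚ g) *ₚ h +ₚ (0# ·ₚ h +ₚ (0# ∷ (f *ₚ g) *ₚ h))
        ≋.≈⟨ +-congₚ (·-*-assoc a g h) (+-congₚ (0·ₚ h) (∷-cong refl (*-assocₚ f g h))) ⟩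
      a ·ₚ (g *ₚ h) +ₚ (0# ∷ f *ₚ (g *ₚ h))
        ≋.∎

    *-identityˡₚ : ∀ f → (1# ∷ []) *ₚ f ≈ₚ f
    *-identityˡₚ f = transₚ (+-congₚ (1·ₚ f) 0∷[]) (+-identityʳₚ f)

  opaque
    ≈ₚ-isCommutativeRing : IsCommutativeRing _≈ₚ_ _+ₚ_ _*ₚ_ -ₚ_ [] [ 1# ]
    ≈ₚ-isCommutativeRing = record
      { isRing = record
        { +-isAbelianGroup = record
          { isGroup = record
            { isMonoid = record
              { isSemigroup = record
                { isMagma = record
                  { isEquivalence = record { refl = reflₚ ; sym = symₚ ; trans = transₚ }
                  ; ∙-cong = +-congₚ
                  }
                ; assoc = +-assocₚ
                }
              ; identity = (λ f → reflₚ) , +-identityʳₚ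
              }
            ; inverse = -‿inverseˡₚ , λ f → transₚ (+-commₚ f (-ₚ f)) (-‿inverseˡₚ f)
            ; ⁻¹-cong = -‿congₚ
            }
          ; comm = +-commₚ
          }
        ; *-cong = *-congₚ
        ; *-assoc = *-assocₚ
        ; *-identity = *-identityˡₚ , λ f → transₚ (*-commₚ f (1# ∷ [])) (*-identityˡₚ f)
        ; distrib = *-distribˡₚ , *-distribʳₚ
        }
      ; *-comm = *-commₚ
      }

  polynomialRing : CommutativeRing c ℓ
  polynomialRing = record
    { Carrier = Poly
    ; _≈_ = _≈ₚ_
    ; _+_ = _+ₚ_
    ; _*_ = _*ₚ_
    ; -_ = -ₚ_
    ; 0# = []
    ; 1# = 1# ∷ []
    ; isCommutativeRing = ≈ₚ-isCommutativeRing
    }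

record Algebra (R : CommutativeRing a k) c ℓ : Set (a ⊔ k ⊔ Level.suc (c ⊔ ℓ)) where
  field
    ring               : CommutativeRing c ℓ
    ι                  : CommutativeRing.Carrier R → CommutativeRing.Carrier ring
    isRingHomomorphism : IsRingHomomorphism (CommutativeRing.rawRing R) (CommutativeRing.rawRing ring) ι

record Extension (F : HeytingField a k₁ k₂) c ℓ₁ ℓ₂ : Set (a ⊔ k₁ ⊔ Level.suc (c ⊔ ℓ₁ ⊔ ℓ₂)) where
  field
    top                : HeytingField c ℓ₁ ℓ₂
    ι                  : HeytingField.Carrier F → HeytingField.Carrier top
    isRingHomomorphism : IsRingHomomorphism (CommutativeRing.rawRing (ringOf F)) (CommutativeRing.rawRing (ringOf top)) ι

  open HeytingField top public

  algebra : Algebra (ringOf F) c ℓ₁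
  algebra = record { ring = ringOf top ; ι = ι ; isRingHomomorphism = isRingHomomorphism }

infix 4 _≅_

_≅_ : {R : CommutativeRing a k} → Algebra R c ℓ → Algebra R c′ ℓ′ → Set _
_≅_ {R = R} A B = ∃[ φ ] IsRingIsomorphism (rawRing (ring A)) (rawRing (ring B)) φ × (∀ r → φ (ι A r) ≈ ι B r)
  where
  open Algebra
  open CommutativeRing using (rawRing)
  open CommutativeRing (ring B) using (_≈_)

trivialAlgebra : (R : CommutativeRing c ℓ) → Algebra R c ℓ
trivialAlgebra R = record
  { ring = R
  ; ι = id
  ; isRingHomomorphism = Algebra.Morphism.Construct.Identity.isRingHomomorphism rawRing refl
  }
  where
  open CommutativeRing R
  import Algebra.Morphism.Construct.Identity

_[X]/_ : (R : CommutativeRing c ℓ) → List (CommutativeRing.Carrier R) → Algebra R c (c ⊔ ℓ)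
R [X]/ m = record
  { ring = quotientRing
  ; ι = [_]
  ; isRingHomomorphism = record
    { isSemiringHomomorphism = record
      { isNearSemiringHomomorphism = record
        { +-isMonoidHomomorphism = record
          { isMagmaHomomorphism = record
            { isRelHomomorphism = record { cong = λ p → ≈ₚ⇒≈ₘ (coeffwise λ { zero → p ; (ℕ.suc n) → refl }) }
            ; homo = λ x y → Q.refl
            }
          ; ε-homo = ≈ₚ⇒≈ₘ (coeffwise λ { zero → refl ; (ℕ.suc n) → refl })
          }
        ; *-homo = λ x y → ≈ₚ⇒≈ₘ (coeffwise λ { zero → sym (+-identityʳ _) ; (ℕ.suc n) → refl })
        }
      ; 1#-homo = Q.refl
      }
    ; -‿homo = λ x → Q.refl
    }
  }
  where
  open CommutativeRing R using (refl; sym; +-identityʳ)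
  open Polynomial R
  open Quotient polynomialRing m
  module Q = CommutativeRing quotientRing
  open CommutativeRing polynomialRing using (zeroˡ) renaming (trans to transₚ; sym to symₚ; ring to polyRing)
  open Algebra.Properties.Ring polyRing using (x≈y⇒x∙y⁻¹≈ε)
  ≈ₚ⇒≈ₘ : ∀ {f g} → f ≈ₚ g → f ≈ₘ g
  ≈ₚ⇒≈ₘ {f} {g} p = multiple [] (transₚ (x≈y⇒x∙y⁻¹≈ε p) (symₚ (zeroˡ m)))

record AlgebraicClosure (F : HeytingField a k₁ k₂) c ℓ₁ ℓ₂ : Set (a ⊔ k₁ ⊔ Level.suc (c ⊔ ℓ₁ ⊔ ℓ₂)) where
  field
    extension : Extension F c ℓ₁ ℓ₂

  open Extension extension public
  private module F = HeytingField F
  open Polynomial (ringOf top) using (eval)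

  field
    algebraic           : ∀ x → ∃[ f ] eval (map ι (f ++ [ F.1# ])) x ≈ 0#
    algebraicallyClosed : ∀ a f → ∃[ x ] eval (a ∷ f ++ [ 1# ]) x ≈ 0#

module _ {F : HeytingField a k₁ k₂} (K : Extension F c ℓ₁ ℓ₂) where
  open Extension K
  private
    module F = HeytingField F
    module K = CommutativeRing (ringOf top)

  Base : Pred Carrier (a ⊔ ℓ₁)
  Base x = ∃[ r ] ι r ≈ x

  -- F(S), the smallest subfield of K containing F and S.
  data Adjoin (S : Pred Carrier p) : Pred Carrier (a ⊔ c ⊔ ℓ₁ ⊔ p) where
    base : ∀ r → Adjoin S (ι r)
    gen  : ∀ {x} → S x → Adjoin S x
    add  : ∀ {x y} → Adjoin S x → Adjoin S y → Adjoin S (x + y)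
    mul  : ∀ {x y} → Adjoin S x → Adjoin S y → Adjoin S (x * y)
    neg  : ∀ {x} → Adjoin S x → Adjoin S (- x)
    inv  : ∀ {x y} → Adjoin S x → x * y ≈ 1# → Adjoin S y
    resp : ∀ {x y} → x ≈ y → Adjoin S x → Adjoin S y

  adjoin : Pred Carrier p → Extension F (a ⊔ c ⊔ ℓ₁ ⊔ p) ℓ₁ ℓ₂
  adjoin S = record
    { top = record
      { Carrier = Σ Carrier (Adjoin S)
      ; _≈_ = λ x y → proj₁ x ≈ proj₁ y
      ; _#_ = λ x y → proj₁ x # proj₁ y
      ; _+_ = λ x y → proj₁ x + proj₁ y , add (proj₂ x) (proj₂ y)
      ; _*_ = λ x y → proj₁ x * proj₁ y , mul (proj₂ x) (proj₂ y)
      ; -_ = λ x → - proj₁ x , neg (proj₂ x)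
      ; 0# = 0# , resp 0#-homo (base F.0#)
      ; 1# = 1# , resp 1#-homo (base F.1#)
      ; isHeytingField = record
        { isHeytingCommutativeRing = record
          { isCommutativeRing = record
            { isRing = record
              { +-isAbelianGroup = record
                { isGroup = record
                  { isMonoid = record
                    { isSemigroup = record
                      { isMagma = record
                        { isEquivalence = record { refl = K.refl ; sym = K.sym ; trans = K.trans }
                        ; ∙-cong = K.+-cong
                        }
                      ; assoc = λ x y z → K.+-assoc (proj₁ x) (proj₁ y) (proj₁ z)
                      }
                    ; identity = K.+-identityˡ ∘ proj₁ , K.+-identityʳ ∘ proj₁
                    }
                  ; inverse = K.-‿inverseˡ ∘ proj₁ , K.-‿inverseʳ ∘ proj₁
                  ; ⁻¹-cong = K.-‿cong
                  }
                ; comm = λ x y → K.+-comm (proj₁ x) (proj₁ y)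
                }
              ; *-cong = K.*-cong
              ; *-assoc = λ x y z → K.*-assoc (proj₁ x) (proj₁ y) (proj₁ z)
              ; *-identity = K.*-identityˡ ∘ proj₁ , K.*-identityʳ ∘ proj₁
              ; distrib = (λ x y z → K.distribˡ (proj₁ x) (proj₁ y) (proj₁ z))
                        , (λ x y z → K.distribʳ (proj₁ x) (proj₁ y) (proj₁ z))
              }
            ; *-comm = λ x y → K.*-comm (proj₁ x) (proj₁ y)
            }
          ; isApartnessRelation = record
            { irrefl = #-irrefl
            ; sym = #-sym
            ; cotrans = λ x#y z → #-cotrans x#y (proj₁ z)
            }
          ; #⇒invertible = λ {x} {y} x#y →
              let z , zd≈1 , dz≈1 = #⇒invertible x#y
              in (z , inv (add (proj₂ x) (neg (proj₂ y))) dz≈1) , zd≈1 , dz≈1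
          ; invertible⇒# = λ { ((z , _) , zd≈1 , dz≈1) → invertible⇒# (z , zd≈1 , dz≈1) }
          }
        ; tight = λ x y → tight (proj₁ x) (proj₁ y)
        }
      }
    ; ι = λ r → ι r , base r
    ; isRingHomomorphism = record
      { isSemiringHomomorphism = record
        { isNearSemiringHomomorphism = record
          { +-isMonoidHomomorphism = record
            { isMagmaHomomorphism = record
              { isRelHomomorphism = record { cong = ⟦⟧-cong }
              ; homo = +-homo
              }
            ; ε-homo = 0#-homo
            }
          ; *-homo = *-homo
          }
        ; 1#-homo = 1#-homo
        }
      ; -‿homo = -‿homo
      }
    }
    where open IsRingHomomorphism isRingHomomorphism

  HasDegree : ℕ → Set _
  HasDegree n = ∃[ e ]
      (∀ x → ∃[ v ] combination v e ≈ x)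
    × (∀ v → combination v e ≈ 0# → ∀ i → v i F.≈ F.0#)
    where
    open Algebra.Definitions.RawSemiring (RawRing.rawSemiring K.rawRing) using (sum)
    combination : Vector F.Carrier n → Vector Carrier n → Carrier
    combination v e = sum λ i → ι (v i) * e i

-- The Weierstrass equation y² + a₁xy + a₃y = x³ + a₂x² + a₄x + a₆.
record Weierstrass (A : Set c) : Set c where
  field
    a₁ a₂ a₃ a₄ a₆ : A

mapW : {A : Set c} {B : Set c′} → (A → B) → Weierstrass A → Weierstrass B
mapW f W = record { a₁ = f a₁ ; a₂ = f a₂ ; a₃ = f a₃ ; a₄ = f a₄ ; a₆ = f a₆ }
  where open Weierstrass W

module _ (R : CommutativeRing c ℓ) where
  open CommutativeRing R
  open Algebra.Definitions.RawSemiring (RawRing.rawSemiring rawRing) using (_^_) renaming (_×_ to infixr 8 _·_)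

  discriminant : Weierstrass Carrier → Carrier
  discriminant W = - (b₂ ^ 2 * b₈) - 8 · b₄ ^ 3 - 27 · b₆ ^ 2 + 9 · (b₂ * b₄ * b₆)
    where
    open Weierstrass W
    b₂ = a₁ ^ 2 + 4 · a₂
    b₄ = 2 · a₄ + a₁ * a₃
    b₆ = a₃ ^ 2 + 4 · a₆
    b₈ = a₁ ^ 2 * a₆ + 4 · (a₂ * a₆) - a₁ * a₃ * a₄ + a₂ * a₃ ^ 2 - a₄ ^ 2

  -- W′ is the equation in x′, y′ got from W by x = u²x′ + r, y = u³y′ + u²sx′ + t.
  record ChangeOfVariables (W W′ : Weierstrass Carrier) (u r s t : Carrier) : Set ℓ where
    private
      module W = Weierstrass W
      module W′ = Weierstrass W′
    field
      a₁-eq : u * W′.a₁ ≈ W.a₁ + 2 · s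
      a₂-eq : u ^ 2 * W′.a₂ ≈ W.a₂ - s * W.a₁ + 3 · r - s ^ 2
      a₃-eq : u ^ 3 * W′.a₃ ≈ W.a₃ + r * W.a₁ + 2 · t
      a₄-eq : u ^ 4 * W′.a₄ ≈ W.a₄ - s * W.a₃ + 2 · (r * W.a₂) - (t + r * s) * W.a₁ + 3 · r ^ 2 - 2 · (s * t)
      a₆-eq : u ^ 6 * W′.a₆ ≈ W.a₆ + r * W.a₄ + r ^ 2 * W.a₂ + r ^ 3 - t * W.a₃ - t ^ 2 - r * t * W.a₁

record EllipticCurve (F : HeytingField c ℓ₁ ℓ₂) : Set (c ⊔ ℓ₂) where
  open HeytingField F
  field
    equation    : Weierstrass Carrier
    nonsingular : discriminant (ringOf F) equation # 0#

module Points (K : HeytingField c ℓ₁ ℓ₂) (W : Weierstrass (HeytingField.Carrier K)) where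
  open HeytingField K
  open Weierstrass W
  open Algebra.Definitions.RawSemiring (RawRing.rawSemiring (CommutativeRing.rawRing (ringOf K))) using (_^_) renaming (_×_ to infixr 8 _·_)

  data Point : Set (c ⊔ ℓ₁) where
    𝒪      : Point
    affine : ∀ x y → y ^ 2 + a₁ * x * y + a₃ * y ≈ x ^ 3 + a₂ * x ^ 2 + a₄ * x + a₆ → Point

  data _≈ₚₜ_ : Point → Point → Set (c ⊔ ℓ₁) where
    𝒪      : 𝒪 ≈ₚₜ 𝒪
    affine : ∀ {x y e x′ y′ e′} → x ≈ x′ → y ≈ y′ → affine x y e ≈ₚₜ affine x′ y′ e′

  ≈ₚₜ-isEquivalence : IsEquivalence _≈ₚₜ_
  ≈ₚₜ-isEquivalence = record
    { refl = λ { {𝒪} → 𝒪 ; {affine x y e} → affine K.refl K.refl }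
    ; sym = λ { 𝒪 → 𝒪 ; (affine p q) → affine (K.sym p) (K.sym q) }
    ; trans = λ { 𝒪 𝒪 → 𝒪 ; (affine p q) (affine p′ q′) → affine (K.trans p p′) (K.trans q q′) }
    }
    where module K = CommutativeRing (ringOf K)

  -- The chord and tangent law, as a relation since equality on K need not be decidable;
  -- in chord and tangent, l is the slope of the line.
  data _⊕_↦_ : Point → Point → Point → Set (c ⊔ ℓ₁ ⊔ ℓ₂) where
    𝒪ˡ : ∀ {P Q} → P ≈ₚₜ Q → 𝒪 ⊕ P ↦ Q
    𝒪ʳ : ∀ {P Q} → P ≈ₚₜ Q → P ⊕ 𝒪 ↦ Q
    opposite : ∀ {x₁ y₁ e₁ x₂ y₂ e₂} →
      x₁ ≈ x₂ → y₁ + y₂ + a₁ * x₁ + a₃ ≈ 0# →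
      affine x₁ y₁ e₁ ⊕ affine x₂ y₂ e₂ ↦ 𝒪
    chord : ∀ {x₁ y₁ e₁ x₂ y₂ e₂ x₃ y₃ e₃} l →
      x₁ # x₂ → l * (x₂ - x₁) ≈ y₂ - y₁ →
      x₃ ≈ l ^ 2 + a₁ * l - a₂ - x₁ - x₂ →
      y₃ ≈ l * (x₁ - x₃) - y₁ - a₁ * x₃ - a₃ →
      affine x₁ y₁ e₁ ⊕ affine x₂ y₂ e₂ ↦ affine x₃ y₃ e₃
    tangent : ∀ {x₁ y₁ e₁ x₂ y₂ e₂ x₃ y₃ e₃} l →
      x₁ ≈ x₂ → y₁ ≈ y₂ → 2 · y₁ + a₁ * x₁ + a₃ # 0# →
      l * (2 · y₁ + a₁ * x₁ + a₃) ≈ 3 · x₁ ^ 2 + 2 · (a₂ * x₁) + a₄ - a₁ * y₁ →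
      x₃ ≈ l ^ 2 + a₁ * l - a₂ - x₁ - x₂ →
      y₃ ≈ l * (x₁ - x₃) - y₁ - a₁ * x₃ - a₃ →
      affine x₁ y₁ e₁ ⊕ affine x₂ y₂ e₂ ↦ affine x₃ y₃ e₃

  TwoTorsion : Pred Point (c ⊔ ℓ₁ ⊔ ℓ₂)
  TwoTorsion P = P ⊕ P ↦ 𝒪

  Coordinate : Point → Pred Carrier ℓ₁
  Coordinate 𝒪 z = Lift ℓ₁ ⊥
  Coordinate (affine x y e) z = z ≈ x ⊎ z ≈ y

-- Unramified says that 2 generates the maximal ideal of the integral closure of ℤ₂ in M, that
-- is, the ramification index is 1; residue extensions are separable, the residue field being 𝔽₂.
module _ (M : Extension ℚ₂ c ℓ₁ ℓ₂) where
  open Extension M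
  open Polynomial (ringOf top) using (eval)

  Integral : Pred Carrier ℓ₁
  Integral x = ∃[ f ] eval (map (ι ∘ ℤ₂→ℚ₂) f ++ [ 1# ]) x ≈ 0#

  Unramified : Set (c ⊔ ℓ₁)
  Unramified = ∀ x → Integral x →
    (∃[ y ] Integral y × x * y ≈ 1#) ⊎ (∃[ y ] Integral y × x ≈ (1# + 1#) * y)

  UnramifiedQuadratic : Set (c ⊔ ℓ₁)
  UnramifiedQuadratic = HasDegree M 2 × Unramified

infix 4 _≅ℚ₄

-- ℚ₄ is determined up to isomorphism by being an unramified quadratic extension of ℚ₂.
_≅ℚ₄ : Extension ℚ₂ c ℓ₁ ℓ₂ → Set (Level.suc (c ⊔ ℓ₁ ⊔ ℓ₂))
_≅ℚ₄ {c} {ℓ₁} {ℓ₂} L = Σ (Extension ℚ₂ c ℓ₁ ℓ₂) λ ℚ₄ →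
  UnramifiedQuadratic ℚ₄ × Extension.algebra L ≅ Extension.algebra ℚ₄

private
  ℚ₂[X]/X²+2X+ : ℕ → Algebra (ringOf ℚ₂) 0ℓ 0ℓ
  ℚ₂[X]/X²+2X+ n = ringOf ℚ₂ [X]/ (fromℕ n ∷ fromℕ 2 ∷ ℚ₂.1# ∷ [])
    where
    fromℕ : ℕ → ℚ₂.Carrier
    fromℕ n = n · ℚ₂.1#
      where open Algebra.Definitions.RawSemiring (RawRing.rawSemiring (CommutativeRing.rawRing (ringOf ℚ₂))) using () renaming (_×_ to _·_)

ℚ₂-algebra L₁ L₂ : Algebra (ringOf ℚ₂) 0ℓ 0ℓ
ℚ₂-algebra = trivialAlgebra (ringOf ℚ₂)
L₁ = ℚ₂[X]/X²+2X+ 2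
L₂ = ℚ₂[X]/X²+2X+ 6

-- E is isomorphic over ℚ₂ to an integral model of unit discriminant whose reduction has a
-- point of order 2 over 𝔽̄₂; reducing coefficients is the identity since 𝔽₂ is ℤ₂/(2).
record GoodOrdinaryReduction (𝔽̄₂ : AlgebraicClosure 𝔽₂ c ℓ₁ ℓ₂) (E : EllipticCurve ℚ₂) : Set (c ⊔ ℓ₁ ⊔ ℓ₂) where
  open AlgebraicClosure 𝔽̄₂ using (top; ι)
  field
    model   : Weierstrass ℤ₂.Carrier
    u r s t : ℚ₂.Carrier
    u#0     : u ℚ₂.# ℚ₂.0#
    change  : ChangeOfVariables (ringOf ℚ₂) (EllipticCurve.equation E) (mapW ℤ₂→ℚ₂ model) u r s t
    good    : ∃[ v ] discriminant ℤ₂ model ℤ₂.* v ℤ₂.≈ ℤ₂.1#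

  reduction : Weierstrass 𝔽₂.Carrier
  reduction = model

  open Points top (mapW ι reduction)

  field
    ordinary : ∃[ P ] TwoTorsion P × ¬ (P ≈ₚₜ 𝒪)

module TwoTorsionPoints (ℚ̄₂ : AlgebraicClosure ℚ₂ c ℓ₁ ℓ₂) (E : EllipticCurve ℚ₂) where
  open AlgebraicClosure ℚ̄₂ using (extension; top; ι; Carrier)
  open Points top (mapW ι (EllipticCurve.equation E))

  E[2] : Setoid (c ⊔ ℓ₁ ⊔ ℓ₂) (c ⊔ ℓ₁)
  E[2] = record
    { Carrier = Σ Point TwoTorsion
    ; _≈_ = λ P Q → proj₁ P ≈ₚₜ proj₁ Q
    ; isEquivalence = record
      { refl = ≈ₚₜ.refl ; sym = ≈ₚₜ.sym ; trans = ≈ₚₜ.trans }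
    }
    where module ≈ₚₜ = IsEquivalence ≈ₚₜ-isEquivalence

  -- ⟨ℚ₂⟩, ℚ₂⟨ P ⟩ and ℚ₂⟨E[2]⟩ are subsets of ℚ̄₂; ℚ₂⟮E[2]⟯ is the last as a field over ℚ₂.
  Coordinates : Pred Carrier (c ⊔ ℓ₁ ⊔ ℓ₂)
  Coordinates z = ∃[ P ] TwoTorsion P × Coordinate P z

  ⟨ℚ₂⟩ : Pred Carrier ℓ₁
  ⟨ℚ₂⟩ = Base extension

  ℚ₂⟨_⟩ : Setoid.Carrier E[2] → Pred Carrier _
  ℚ₂⟨ P ⟩ = Adjoin extension (Coordinate (proj₁ P))

  ℚ₂⟨E[2]⟩ : Pred Carrier (c ⊔ ℓ₁ ⊔ ℓ₂)
  ℚ₂⟨E[2]⟩ = Adjoin extension Coordinates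

  ℚ₂⟮E[2]⟯ : Extension ℚ₂ _ _ _
  ℚ₂⟮E[2]⟯ = adjoin extension Coordinates

{-# OPTIONS --safe #-}

-- The abscissas of the points of order 2 are the zeros of ψ = 4x³ + b₂x² + 2b₄x + b₆. On a model of
-- good ordinary reduction a₁, hence b₂, is odd, so over ℤ₂ Hensel's lemma splits ψ as
-- (4x - e)(x² + 2px + q) with e odd. The resultant of the two factors is odd, so Δ differs from
-- p² - q by a square. As ℤ₂ˣ/squares = {1, -3, -1, -5}, the field ℚ₂(E[2]) is ℚ₂(√d) for one of these
-- d, and two of the three abscissas are conjugate if d ≠ 1. Inverses come without a norm: over ℚ₂
-- every element of ℚ̄₂ is algebraic, so a subring containing ℚ₂ is closed under inversion.
module Submission where

open import Defs
import Algebra.Definitions.RawSemiring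
import Algebra.Morphism.Construct.Composition
import Algebra.Morphism.Construct.Identity
import Algebra.Properties.Ring
import Algebra.Properties.Semiring.Exp
import Algebra.Properties.Semiring.Mult
import Algebra.Properties.Semiring.Mult.TCOptimised
import Algebra.Solver.Ring
import Data.Integer.DivMod as ℤD
import Data.Integer.Properties as ℤₚ
import Data.Nat.Properties as ℕₚ
import Relation.Binary.Reasoning.Setoid
open import Algebra.Apartness.Bundles using (HeytingField)
open import Algebra.Bundles using (CommutativeRing; RawRing)
open import Algebra.Morphism.Structures using (IsRingHomomorphism; IsRingIsomorphism)
open import Algebra.Solver.Ring.AlmostCommutativeRing using (_-Raw-AlmostCommutative⟶_; fromCommutativeRing)
open import Data.Empty using (⊥-elim)
open import Data.Fin using (Fin)
open import Data.Fin.Patterns using (0F; 1F; 2F; 3F)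
open import Data.Integer as ℤ using (ℤ; +_; -[1+_]; 1ℤ)
open import Data.Integer.Divisibility.Signed as ℤ∣ using (_∣_; _∣?_; divides)
open import Data.Integer.Tactic.RingSolver using (solve-∀)
open import Data.List using ([]; _∷_; _++_; [_]; map)
open import Data.List.Properties using (map-++)
open import Data.List.Relation.Unary.All as All using (All; []; _∷_)
open import Data.List.Relation.Unary.All.Properties using (map⁺)
open import Data.Maybe as Maybe using (Maybe)
open import Data.Nat as ℕ using (ℕ; zero; suc)
open import Data.Product using (Σ; _×_; _,_; ∃-syntax; proj₁; proj₂)
open import Data.Sum using (_⊎_; inj₁; inj₂)
open import Data.Vec.Functional using (Vector)
open import Function using (_∘_; id; case_of_)
open import Function.Bundles using (Bijection)
open import Level using (_⊔_; lift)
open import Relation.Binary.Bundles using (Setoid)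
open import Relation.Binary.Consequences using (dec⇒weaklyDec)
open import Relation.Binary.PropositionalEquality as ≡ using (_≡_; _≢_; cong)
open import Relation.Nullary using (¬_; yes; no)
open import Relation.Nullary.Decidable using (from-no)
open import Relation.Unary using (Pred; _⊆_; _≐_)

open ℤ₂^ using () renaming (_^_ to _^₂_)

-- Modulo 2 the cubic ψ drops to b₂x² + b₆. Hence the root that Hensel's lemma finds is the one near
-- infinity, and it is computed as w = 1/(4x), close to -1/b₂. The remaining quadratic is
-- inseparable modulo 2; this is why ramified fields can occur and why Δ has to be known modulo 8
-- and not just modulo 2.
--
-- Equality in ℚ₂ and in its closure is not decidable. The case distinction is therefore made on a
-- square class `κ` carried as data, which three parity tests on Δ determine; apartness is carried
-- as invertibility, a property that homomorphisms preserve.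
--
-- The second claim starts from an abstract isomorphism, not from the value of `κ`. It needs the
-- converse direction as well: ℚ₂ is isomorphic to none of ℚ₄, `L₁`, `L₂`, which excludes the class
-- of 1.
--
-- Most identities are proved over an arbitrary commutative ring and instantiated afterwards, so
-- that ring normalisation does not meet sequences of integers or fractions.

module IntegerCoefficients {c ℓ} (R : CommutativeRing c ℓ) where
  open CommutativeRing R
  open Algebra.Properties.Ring ring
  open Algebra.Properties.Semiring.Mult.TCOptimised semiring using (1+×; ×-homo-+; ×1-homo-*) renaming (_×_ to _×ᵣ_)
  private
    module ≈ = Relation.Binary.Reasoning.Setoid setoid

    -- The optimised multiple has 1 ×ᵣ 1# reduce to 1# itself, so the solver constant `♯ 1` denotes
    -- exactly the 1# that occurs in the goals.
    ⟦_⟧ℤ : ℤ → Carrier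
    ⟦ + n ⟧ℤ = n ×ᵣ 1#
    ⟦ -[1+ n ] ⟧ℤ = - (suc n ×ᵣ 1#)

    cancel : ∀ a x y → (a + x) - (a + y) ≈ x - y
    cancel a x y = ≈.begin
      (a + x) - (a + y)      ≈.≈⟨ +-cong (+-comm a x) (sym (-‿+-comm a y)) ⟩
      (x + a) + (- a - y)    ≈.≈⟨ +-assoc x a _ ⟩
      x + (a + (- a - y))    ≈.≈⟨ +-congˡ (+-assoc a (- a) (- y)) ⟨
      x + ((a - a) - y)      ≈.≈⟨ +-congˡ (trans (+-congʳ (-‿inverseʳ a)) (+-identityˡ (- y))) ⟩
      x - y                  ≈.∎

    ⊖-homo : ∀ m n → ⟦ m ℤ.⊖ n ⟧ℤ ≈ m ×ᵣ 1# - n ×ᵣ 1#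
    ⊖-homo zero zero = sym (-‿inverseʳ 0#)
    ⊖-homo zero (suc n) = sym (+-identityˡ _)
    ⊖-homo (suc m) zero = sym (trans (+-congˡ -0#≈0#) (+-identityʳ _))
    ⊖-homo (suc m) (suc n) = ≈.begin
      ⟦ suc m ℤ.⊖ suc n ⟧ℤ                ≈.≡⟨ ≡.cong ⟦_⟧ℤ (ℤₚ.[1+m]⊖[1+n]≡m⊖n m n) ⟩
      ⟦ m ℤ.⊖ n ⟧ℤ                        ≈.≈⟨ ⊖-homo m n ⟩
      m ×ᵣ 1# - n ×ᵣ 1#                     ≈.≈⟨ cancel 1# (m ×ᵣ 1#) (n ×ᵣ 1#) ⟨
      (1# + m ×ᵣ 1#) - (1# + n ×ᵣ 1#)       ≈.≈⟨ +-cong (1+× m 1#) (-‿cong (1+× n 1#)) ⟨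
      suc m ×ᵣ 1# - suc n ×ᵣ 1#             ≈.∎

    +-homo : ∀ i j → ⟦ i ℤ.+ j ⟧ℤ ≈ ⟦ i ⟧ℤ + ⟦ j ⟧ℤ
    +-homo (+ m) (+ n) = ×-homo-+ 1# m n
    +-homo (+ m) -[1+ n ] = ⊖-homo m (suc n)
    +-homo -[1+ m ] (+ n) = trans (⊖-homo n (suc m)) (+-comm _ _)
    +-homo -[1+ m ] -[1+ n ] = ≈.begin
      - (suc (suc (m ℕ.+ n)) ×ᵣ 1#)        ≈.≡⟨ ≡.cong (λ k → - (k ×ᵣ 1#)) (≡.sym (≡.cong suc (ℕₚ.+-suc m n))) ⟩
      - ((suc m ℕ.+ suc n) ×ᵣ 1#)          ≈.≈⟨ -‿cong (×-homo-+ 1# (suc m) (suc n)) ⟩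
      - (suc m ×ᵣ 1# + suc n ×ᵣ 1#)         ≈.≈⟨ -‿+-comm _ _ ⟨
      - (suc m ×ᵣ 1#) - suc n ×ᵣ 1#         ≈.∎

    -‿homo : ∀ i → ⟦ ℤ.- i ⟧ℤ ≈ - ⟦ i ⟧ℤ
    -‿homo (+ zero) = sym -0#≈0#
    -‿homo (+ suc n) = refl
    -‿homo -[1+ n ] = sym (-‿involutive _)

    *-homo⁺ : ∀ m j → ⟦ + m ℤ.* j ⟧ℤ ≈ (m ×ᵣ 1#) * ⟦ j ⟧ℤ
    *-homo⁺ m (+ n) = trans (reflexive (≡.cong ⟦_⟧ℤ (≡.sym (ℤₚ.pos-* m n)))) (×1-homo-* m n)
    *-homo⁺ m -[1+ n ] = ≈.begin
      ⟦ + m ℤ.* -[1+ n ] ⟧ℤ               ≈.≡⟨ ≡.cong ⟦_⟧ℤ (ℤₚ.neg-distribʳ-* (+ m) (+ suc n)) ⟨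
      ⟦ ℤ.- (+ m ℤ.* + suc n) ⟧ℤ          ≈.≈⟨ -‿homo (+ m ℤ.* + suc n) ⟩
      - ⟦ + m ℤ.* + suc n ⟧ℤ              ≈.≈⟨ -‿cong (*-homo⁺ m (+ suc n)) ⟩
      - ((m ×ᵣ 1#) * (suc n ×ᵣ 1#))         ≈.≈⟨ -‿distribʳ-* _ _ ⟩
      (m ×ᵣ 1#) * - (suc n ×ᵣ 1#)           ≈.∎

    *-homo : ∀ i j → ⟦ i ℤ.* j ⟧ℤ ≈ ⟦ i ⟧ℤ * ⟦ j ⟧ℤ
    *-homo (+ m) j = *-homo⁺ m j
    *-homo -[1+ m ] j = ≈.begin
      ⟦ -[1+ m ] ℤ.* j ⟧ℤ                 ≈.≡⟨ ≡.cong ⟦_⟧ℤ (ℤₚ.neg-distribˡ-* (+ suc m) j) ⟨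
      ⟦ ℤ.- (+ suc m ℤ.* j) ⟧ℤ            ≈.≈⟨ -‿homo (+ suc m ℤ.* j) ⟩
      - ⟦ + suc m ℤ.* j ⟧ℤ                ≈.≈⟨ -‿cong (*-homo⁺ (suc m) j) ⟩
      - ((suc m ×ᵣ 1#) * ⟦ j ⟧ℤ)           ≈.≈⟨ -‿distribˡ-* _ _ ⟩
      - (suc m ×ᵣ 1#) * ⟦ j ⟧ℤ             ≈.∎

    homomorphism : CommutativeRing.rawRing ℤₚ.+-*-commutativeRing -Raw-AlmostCommutative⟶ fromCommutativeRing R
    homomorphism = record
      { ⟦_⟧    = ⟦_⟧ℤ
      ; +-homo = +-homo
      ; *-homo = *-homo
      ; -‿homo = -‿homo
      ; 0-homo = refl
      ; 1-homo = refl
      }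

    coefficients≟ : ∀ i j → Maybe (⟦ i ⟧ℤ ≈ ⟦ j ⟧ℤ)
    coefficients≟ i j = Maybe.map (λ { ≡.refl → refl }) (dec⇒weaklyDec ℤ._≟_ i j)

  open Algebra.Solver.Ring _ _ homomorphism coefficients≟ public

  ♯ : ∀ {n} → ℕ → Polynomial n
  ♯ k = con (+ k)

-- Weierstrass equations

module RingOps {c ℓ} (R : CommutativeRing c ℓ) where
  open CommutativeRing R
  open Algebra.Definitions.RawSemiring (RawRing.rawSemiring rawRing) using (_^_) renaming (_×_ to infixr 8 _·_) public

module LinearCombination {c ℓ} (R : CommutativeRing c ℓ) where
  open CommutativeRing R
  open Algebra.Properties.Ring ring using (x≈y⇒x∙y⁻¹≈ε; x∙y⁻¹≈ε⇒x≈y)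

  infixl 5 _⊞_

  _⊠_ : ∀ k {x y} → x ≈ y → k * (x - y) ≈ 0#
  k ⊠ p = trans (*-congˡ (x≈y⇒x∙y⁻¹≈ε p)) (zeroʳ k)

  _⊞_ : ∀ {x y} → x ≈ 0# → y ≈ 0# → x + y ≈ 0#
  p ⊞ q = trans (+-cong p q) (+-identityˡ 0#)

  -- Proof by certificate: hypotheses l ≈ r enter as k * (l - r) through `⊠`, are summed by `⊞`, and
  -- it remains to check x = y + Σ k (l - r) as an identity of polynomials, which is left to the
  -- solver.
  modulo : ∀ {x y z} → z ≈ 0# → x ≈ y + z → x ≈ y
  modulo p q = trans q (trans (+-congˡ p) (+-identityʳ _))

  ≈⇒-≈0 : ∀ {x y} → x ≈ y → x - y ≈ 0#
  ≈⇒-≈0 = x≈y⇒x∙y⁻¹≈ε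

  -≈0⇒≈ : ∀ {x y} → x - y ≈ 0# → x ≈ y
  -≈0⇒≈ = x∙y⁻¹≈ε⇒x≈y _ _

module WeierstrassIdentities {c ℓ} (R : CommutativeRing c ℓ) where
  open CommutativeRing R
  open RingOps R
  open LinearCombination R
  open Algebra.Properties.Semiring.Exp semiring using (^-congˡ)
  open Algebra.Properties.Semiring.Mult semiring using () renaming (×-congʳ to ·-congʳ)
  open IntegerCoefficients R using (solve; _:=_; _:+_; _:*_; _:-_; :-_; _:^_; _:×_; ♯; Polynomial)

  b₂ b₄ b₆ b₈ : Weierstrass Carrier → Carrier
  b₂ W = a₁ ^ 2 + 4 · a₂ where open Weierstrass W
  b₄ W = 2 · a₄ + a₁ * a₃ where open Weierstrass W
  b₆ W = a₃ ^ 2 + 4 · a₆ where open Weierstrass W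
  b₈ W = a₁ ^ 2 * a₆ + 4 · (a₂ * a₆) - a₁ * a₃ * a₄ + a₂ * a₃ ^ 2 - a₄ ^ 2 where open Weierstrass W

  private
    disc : Carrier → Carrier → Carrier → Carrier → Carrier
    disc x₂ x₄ x₆ x₈ = - (x₂ ^ 2 * x₈) - 8 · x₄ ^ 3 - 27 · x₆ ^ 2 + 9 · (x₂ * x₄ * x₆)

    disc-cong : ∀ {x₂ y₂ x₄ y₄ x₆ y₆} x₈ → x₂ ≈ y₂ → x₄ ≈ y₄ → x₆ ≈ y₆ → disc x₂ x₄ x₆ x₈ ≈ disc y₂ y₄ y₆ x₈
    disc-cong x₈ p₂ p₄ p₆ =
      +-cong
        (+-cong
          (+-cong (-‿cong (*-congʳ (^-congˡ 2 p₂))) (-‿cong (·-congʳ 8 (^-congˡ 3 p₄))))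
          (-‿cong (·-congʳ 27 (^-congˡ 2 p₆))))
        (·-congʳ 9 (*-cong (*-cong p₂ p₄) p₆))

    disc-:= : ∀ {n} → (x₂ x₄ x₆ x₈ : Polynomial n) → Polynomial n
    disc-:= x₂ x₄ x₆ x₈ = :- (x₂ :^ 2 :* x₈) :- 8 :× x₄ :^ 3 :- 27 :× x₆ :^ 2 :+ 9 :× (x₂ :* x₄ :* x₆)

    4b₈ : ∀ W → 4 · b₈ W ≈ b₂ W * b₆ W - b₄ W ^ 2
    4b₈ W = solve 5 (λ a₁ a₂ a₃ a₄ a₆ →
      4 :× (a₁ :^ 2 :* a₆ :+ 4 :× (a₂ :* a₆) :- a₁ :* a₃ :* a₄ :+ a₂ :* a₃ :^ 2 :- a₄ :^ 2)
      := (a₁ :^ 2 :+ 4 :× a₂) :* (a₃ :^ 2 :+ 4 :× a₆) :- (2 :× a₄ :+ a₁ :* a₃) :^ 2)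
      refl a₁ a₂ a₃ a₄ a₆
      where open Weierstrass W

  -- In characteristic 2, a₁ = a₃ = 0 makes b₂, b₄ and b₆ vanish, and every term of Δ contains one
  -- of them.
  discriminant≈0 : 1# + 1# ≈ 0# → ∀ W → Weierstrass.a₁ W ≈ 0# → Weierstrass.a₃ W ≈ 0# → discriminant R W ≈ 0#
  discriminant≈0 2≈0 W a₁≈0 a₃≈0 = trans (disc-cong (b₈ W) b₂≈0 b₄≈0 b₆≈0)
    (solve 1 (λ x → disc-:= (♯ 0) (♯ 0) (♯ 0) x := ♯ 0) refl (b₈ W))
    where
    open Weierstrass W
    square : ∀ x a → x ≈ 0# → x ^ 2 + 4 · a ≈ 0#
    square x a x≈0 = modulo (x ⊠ x≈0 ⊞ (2 · a) ⊠ 2≈0)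
      (solve 2 (λ x a → x :^ 2 :+ 4 :× a := ♯ 0 :+ (x :* (x :- ♯ 0) :+ 2 :× a :* (♯ 1 :+ ♯ 1 :- ♯ 0))) refl x a)
    b₂≈0 : b₂ W ≈ 0#
    b₂≈0 = square a₁ a₂ a₁≈0
    b₆≈0 : b₆ W ≈ 0#
    b₆≈0 = square a₃ a₆ a₃≈0
    b₄≈0 : b₄ W ≈ 0#
    b₄≈0 = modulo (a₃ ⊠ a₁≈0 ⊞ a₄ ⊠ 2≈0)
      (solve 3 (λ a₁ a₃ a₄ → 2 :× a₄ :+ a₁ :* a₃ := ♯ 0 :+ (a₃ :* (a₁ :- ♯ 0) :+ a₄ :* (♯ 1 :+ ♯ 1 :- ♯ 0))) refl a₁ a₃ a₄)

  -- b₂, b₄, b₆ belong to the cubic 4x³ + b₂x² + 2b₄x + b₆ = (4x - e)(x² + 2px + q),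
  -- and e² + 8ep + 16q is the resultant of the two factors.
  record Factors (W : Weierstrass Carrier) (p q e : Carrier) : Set ℓ where
    field
      b₂-eq : b₂ W ≈ 8 · p - e
      b₄-eq : b₄ W ≈ 2 · q - e * p
      b₆-eq : b₆ W ≈ - (e * q)

  resultant : Carrier → Carrier → Carrier → Carrier
  resultant p q e = e ^ 2 + 8 · (e * p) + 16 · q

  -- The cubic has discriminant 16Δ, and the discriminant of a product is disc · disc · Res², here
  -- 4(p² - q) Res². The remaining factor 4 stays on the left because b₈ is accessible only through
  -- 4b₈ = b₂b₆ - b₄².
  discriminant-factors : ∀ {W p q e} → Factors W p q e →
    4 · discriminant R W ≈ (p ^ 2 - q) * resultant p q e ^ 2
  discriminant-factors {W} {p} {q} {e} F = trans
    (·-congʳ 4 (disc-cong (b₈ W) b₂-eq b₄-eq b₆-eq))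
    (modulo ((- ((8 · p - e) ^ 2)) ⊠ 4b₈′)
      (solve 4 (λ p q e x₈ →
        let x₂ = 8 :× p :- e ; x₄ = 2 :× q :- e :* p ; x₆ = :- (e :* q) in
        4 :× disc-:= x₂ x₄ x₆ x₈
        := (p :^ 2 :- q) :* (e :^ 2 :+ 8 :× (e :* p) :+ 16 :× q) :^ 2
           :+ :- (x₂ :^ 2) :* (4 :× x₈ :- (x₂ :* x₆ :- x₄ :^ 2)))
        refl p q e (b₈ W)))
    where
    open Factors F
    4b₈′ : 4 · b₈ W ≈ (8 · p - e) * - (e * q) - (2 · q - e * p) ^ 2
    4b₈′ = trans (4b₈ W) (+-cong (*-cong b₂-eq b₆-eq) (-‿cong (^-congˡ 2 b₄-eq)))

  ψ : Weierstrass Carrier → Carrier → Carrier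
  ψ W x = 4 · x ^ 3 + b₂ W * x ^ 2 + 2 · (b₄ W * x) + b₆ W

  module _ (W : Weierstrass Carrier) where
    open Weierstrass W

    -- That is, (2y + a₁x + a₃)² = ψ(x) on the curve.
    square≈ψ : ∀ x y → (2 · y + a₁ * x + a₃) ^ 2 + 4 · (x ^ 3 + a₂ * x ^ 2 + a₄ * x + a₆)
                       ≈ ψ W x + 4 · (y ^ 2 + a₁ * x * y + a₃ * y)
    square≈ψ x y = solve 7 (λ a₁ a₂ a₃ a₄ a₆ x y →
      (2 :× y :+ a₁ :* x :+ a₃) :^ 2 :+ 4 :× (x :^ 3 :+ a₂ :* x :^ 2 :+ a₄ :* x :+ a₆)
      := 4 :× x :^ 3 :+ (a₁ :^ 2 :+ 4 :× a₂) :* x :^ 2 :+ 2 :× ((2 :× a₄ :+ a₁ :* a₃) :* x) :+ (a₃ :^ 2 :+ 4 :× a₆)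
         :+ 4 :× (y :^ 2 :+ a₁ :* x :* y :+ a₃ :* y))
      refl a₁ a₂ a₃ a₄ a₆ x y

  module _ {W W′ u r s t} (C : ChangeOfVariables R W W′ u r s t) where
    open ChangeOfVariables C
    private
      module W = Weierstrass W
      module W′ = Weierstrass W′

    -- Completing the square in y removes s and t, so only the shift by r and the scaling by u are
    -- felt: in this and the next two formulas the right sides come from the Taylor coefficients of
    -- ψ at r.
    change-b₂ : u ^ 2 * b₂ W′ ≈ b₂ W + 12 · r
    change-b₂ = trans
      (solve 3 (λ u a₁ a₂ → u :^ 2 :* (a₁ :^ 2 :+ 4 :× a₂) := (u :* a₁) :^ 2 :+ 4 :× (u :^ 2 :* a₂)) refl u W′.a₁ W′.a₂)
      (trans (+-cong (^-congˡ 2 a₁-eq) (·-congʳ 4 a₂-eq))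
        (solve 4 (λ a₁ a₂ r s →
          (a₁ :+ 2 :× s) :^ 2 :+ 4 :× (a₂ :- s :* a₁ :+ 3 :× r :- s :^ 2) := a₁ :^ 2 :+ 4 :× a₂ :+ 12 :× r)
          refl W.a₁ W.a₂ r s))

    change-b₄ : u ^ 4 * b₄ W′ ≈ b₄ W + r * b₂ W + 6 · r ^ 2
    change-b₄ = trans
      (solve 4 (λ u a₁ a₃ a₄ → u :^ 4 :* (2 :× a₄ :+ a₁ :* a₃) := 2 :× (u :^ 4 :* a₄) :+ (u :* a₁) :* (u :^ 3 :* a₃))
        refl u W′.a₁ W′.a₃ W′.a₄)
      (trans (+-cong (·-congʳ 2 a₄-eq) (*-cong a₁-eq a₃-eq))
        (solve 7 (λ a₁ a₂ a₃ a₄ r s t →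
          2 :× (a₄ :- s :* a₃ :+ 2 :× (r :* a₂) :- (t :+ r :* s) :* a₁ :+ 3 :× r :^ 2 :- 2 :× (s :* t))
            :+ (a₁ :+ 2 :× s) :* (a₃ :+ r :* a₁ :+ 2 :× t)
          := 2 :× a₄ :+ a₁ :* a₃ :+ r :* (a₁ :^ 2 :+ 4 :× a₂) :+ 6 :× r :^ 2)
          refl W.a₁ W.a₂ W.a₃ W.a₄ r s t))

    change-b₆ : u ^ 6 * b₆ W′ ≈ b₆ W + 2 · (r * b₄ W) + r ^ 2 * b₂ W + 4 · r ^ 3
    change-b₆ = trans
      (solve 3 (λ u a₃ a₆ → u :^ 6 :* (a₃ :^ 2 :+ 4 :× a₆) := (u :^ 3 :* a₃) :^ 2 :+ 4 :× (u :^ 6 :* a₆)) refl u W′.a₃ W′.a₆)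
      (trans (+-cong (^-congˡ 2 a₃-eq) (·-congʳ 4 a₆-eq))
        (solve 7 (λ a₁ a₂ a₃ a₄ a₆ r t →
          (a₃ :+ r :* a₁ :+ 2 :× t) :^ 2
            :+ 4 :× (a₆ :+ r :* a₄ :+ r :^ 2 :* a₂ :+ r :^ 3 :- t :* a₃ :- t :^ 2 :- r :* t :* a₁)
          := a₃ :^ 2 :+ 4 :× a₆ :+ 2 :× (r :* (2 :× a₄ :+ a₁ :* a₃)) :+ r :^ 2 :* (a₁ :^ 2 :+ 4 :× a₂) :+ 4 :× r :^ 3)
          refl W.a₁ W.a₂ W.a₃ W.a₄ W.a₆ r t))

  -- Comparison of coefficients in ψ = 4(X - ρ)((X - g)² - n). The completed square makes g ± √n the
  -- two roots that may be irrational.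
  record Roots (W : Weierstrass Carrier) (ρ g n : Carrier) : Set ℓ where
    field
      b₂-eq : b₂ W ≈ - (4 · (ρ + 2 · g))
      b₄-eq : b₄ W ≈ 2 · (2 · (ρ * g) + g ^ 2 - n)
      b₆-eq : b₆ W ≈ - (4 · (ρ * (g ^ 2 - n)))

  ψ-roots : ∀ {W ρ g n} → Roots W ρ g n → ∀ x → ψ W x ≈ 4 · ((x - ρ) * ((x - g) ^ 2 - n))
  ψ-roots {W} {ρ} {g} {n} H x = trans
    (+-cong (+-cong (+-congˡ (*-congʳ b₂-eq)) (·-congʳ 2 (*-congʳ b₄-eq))) b₆-eq)
    (solve 4 (λ ρ g n x →
      4 :× x :^ 3 :+ :- (4 :× (ρ :+ 2 :× g)) :* x :^ 2 :+ 2 :× (2 :× (2 :× (ρ :* g) :+ g :^ 2 :- n) :* x)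
        :+ :- (4 :× (ρ :* (g :^ 2 :- n)))
      := 4 :× ((x :- ρ) :* ((x :- g) :^ 2 :- n))) refl ρ g n x)
    where open Roots H

  -- Under x = u²x′ + r the root x′ = e/4 goes to ρ, and x′² + 2px′ + q = (x′ + p)² - (p² - q) gives
  -- the centre g and the radicand n. Here h is 1/2.
  roots : ∀ {W W′ u r s t p q e h} → ChangeOfVariables R W W′ u r s t → Factors W′ p q e → 2 · h ≈ 1# →
    Roots W (r + u ^ 2 * e * h ^ 2) (r - u ^ 2 * p) (u ^ 4 * (p ^ 2 - q))
  roots {W} {W′} {u} {r} {s} {t} {p} {q} {e} {h} C F 2h≈1 = record { b₂-eq = E₂ ; b₄-eq = E₄ ; b₆-eq = E₆ }
    where
    module F = Factors F
    ρ g n : Carrier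
    ρ = r + u ^ 2 * e * h ^ 2
    g = r - u ^ 2 * p
    n = u ^ 4 * (p ^ 2 - q)
    β₂ β₄ : Carrier
    β₂ = - (4 · (ρ + 2 · g))
    β₄ = 2 · (2 · (ρ * g) + g ^ 2 - n)
    H₂ : u ^ 2 * (8 · p - e) ≈ b₂ W + 12 · r
    H₂ = trans (*-congˡ (sym F.b₂-eq)) (change-b₂ C)
    H₄ : u ^ 4 * (2 · q - e * p) ≈ b₄ W + r * b₂ W + 6 · r ^ 2
    H₄ = trans (*-congˡ (sym F.b₄-eq)) (change-b₄ C)
    H₆ : u ^ 6 * - (e * q) ≈ b₆ W + 2 · (r * b₄ W) + r ^ 2 * b₂ W + 4 · r ^ 3
    H₆ = trans (*-congˡ (sym F.b₆-eq)) (change-b₆ C)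
    E₂ : b₂ W ≈ β₂
    E₂ = modulo ((- 1#) ⊠ H₂ ⊞ (u ^ 2 * e * (2 · h + 1#)) ⊠ 2h≈1)
      (solve 6 (λ b₂ u r p e h →
        b₂ := :- (4 :× (r :+ u :^ 2 :* e :* h :^ 2 :+ 2 :× (r :- u :^ 2 :* p)))
          :+ (:- (♯ 1) :* (u :^ 2 :* (8 :× p :- e) :- (b₂ :+ 12 :× r))
          :+ u :^ 2 :* e :* (2 :× h :+ ♯ 1) :* (2 :× h :- ♯ 1)))
        refl (b₂ W) u r p e h)
    E₄ : b₄ W ≈ β₄
    E₄ = modulo ((- 1#) ⊠ H₄ ⊞ (- r) ⊠ E₂ ⊞ (u ^ 4 * (e * p) * (2 · h + 1#)) ⊠ 2h≈1)
      (solve 8 (λ b₂ b₄ u r p q e h →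
        let ρ = r :+ u :^ 2 :* e :* h :^ 2 ; g = r :- u :^ 2 :* p ; n = u :^ 4 :* (p :^ 2 :- q) in
        b₄ := 2 :× (2 :× (ρ :* g) :+ g :^ 2 :- n)
          :+ (:- (♯ 1) :* (u :^ 4 :* (2 :× q :- e :* p) :- (b₄ :+ r :* b₂ :+ 6 :× r :^ 2))
          :+ (:- r) :* (b₂ :- :- (4 :× (ρ :+ 2 :× g)))
          :+ u :^ 4 :* (e :* p) :* (2 :× h :+ ♯ 1) :* (2 :× h :- ♯ 1)))
        refl (b₂ W) (b₄ W) u r p q e h)
    E₆ : b₆ W ≈ - (4 · (ρ * (g ^ 2 - n)))
    E₆ = modulo ((- 1#) ⊠ H₆ ⊞ (- (2 · r)) ⊠ E₄ ⊞ (- (r ^ 2)) ⊠ E₂ ⊞ (u ^ 6 * (e * q) * (2 · h + 1#)) ⊠ 2h≈1)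
      (solve 9 (λ b₂ b₄ b₆ u r p q e h →
        let ρ = r :+ u :^ 2 :* e :* h :^ 2 ; g = r :- u :^ 2 :* p ; n = u :^ 4 :* (p :^ 2 :- q) in
        b₆ := :- (4 :× (ρ :* (g :^ 2 :- n)))
          :+ (:- (♯ 1) :* (u :^ 6 :* (:- (e :* q)) :- (b₆ :+ 2 :× (r :* b₄) :+ r :^ 2 :* b₂ :+ 4 :× r :^ 3))
          :+ (:- (2 :× r)) :* (b₄ :- 2 :× (2 :× (ρ :* g) :+ g :^ 2 :- n))
          :+ (:- (r :^ 2)) :* (b₂ :- :- (4 :× (ρ :+ 2 :× g)))
          :+ u :^ 6 :* (e :* q) :* (2 :× h :+ ♯ 1) :* (2 :× h :- ♯ 1)))
        refl (b₂ W) (b₄ W) (b₆ W) u r p q e h)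

  -- The left side is the quadratic factor evaluated at the root ρ of the linear one, which is the
  -- resultant up to u⁴/16.
  separation : ∀ u r p q e {h} → 2 · h ≈ 1# →
    (r + u ^ 2 * e * h ^ 2 - (r - u ^ 2 * p)) ^ 2 - u ^ 4 * (p ^ 2 - q) ≈ u ^ 4 * h ^ 4 * resultant p q e
  separation u r p q e {h} 2h≈1 = modulo ((- (u ^ 4 * (2 · h + 1#) * (2 · (e * p * h ^ 2) + q * (1# + 4 · h ^ 2)))) ⊠ 2h≈1)
    (solve 6 (λ u r p q e h →
      (r :+ u :^ 2 :* e :* h :^ 2 :- (r :- u :^ 2 :* p)) :^ 2 :- u :^ 4 :* (p :^ 2 :- q)
      := u :^ 4 :* h :^ 4 :* (e :^ 2 :+ 8 :× (e :* p) :+ 16 :× q)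
        :+ (:- (u :^ 4 :* (2 :× h :+ ♯ 1) :* (2 :× (e :* p :* h :^ 2) :+ q :* (♯ 1 :+ 4 :× h :^ 2)))) :* (2 :× h :- ♯ 1))
      refl u r p q e h)

  -- With v the inverse of the resultant, p² - q = 4Δv², so Δ = σ²d yields (2σv)²d.
  squareClass : ∀ p q e {d δ σ v} → 4 · δ ≈ (p ^ 2 - q) * resultant p q e ^ 2 → δ ≈ σ ^ 2 * d → resultant p q e * v ≈ 1# →
    p ^ 2 - q ≈ (2 · σ * v) ^ 2 * d
  squareClass p q e {d} {δ} {σ} {v} H₁ H₂ H₃ =
    modulo ((- (v ^ 2)) ⊠ H₁ ⊞ (4 · (v ^ 2)) ⊠ H₂ ⊞ (- ((p ^ 2 - q) * (resultant p q e * v + 1#))) ⊠ H₃)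
      (solve 7 (λ p q d δ σ v R →
        p :^ 2 :- q
        := (2 :× σ :* v) :^ 2 :* d
          :+ ((:- (v :^ 2)) :* (4 :× δ :- (p :^ 2 :- q) :* R :^ 2)
            :+ 4 :× (v :^ 2) :* (δ :- σ :^ 2 :* d)
            :+ (:- ((p :^ 2 :- q) :* (R :* v :+ ♯ 1))) :* (R :* v :- ♯ 1)))
        refl p q d δ σ v (resultant p q e))

  scale : ∀ u p q c d → p ^ 2 - q ≈ c ^ 2 * d → u ^ 4 * (p ^ 2 - q) ≈ (u ^ 2 * c) ^ 2 * d
  scale u p q c d H = trans (*-congˡ H) (solve 3 (λ u c d → u :^ 4 :* (c :^ 2 :* d) := (u :^ 2 :* c) :^ 2 :* d) refl u c d)

  Roots-cong : ∀ {W ρ g n n′} → n ≈ n′ → Roots W ρ g n → Roots W ρ g n′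
  Roots-cong n≈n′ H = record
    { b₂-eq = b₂-eq
    ; b₄-eq = trans b₄-eq (·-congʳ 2 (+-congˡ (-‿cong n≈n′)))
    ; b₆-eq = trans b₆-eq (-‿cong (·-congʳ 4 (*-congˡ (+-congˡ (-‿cong n≈n′)))))
    }
    where open Roots H

-- Arithmetic in ℤ₂

Unit : ∀ {c ℓ} (R : CommutativeRing c ℓ) → CommutativeRing.Carrier R → Set _
Unit R x = ∃[ y ] x * y ≈ 1# where open CommutativeRing R

data SquareClass : Set where
  ⟨1⟩ ⟨-3⟩ ⟨-1⟩ ⟨-5⟩ : SquareClass

module _ {c ℓ} (R : CommutativeRing c ℓ) where
  open CommutativeRing R
  open RingOps R

  representative : SquareClass → Carrier
  representative ⟨1⟩ = 1#
  representative ⟨-3⟩ = - (3 · 1#)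
  representative ⟨-1⟩ = - 1#
  representative ⟨-5⟩ = - (5 · 1#)

module Units {c ℓ} (R : CommutativeRing c ℓ) where
  open CommutativeRing R
  open RingOps R
  open IntegerCoefficients R using (solve; _:=_; _:*_; _:+_; _:×_; ♯)

  2·≈2* : ∀ x → 2 · x ≈ (1# + 1#) * x
  2·≈2* x = solve 1 (λ x → 2 :× x := (♯ 1 :+ ♯ 1) :* x) refl x

  2·-assoc : ∀ x y z → 2 · x * y * z ≈ 2 · (x * y * z)
  2·-assoc x y z = solve 3 (λ x y z → 2 :× x :* y :* z := 2 :× (x :* y :* z)) refl x y z

  unit-resp : ∀ {x y} → x ≈ y → Unit R x → Unit R y
  unit-resp x≈y (z , xz≈1) = z , trans (*-congʳ (sym x≈y)) xz≈1

  unit-1 : Unit R 1#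
  unit-1 = 1# , *-identityˡ 1#

  unit-* : ∀ {x y} → Unit R x → Unit R y → Unit R (x * y)
  unit-* {x} {y} (x′ , p) (y′ , q) = x′ * y′ ,
    trans (solve 4 (λ x y x′ y′ → x :* y :* (x′ :* y′) := x :* x′ :* (y :* y′)) refl x y x′ y′)
      (trans (*-cong p q) (*-identityˡ 1#))

  unit-^ : ∀ {x} n → Unit R x → Unit R (x ^ n)
  unit-^ zero u = unit-1
  unit-^ (suc n) u = unit-* u (unit-^ n u)

  unit-factorˡ : ∀ {x y} → Unit R (x * y) → Unit R x
  unit-factorˡ {x} {y} (z , xyz≈1) = y * z , trans (sym (*-assoc x y z)) xyz≈1

  unit-factorʳ : ∀ {x y} → Unit R (x * y) → Unit R y
  unit-factorʳ {x} {y} u = unit-factorˡ (unit-resp (*-comm x y) u)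

  unit-cancelˡ : ∀ {x y} → Unit R x → x * y ≈ 0# → y ≈ 0#
  unit-cancelˡ {x} {y} (z , xz≈1) xy≈0 = trans (sym (*-identityˡ y)) (trans (*-congʳ (trans (sym xz≈1) (*-comm x z)))
    (trans (*-assoc z x y) (trans (*-congˡ xy≈0) (zeroʳ z))))

module HenselIdentities {c ℓ} (R : CommutativeRing c ℓ) where
  open CommutativeRing R
  open RingOps R
  open LinearCombination R
  open WeierstrassIdentities R
  open IntegerCoefficients R using (solve; _:=_; _:+_; _:*_; _:-_; :-_; _:^_; _:×_; ♯)

  2# : Carrier
  2# = 1# + 1#

  -- For w = 1/(4x), w-eq is the equation 4x³ + b₂x² + 2b₄x + b₆ = 0 divided by 4b₂x³ (and e w = 1).
  module _ {W : Weierstrass Carrier} {v w m : Carrier}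
    (v-inv : b₂ W * v ≈ 1#) (odd : b₂ W ≈ 1# + 2# * m)
    (w-eq : w ≈ - v + 2# * - (v * (4 · (b₄ W * w ^ 2) + 8 · (b₆ W * w ^ 3)))) where
    private
      -- With w in the role of 1/e, the equations of `Factors` are solved from the constant term
      -- upwards: b₆ gives q, then b₄ gives p, then b₂ gives e. The b₂-equation then holds
      -- identically, and what has to be shown is that e w is indeed 1.
      p q e : Carrier
      p = - (b₄ W * w + 2 · (b₆ W * w ^ 2))
      q = - (b₆ W * w)
      e = - (b₂ W + 8 · (b₄ W * w) + 16 · (b₆ W * w ^ 2))

      ew≈1 : e * w ≈ 1#
      ew≈1 = modulo ((- b₂ W) ⊠ w-eq ⊞ (1# + 8 · (b₄ W * w ^ 2) + 16 · (b₆ W * w ^ 3)) ⊠ v-inv)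
        (solve 5 (λ b₂ b₄ b₆ v w →
          :- (b₂ :+ 8 :× (b₄ :* w) :+ 16 :× (b₆ :* w :^ 2)) :* w
          := ♯ 1 :+ ((:- b₂) :* (w :- (:- v :+ (♯ 1 :+ ♯ 1) :* (:- (v :* (4 :× (b₄ :* w :^ 2) :+ 8 :× (b₆ :* w :^ 3))))))
             :+ (♯ 1 :+ 8 :× (b₄ :* w :^ 2) :+ 16 :× (b₆ :* w :^ 3)) :* (b₂ :* v :- ♯ 1)))
          refl (b₂ W) (b₄ W) (b₆ W) v w)

    factors : Factors W p q e
    factors = record
      { b₂-eq = solve 4 (λ b₂ b₄ b₆ w →
          b₂ := 8 :× (:- (b₄ :* w :+ 2 :× (b₆ :* w :^ 2))) :- :- (b₂ :+ 8 :× (b₄ :* w) :+ 16 :× (b₆ :* w :^ 2)))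
          refl (b₂ W) (b₄ W) (b₆ W) w
      ; b₄-eq = modulo ((- (b₄ W + 2 · (b₆ W * w))) ⊠ ew≈1)
          (solve 4 (λ e b₄ b₆ w →
            b₄ := 2 :× (:- (b₆ :* w)) :- e :* (:- (b₄ :* w :+ 2 :× (b₆ :* w :^ 2)))
               :+ (:- (b₄ :+ 2 :× (b₆ :* w))) :* (e :* w :- ♯ 1))
            refl e (b₄ W) (b₆ W) w)
      ; b₆-eq = modulo ((- b₆ W) ⊠ ew≈1)
          (solve 3 (λ e b₆ w → b₆ := :- (e :* (:- (b₆ :* w))) :+ (:- b₆) :* (e :* w :- ♯ 1)) refl e (b₆ W) w)
      }

    private
      κ : Carrier
      κ = - (1# + m + 4 · (b₄ W * w) + 8 · (b₆ W * w ^ 2))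

    -- The resultant is e² modulo 8, and e is odd because it is -b₂ modulo 8. In this module `κ`
    -- stands for (e - 1)/2 and is not a square class.
    resultant-odd : resultant p q e ≈ 1# + 2# * (2 · κ + 2 · κ ^ 2 + 4 · (e * p) + 8 · q)
    resultant-odd = modulo ((1# + 2 · κ + e) ⊠ e-odd)
      (solve 4 (λ κ p q e →
        e :^ 2 :+ 8 :× (e :* p) :+ 16 :× q
        := ♯ 1 :+ (♯ 1 :+ ♯ 1) :* (2 :× κ :+ 2 :× κ :^ 2 :+ 4 :× (e :* p) :+ 8 :× q)
          :+ (♯ 1 :+ 2 :× κ :+ e) :* (e :- (♯ 1 :+ 2 :× κ)))
        refl κ p q e)
      where
      e-odd : e ≈ 1# + 2 · κ
      e-odd = modulo ((- 1#) ⊠ odd)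
        (solve 5 (λ b₂ b₄ b₆ w m →
          :- (b₂ :+ 8 :× (b₄ :* w) :+ 16 :× (b₆ :* w :^ 2))
          := ♯ 1 :+ 2 :× (:- (♯ 1 :+ m :+ 4 :× (b₄ :* w) :+ 8 :× (b₆ :* w :^ 2)))
            :+ (:- (♯ 1)) :* (b₂ :- (♯ 1 :+ (♯ 1 :+ ♯ 1) :* m)))
          refl (b₂ W) (b₄ W) (b₆ W) w m)

  b₂-odd : ∀ {W m} → Weierstrass.a₁ W ≈ 1# + 2# * m → b₂ W ≈ 1# + 2# * (2 · m + 2 · m ^ 2 + 2 · Weierstrass.a₂ W)
  b₂-odd {W} {m} H = modulo ((1# + 2 · m + a₁) ⊠ H)
    (solve 3 (λ a₁ a₂ m →
      a₁ :^ 2 :+ 4 :× a₂ := ♯ 1 :+ (♯ 1 :+ ♯ 1) :* (2 :× m :+ 2 :× m :^ 2 :+ 2 :× a₂)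
        :+ (♯ 1 :+ 2 :× m :+ a₁) :* (a₁ :- (♯ 1 :+ (♯ 1 :+ ♯ 1) :* m)))
      refl a₁ a₂ m)
    where open Weierstrass W

  -- (1 + 4v)² = 1 + 8(v + 2v²), so a square root of 1 + 8m amounts to v = m - 2v², an equation
  -- whose right side is contracting in v.
  sqrt-1+8m : ∀ {m v} → v ≈ m + 2# * - (v * v) → (1# + 4 · v) ^ 2 ≈ 1# + 2# * (2# * (2# * m))
  sqrt-1+8m {m} {v} H = modulo ((8 · 1#) ⊠ H)
    (solve 2 (λ m v → let two = ♯ 1 :+ ♯ 1 in
      (♯ 1 :+ 4 :× v) :^ 2 := ♯ 1 :+ two :* (two :* (two :* m)) :+ 8 :× (♯ 1) :* (v :- (m :+ two :* (:- (v :* v)))))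
      refl m v)

  rescale : ∀ {x d d′ τ} → x * d ≈ τ ^ 2 → d * d′ ≈ 1# → x ≈ (τ * d′) ^ 2 * d
  rescale {x} {d} {d′} {τ} H₁ H₂ = modulo (d′ ⊠ H₁ ⊞ (- (x + τ ^ 2 * d′)) ⊠ H₂)
    (solve 4 (λ x d d′ τ →
      x := (τ :* d′) :^ 2 :* d
        :+ (d′ :* (x :* d :- τ :^ 2) :+ (:- (x :+ τ :^ 2 :* d′)) :* (d :* d′ :- ♯ 1)))
      refl x d d′ τ)

  representative-odd : ∀ κ → ∃[ m ] representative R κ ≈ 1# + 2# * m
  representative-odd ⟨1⟩ = 0# , solve 0 (♯ 1 := ♯ 1 :+ (♯ 1 :+ ♯ 1) :* (♯ 0)) refl
  representative-odd ⟨-3⟩ = - (2 · 1#) , solve 0 (:- (3 :× (♯ 1)) := ♯ 1 :+ (♯ 1 :+ ♯ 1) :* (:- (2 :× (♯ 1)))) refl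
  representative-odd ⟨-1⟩ = - 1# , solve 0 (:- (♯ 1) := ♯ 1 :+ (♯ 1 :+ ♯ 1) :* (:- (♯ 1))) refl
  representative-odd ⟨-5⟩ = - (3 · 1#) , solve 0 (:- (5 :× (♯ 1)) := ♯ 1 :+ (♯ 1 :+ ♯ 1) :* (:- (3 :× (♯ 1)))) refl

  -- The number in the names of these four lemmas is the residue of x modulo 8, given by three
  -- binary digits. The representatives 1, -3, -5, -1 have residues 1, 5, 3, 7, and each squares to
  -- 1 modulo 8; so x times the representative of its own residue is 1 modulo 8.
  class-1 : ∀ {x m k l} → x ≈ 1# + 2# * m → m ≈ 2# * k → k ≈ 2# * l →
            x * 1# ≈ 1# + 2# * (2# * (2# * l))
  class-1 {x} {m} {k} {l} H₁ H₂ H₃ = modulo (1# ⊠ H₁ ⊞ 2# ⊠ H₂ ⊞ (2# * 2#) ⊠ H₃)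
    (solve 4 (λ x m k l → let two = ♯ 1 :+ ♯ 1 in
      x :* ♯ 1 := ♯ 1 :+ two :* (two :* (two :* l))
        :+ (♯ 1 :* (x :- (♯ 1 :+ two :* m)) :+ two :* (m :- two :* k) :+ two :* two :* (k :- two :* l)))
      refl x m k l)

  class-5 : ∀ {x m k l} → x ≈ 1# + 2# * m → m ≈ 2# * k → k ≈ 1# + 2# * l →
            x * - (3 · 1#) ≈ 1# + 2# * (2# * (2# * - (2# + 3 · l)))
  class-5 {x} {m} {k} {l} H₁ H₂ H₃ = modulo ((- (3 · 1#)) ⊠ H₁ ⊞ (- (3 · 1#) * 2#) ⊠ H₂ ⊞ (- (3 · 1#) * 2# * 2#) ⊠ H₃)
    (solve 4 (λ x m k l → let two = ♯ 1 :+ ♯ 1 ; d = :- (3 :× (♯ 1)) in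
      x :* d := ♯ 1 :+ two :* (two :* (two :* (:- (two :+ 3 :× l))))
        :+ (d :* (x :- (♯ 1 :+ two :* m)) :+ d :* two :* (m :- two :* k) :+ d :* two :* two :* (k :- (♯ 1 :+ two :* l))))
      refl x m k l)

  class-3 : ∀ {x m k l} → x ≈ 1# + 2# * m → m ≈ 1# + 2# * k → k ≈ 2# * l →
            x * - (5 · 1#) ≈ 1# + 2# * (2# * (2# * - (2# + 5 · l)))
  class-3 {x} {m} {k} {l} H₁ H₂ H₃ = modulo ((- (5 · 1#)) ⊠ H₁ ⊞ (- (5 · 1#) * 2#) ⊠ H₂ ⊞ (- (5 · 1#) * 2# * 2#) ⊠ H₃)
    (solve 4 (λ x m k l → let two = ♯ 1 :+ ♯ 1 ; d = :- (5 :× (♯ 1)) in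
      x :* d := ♯ 1 :+ two :* (two :* (two :* (:- (two :+ 5 :× l))))
        :+ (d :* (x :- (♯ 1 :+ two :* m)) :+ d :* two :* (m :- (♯ 1 :+ two :* k)) :+ d :* two :* two :* (k :- two :* l)))
      refl x m k l)

  class-7 : ∀ {x m k l} → x ≈ 1# + 2# * m → m ≈ 1# + 2# * k → k ≈ 1# + 2# * l →
            x * - 1# ≈ 1# + 2# * (2# * (2# * - (1# + l)))
  class-7 {x} {m} {k} {l} H₁ H₂ H₃ = modulo ((- 1#) ⊠ H₁ ⊞ (- 1# * 2#) ⊠ H₂ ⊞ (- 1# * 2# * 2#) ⊠ H₃)
    (solve 4 (λ x m k l → let two = ♯ 1 :+ ♯ 1 ; d = :- (♯ 1) in
      x :* d := ♯ 1 :+ two :* (two :* (two :* (:- (♯ 1 :+ l))))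
        :+ (d :* (x :- (♯ 1 :+ two :* m)) :+ d :* two :* (m :- (♯ 1 :+ two :* k)) :+ d :* two :* two :* (k :- (♯ 1 :+ two :* l))))
      refl x m k l)

  square-even : ∀ {z h} → z ≈ 2# * h → z * z ≈ 2# * (2# * (h * h))
  square-even {z} {h} H = modulo ((z + 2# * h) ⊠ H)
    (solve 2 (λ z h → let two = ♯ 1 :+ ♯ 1 in
      z :* z := two :* (two :* (h :* h)) :+ (z :+ two :* h) :* (z :- two :* h)) refl z h)

  square-odd : ∀ {z h} → z ≈ 1# + 2# * h → z * z ≈ 1# + 2# * (2# * (h + h * h))
  square-odd {z} {h} H = modulo ((z + (1# + 2# * h)) ⊠ H)
    (solve 2 (λ z h → let two = ♯ 1 :+ ♯ 1 in
      z :* z := ♯ 1 :+ two :* (two :* (h :+ h :* h)) :+ (z :+ (♯ 1 :+ two :* h)) :* (z :- (♯ 1 :+ two :* h))) refl z h)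

  pronic-even : ∀ {h i} → h ≈ 2# * i → h + h * h ≈ 2# * (i + 2# * (i * i))
  pronic-even {h} {i} H = modulo ((1# + h + 2# * i) ⊠ H)
    (solve 2 (λ h i → let two = ♯ 1 :+ ♯ 1 in
      h :+ h :* h := two :* (i :+ two :* (i :* i)) :+ (♯ 1 :+ h :+ two :* i) :* (h :- two :* i)) refl h i)

  pronic-odd : ∀ {h i} → h ≈ 1# + 2# * i → h + h * h ≈ 2# * ((1# + 2# * i) * (1# + i))
  pronic-odd {h} {i} H = modulo ((1# + h + (1# + 2# * i)) ⊠ H)
    (solve 2 (λ h i → let two = ♯ 1 :+ ♯ 1 in
      h :+ h :* h := two :* ((♯ 1 :+ two :* i) :* (♯ 1 :+ i)) :+ (♯ 1 :+ h :+ (♯ 1 :+ two :* i)) :* (h :- (♯ 1 :+ two :* i))) refl h i)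

  4-shift : ∀ {d x} → d * (2# * (2# * x)) ≈ d * x * 2# * 2#
  4-shift {d} {x} = solve 2 (λ d x → let two = ♯ 1 :+ ♯ 1 in d :* (two :* (two :* x)) := d :* x :* two :* two) refl d x

  2-shift : ∀ {d x} → d * (2# * x) ≈ 2# * (d * x)
  2-shift {d} {x} = solve 2 (λ d x → let two = ♯ 1 :+ ♯ 1 in d :* (two :* x) := two :* (d :* x)) refl d x

  4-shift′ : ∀ {x} → 2# * (2# * x) ≈ x * 2# * 2#
  4-shift′ {x} = solve 1 (λ x → let two = ♯ 1 :+ ♯ 1 in two :* (two :* x) := x :* two :* two) refl x

-- How the cubic of a model of good ordinary reduction factors over ℤ₂: the quadratic factor
-- has discriminant Δ up to squares.
record IntegralFactors {a ℓ} (R : CommutativeRing a ℓ) (W : Weierstrass (CommutativeRing.Carrier R)) : Set (a ⊔ ℓ) where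
  open CommutativeRing R
  open WeierstrassIdentities R
  open RingOps R
  field
    p q e c        : Carrier
    κ              : SquareClass
    isFactors      : Factors W p q e
    square         : p ^ 2 - q ≈ c ^ 2 * representative R κ
    c∣2            : ∃[ y ] c * y ≈ 2 · 1#
    resultant-unit : Unit R (resultant p q e)

module _ {c ℓ} (R : CommutativeRing c ℓ) where
  open CommutativeRing R
  open WeierstrassIdentities R
  open RingOps R
  open Units R
  open HenselIdentities R
  open Algebra.Properties.Semiring.Mult semiring using () renaming (×-congʳ to ·-congʳ)

  -- The hypotheses say what is used of ℤ₂: odd elements are units, and the contracting equation for
  -- w has a solution.
  integralFactors :
    (∀ {z h} → z ≈ 1# + 2# * h → Unit R z) →
    (∀ v b c → ∃[ w ] w ≈ - v + 2# * - (v * (4 · (b * w ^ 2) + 8 · (c * w ^ 3)))) →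
    ∀ {W} → ∃[ m ] Weierstrass.a₁ W ≈ 1# + 2# * m →
    Unit R (discriminant R W) → ∃[ κ ] ∃[ σ ] discriminant R W ≈ σ ^ 2 * representative R κ →
    IntegralFactors R W
  integralFactors odd⇒unit fixedPoint {W} (m , a₁-odd) Δ-unit (κ , σ , σ-eq) =
    let v , b₂v≈1 = odd⇒unit (b₂-odd {W} a₁-odd)
        w , w-eq = fixedPoint v (b₄ W) (b₆ W)
        F = factors {W} b₂v≈1 (b₂-odd {W} a₁-odd) w-eq
        t , Rt≈1 = odd⇒unit (resultant-odd {W} b₂v≈1 (b₂-odd {W} a₁-odd) w-eq)
        -- Since σ²d = Δ is a unit, so is σ; hence c = 2σt divides 2. Over ℚ₂ this will make c
        -- invertible.
        σ-unit = unit-factorˡ (unit-factorˡ (unit-resp σ-eq Δ-unit))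
        y , σty≈1 = unit-* σ-unit (unit-factorʳ (1# , trans (*-identityʳ _) Rt≈1))
    in record
      { κ = κ
      ; isFactors = F
      ; square = squareClass _ _ _ {representative R κ} (discriminant-factors F) σ-eq Rt≈1
      ; c∣2 = y , trans (2·-assoc σ t y) (·-congʳ 2 σty≈1)
      ; resultant-unit = t , Rt≈1
      }

-- Contractions and square classes in ℤ₂

open HenselIdentities ℤ₂ using (sqrt-1+8m; rescale; representative-odd;
  class-1; class-3; class-5; class-7; square-even; square-odd; pronic-even; pronic-odd; 2-shift; 4-shift; 4-shift′)

infix 4 _≡[_]_
_≡[_]_ : ℤ₂.Carrier → ℕ → ℤ₂.Carrier → Set
x ≡[ n ] y = approx x n ≡ approx y n mod2^ n

-- Doubling gains one binary digit. The hypothesis concerns the approximations at n and the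
-- conclusion those at n + 1; coherence bridges the two.
double-mod : ∀ {x y} n → x ≡[ n ] y → 2ℤ₂ ℤ₂.* x ≡[ suc n ] 2ℤ₂ ℤ₂.* y
double-mod {x} {y} n x≡y = double (mod-trans (coherent x n) (mod-trans x≡y (mod-sym (coherent y n))))
  where
  distrib : ∀ a b → + 2 ℤ.* (a ℤ.- b) ≡ + 2 ℤ.* a ℤ.- + 2 ℤ.* b
  distrib = solve-∀
  double : ∀ {a b} → a ≡ b mod2^ n → + 2 ℤ.* a ≡ + 2 ℤ.* b mod2^ suc n
  double {a} {b} (mk d) = mk (along (distrib a b) (ℤ∣.*-monoʳ-∣ (+ 2) d))

module _ (c : ℤ₂.Carrier) (G : ℤ₂.Carrier → ℤ₂.Carrier)
  (G-cong : ∀ n {x y} → x ≡[ n ] y → G x ≡[ n ] G y) where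
  private
    F : ℤ₂.Carrier → ℤ₂.Carrier
    F z = c ℤ₂.+ 2ℤ₂ ℤ₂.* G z

    F-contracts : ∀ n {x y} → x ≡[ n ] y → F x ≡[ suc n ] F y
    F-contracts n {x} {y} p = mod-+ {suc n} {approx c (suc n)} (mod-reflexive ≡.refl) (double-mod {G x} {G y} n (G-cong n {x} {y} p))

    iterate : ℕ → ℤ₂.Carrier
    iterate zero = ℤ₂.0#
    iterate (suc n) = F (iterate n)

    successive : ∀ n → iterate (suc n) ≡[ n ] iterate n
    successive zero = mod-1
    successive (suc n) = F-contracts n (successive n)

    limit : ℤ₂.Carrier
    limit = mkℤ₂ (λ n → approx (iterate n) n) (λ n → mod-trans (coherent (iterate (suc n)) n) (successive n))

  opaque
    -- Hensel's lemma as a contraction principle: G preserves congruences modulo 2ⁿ, so c + 2G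
    -- improves them by one digit, and approximation n of the n-th iterate is already final. By
    -- construction the limit agrees with that iterate modulo 2ⁿ.
    fixedPoint : ∃[ z ] z ℤ₂.≈ c ℤ₂.+ 2ℤ₂ ℤ₂.* G z
    fixedPoint = limit , mk≈₂ λ
      { zero → mod-1
      ; (suc n) → F-contracts n {iterate n} {limit} (mod-reflexive ≡.refl)
      }

opaque
  parity : ∀ z → (∃[ h ] z ℤ₂.≈ 2ℤ₂ ℤ₂.* h) ⊎ (∃[ h ] z ℤ₂.≈ ℤ₂.1# ℤ₂.+ 2ℤ₂ ℤ₂.* h)
  parity z with + 2 ∣? approx z 1
  ... | yes 2∣z = let h , h-eq = halve z 2∣z in inj₁ (h , half≈ z h h-eq)
  ... | no 2∤z =
    let h , h-eq = halve (z ℤ₂.- ℤ₂.1#) (odd-pred (approx z 1) 2∤z) in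
    inj₂ (h , modulo (ℤ₂.1# ⊠ half≈ (z ℤ₂.- ℤ₂.1#) h h-eq) (add-1 z (2ℤ₂ ℤ₂.* h)))
    where
    open LinearCombination ℤ₂
    odd-pred : ∀ a → ¬ (+ 2 ∣ a) → + 2 ∣ a ℤ.- 1ℤ
    odd-pred a ¬d with a ℤD.% + 2 | ℤD.n%d<d a (+ 2) | ℤD.a≡a%n+[a/n]*n a (+ 2)
    ... | zero | _ | eq = ⊥-elim (¬d (divides (a ℤD./ + 2) (≡.trans eq (ℤₚ.+-identityˡ _))))
    ... | suc zero | _ | eq = divides (a ℤD./ + 2) (≡.trans (cong (ℤ._- 1ℤ) eq) (cancel (a ℤD./ + 2)))
      where
      cancel : ∀ b → 1ℤ ℤ.+ b ℤ.* + 2 ℤ.- 1ℤ ≡ b ℤ.* + 2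
      cancel = solve-∀
    ... | suc (suc m) | ℕ.s≤s (ℕ.s≤s ()) | _
    add-1 : ∀ z h → z ℤ₂.≈ ℤ₂.1# ℤ₂.+ h ℤ₂.+ ℤ₂.1# ℤ₂.* (z ℤ₂.- ℤ₂.1# ℤ₂.- h)
    add-1 z h = solve 2 (λ z h → z := ♯ 1 :+ h :+ ♯ 1 :* (z :- ♯ 1 :- h)) ℤ₂.refl z h
      where open IntegerCoefficients ℤ₂

  odd≉even : ∀ h k → ¬ (ℤ₂.1# ℤ₂.+ 2ℤ₂ ℤ₂.* h ℤ₂.≈ 2ℤ₂ ℤ₂.* k)
  odd≉even h k p = 2∤1 (mod-0⇒∣ {1} (mod-trans
      (mod-reflexive (difference (approx h 1)))
      (mod-trans (mod-+ (at p 1) (mod-reflexive ≡.refl)) (∣⇒mod-0 (divides (approx k 1 ℤ.- approx h 1) (even (approx h 1) (approx k 1)))))))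
    where
    difference : ∀ h → 1ℤ ≡ 1ℤ ℤ.+ + 2 ℤ.* h ℤ.+ ℤ.- (+ 2 ℤ.* h)
    difference = solve-∀
    even : ∀ h k → + 2 ℤ.* k ℤ.+ ℤ.- (+ 2 ℤ.* h) ≡ (k ℤ.- h) ℤ.* + 2
    even = solve-∀

  odd⇒unit : ∀ {z h} → z ℤ₂.≈ ℤ₂.1# ℤ₂.+ 2ℤ₂ ℤ₂.* h → Unit ℤ₂ z
  odd⇒unit {z} {h} z-odd with + 2 ∣? approx z 1
  ... | no 2∤z = OddInverse.inverse z 2∤z , OddInverse.isInverse z 2∤z
  ... | yes 2∣z = let k , k-eq = halve z 2∣z in
    ⊥-elim (odd≉even h k (ℤ₂.trans (ℤ₂.sym z-odd) (half≈ z k k-eq)))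

  even⇒nonunit : ∀ {z h} → z ℤ₂.≈ 2ℤ₂ ℤ₂.* h → ¬ Unit ℤ₂ z
  even⇒nonunit {z} {h} z-even (w , zw≈1) = odd≉even ℤ₂.0# (h ℤ₂.* w)
    (ℤ₂.trans (ℤ₂.trans (ℤ₂.+-congˡ (ℤ₂.zeroʳ 2ℤ₂)) (ℤ₂.+-identityʳ ℤ₂.1#))
      (ℤ₂.trans (ℤ₂.sym zw≈1) (ℤ₂.trans (ℤ₂.*-congʳ z-even) (ℤ₂.*-assoc 2ℤ₂ h w))))

  unit⇒odd : ∀ {z} → Unit ℤ₂ z → ∃[ h ] z ℤ₂.≈ ℤ₂.1# ℤ₂.+ 2ℤ₂ ℤ₂.* h
  unit⇒odd {z} u with parity z
  ... | inj₁ (h , z-even) = ⊥-elim (even⇒nonunit z-even u)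
  ... | inj₂ odd = odd

  squareRoot : ∀ m → ∃[ τ ] (τ ^₂ 2) ℤ₂.≈ ℤ₂.1# ℤ₂.+ 2ℤ₂ ℤ₂.* (2ℤ₂ ℤ₂.* (2ℤ₂ ℤ₂.* m))
  squareRoot m =
    let v , v-eq = fixedPoint m (λ v → ℤ₂.- (v ℤ₂.* v)) (λ n p → mod-neg {n} (mod-* {n} p p)) in
    ℤ₂.1# ℤ₂.+ 4 · v , sqrt-1+8m v-eq
    where open RingOps ℤ₂

  -- Three parity tests find the residue of x modulo 8. Multiplied by the representative with that
  -- residue, x becomes 1 modulo 8 and so has a square root.
  squareClass-of : ∀ {x} → Unit ℤ₂ x → ∃[ κ ] ∃[ σ ] x ℤ₂.≈ (σ ^₂ 2) ℤ₂.* representative ℤ₂ κ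
  squareClass-of {x} x-unit = let m , x-eq = unit⇒odd x-unit in go x-eq (parity m)
    where
    finish : ∀ κ {l} → x ℤ₂.* representative ℤ₂ κ ℤ₂.≈ ℤ₂.1# ℤ₂.+ 2ℤ₂ ℤ₂.* (2ℤ₂ ℤ₂.* (2ℤ₂ ℤ₂.* l)) →
             ∃[ κ ] ∃[ σ ] x ℤ₂.≈ (σ ^₂ 2) ℤ₂.* representative ℤ₂ κ
    finish κ {l} eq =
      let τ , τ-eq = squareRoot l
          d′ , dd′≈1 = odd⇒unit (proj₂ (representative-odd κ)) in
      κ , τ ℤ₂.* d′ , rescale (ℤ₂.trans eq (ℤ₂.sym τ-eq)) dd′≈1
    go : ∀ {m} → x ℤ₂.≈ ℤ₂.1# ℤ₂.+ 2ℤ₂ ℤ₂.* m → (∃[ h ] m ℤ₂.≈ 2ℤ₂ ℤ₂.* h) ⊎ (∃[ h ] m ℤ₂.≈ ℤ₂.1# ℤ₂.+ 2ℤ₂ ℤ₂.* h) →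
         ∃[ κ ] ∃[ σ ] x ℤ₂.≈ (σ ^₂ 2) ℤ₂.* representative ℤ₂ κ
    go x-eq (inj₁ (k , m-eq)) with parity k
    ... | inj₁ (l , k-eq) = finish ⟨1⟩ (class-1 x-eq m-eq k-eq)
    ... | inj₂ (l , k-eq) = finish ⟨-3⟩ (class-5 x-eq m-eq k-eq)
    go x-eq (inj₂ (k , m-eq)) with parity k
    ... | inj₁ (l , k-eq) = finish ⟨-5⟩ (class-3 x-eq m-eq k-eq)
    ... | inj₂ (l , k-eq) = finish ⟨-1⟩ (class-7 x-eq m-eq k-eq)

  -- (1 + 2h)² = 1 + 4(h + h²), and h + h² is even.
  odd-square : ∀ {z h} → z ℤ₂.≈ ℤ₂.1# ℤ₂.+ 2ℤ₂ ℤ₂.* h →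
               ∃[ j ] z ℤ₂.* z ℤ₂.≈ ℤ₂.1# ℤ₂.+ 2ℤ₂ ℤ₂.* (2ℤ₂ ℤ₂.* (2ℤ₂ ℤ₂.* j))
  odd-square {z} {h} z-odd = let j , eq = pronic in
    j , ℤ₂.trans (square-odd z-odd) (ℤ₂.+-congˡ (ℤ₂.*-congˡ (ℤ₂.*-congˡ eq)))
    where
    pronic : ∃[ j ] h ℤ₂.+ h ℤ₂.* h ℤ₂.≈ 2ℤ₂ ℤ₂.* j
    pronic with parity h
    ... | inj₁ (i , h-even) = _ , pronic-even h-even
    ... | inj₂ (i , h-odd) = _ , pronic-odd h-odd

  representative≉1mod8 : ∀ κ → κ ≢ ⟨1⟩ → ∀ j → ¬ (representative ℤ₂ κ ℤ₂.≈ ℤ₂.1# ℤ₂.+ 2ℤ₂ ℤ₂.* (2ℤ₂ ℤ₂.* (2ℤ₂ ℤ₂.* j)))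
  representative≉1mod8 κ κ≢1 j p = indivisible κ κ≢1 (residue (approx (representative ℤ₂ κ) 3) (approx j 3) (at p 3))
    where
    indivisible : ∀ κ → κ ≢ ⟨1⟩ → ¬ (+ 8 ∣ approx (representative ℤ₂ κ) 3 ℤ.- 1ℤ)
    indivisible ⟨1⟩ κ≢1 = ⊥-elim (κ≢1 ≡.refl)
    -- The numbers -4, -2 and -6 are d - 1 for d = -3, -1 and -5.
    indivisible ⟨-3⟩ _ = from-no (+ 8 ∣? -[1+ 3 ])
    indivisible ⟨-1⟩ _ = from-no (+ 8 ∣? -[1+ 1 ])
    indivisible ⟨-5⟩ _ = from-no (+ 8 ∣? -[1+ 5 ])
    shift : ∀ a j → a ℤ.- (1ℤ ℤ.+ + 2 ℤ.* (+ 2 ℤ.* (+ 2 ℤ.* j))) ℤ.+ j ℤ.* + 8 ≡ a ℤ.- 1ℤ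
    shift = solve-∀
    residue : ∀ a j → a ≡ 1ℤ ℤ.+ + 2 ℤ.* (+ 2 ℤ.* (+ 2 ℤ.* j)) mod2^ 3 → + 8 ∣ a ℤ.- 1ℤ
    residue a j (mk d) = along (shift a j) (ℤ∣.∣m∣n⇒∣m+n d (divides j ≡.refl))

  -- The factor 4ᵏ clears the denominator of a square root z/2ᵏ in ℚ₂. Descent on k: for k > 0
  -- parity makes z even, and a factor 4 cancels; for k = 0, z is odd, so z² is 1 modulo 8 while d
  -- is not.
  representative-nonsquare-ℤ₂ : ∀ κ → κ ≢ ⟨1⟩ → ∀ k z → ¬ (z ℤ₂.* z ℤ₂.≈ representative ℤ₂ κ ℤ₂.* 2ℤ₂ ^₂ (k ℕ.+ k))
  representative-nonsquare-ℤ₂ κ κ≢1 k z eq with parity z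
  representative-nonsquare-ℤ₂ κ κ≢1 zero z eq | inj₁ (h , z-even) =
    odd≉even _ (2ℤ₂ ℤ₂.* (h ℤ₂.* h)) (ℤ₂.trans (ℤ₂.sym (proj₂ (representative-odd κ)))
      (ℤ₂.trans (ℤ₂.sym (ℤ₂.*-identityʳ _)) (ℤ₂.trans (ℤ₂.sym eq) (square-even z-even))))
  representative-nonsquare-ℤ₂ κ κ≢1 zero z eq | inj₂ (h , z-odd) =
    let j , z²-eq = odd-square z-odd in
    representative≉1mod8 κ κ≢1 j (ℤ₂.trans (ℤ₂.sym (ℤ₂.*-identityʳ _)) (ℤ₂.trans (ℤ₂.sym eq) z²-eq))
  representative-nonsquare-ℤ₂ κ κ≢1 (suc k) z eq | inj₁ (h , z-even) =
    representative-nonsquare-ℤ₂ κ κ≢1 k h (2*-cancel (2*-cancel (ℤ₂.trans (ℤ₂.sym 4-shift′)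
      (ℤ₂.trans (ℤ₂.sym (square-even z-even)) (ℤ₂.trans eq (ℤ₂.trans
        (ℤ₂.reflexive (cong (λ n → representative ℤ₂ κ ℤ₂.* 2ℤ₂ ^₂ suc n) (ℕₚ.+-suc k k))) 4-shift))))))
  representative-nonsquare-ℤ₂ κ κ≢1 (suc k) z eq | inj₂ (h , z-odd) =
    odd≉even _ (representative ℤ₂ κ ℤ₂.* 2ℤ₂ ^₂ (k ℕ.+ suc k)) (ℤ₂.trans (ℤ₂.sym (square-odd z-odd)) (ℤ₂.trans eq 2-shift))

opaque
  ℤ₂-cubicFixedPoint :
    let open CommutativeRing ℤ₂
        open RingOps ℤ₂
        open HenselIdentities ℤ₂ using (2#)
    in
    ∀ v b c → ∃[ w ] w ≈ - v + 2# * - (v * (4 · (b * w ^ 2) + 8 · (c * w ^ 3)))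
  ℤ₂-cubicFixedPoint v b c = fixedPoint (ℤ₂.- v) G G-cong
    where
    open RingOps ℤ₂
    G : ℤ₂.Carrier → ℤ₂.Carrier
    G w = ℤ₂.- (v ℤ₂.* (4 · (b ℤ₂.* w ^ 2) ℤ₂.+ 8 · (c ℤ₂.* w ^ 3)))
    ^-mod : ∀ n k {x y} → x ≡[ n ] y → x ^ k ≡[ n ] y ^ k
    ^-mod n zero p = mod-reflexive ≡.refl
    ^-mod n (suc k) p = mod-* p (^-mod n k p)
    *-mod : ∀ n a {x y} → x ≡[ n ] y → a ℤ₂.* x ≡[ n ] a ℤ₂.* y
    *-mod n a p = mod-* (mod-reflexive {n} {approx a n} ≡.refl) p
    ·-mod : ∀ n k {x y} → x ≡[ n ] y → k · x ≡[ n ] k · y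
    ·-mod n zero p = mod-reflexive ≡.refl
    ·-mod n (suc k) {x} {y} p = mod-+ p (·-mod n k {x} {y} p)
    G-cong : ∀ n {x y} → x ≡[ n ] y → G x ≡[ n ] G y
    G-cong n {x} {y} p = mod-neg (*-mod n v {4 · (b ℤ₂.* x ^ 2) ℤ₂.+ 8 · (c ℤ₂.* x ^ 3)} {4 · (b ℤ₂.* y ^ 2) ℤ₂.+ 8 · (c ℤ₂.* y ^ 3)}
      (mod-+ (·-mod n 4 {b ℤ₂.* x ^ 2} {b ℤ₂.* y ^ 2} (*-mod n b {x ^ 2} {y ^ 2} (^-mod n 2 {x} {y} p)))
             (·-mod n 8 {c ℤ₂.* x ^ 3} {c ℤ₂.* y ^ 3} (*-mod n c {x ^ 3} {y ^ 3} (^-mod n 3 {x} {y} p)))))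

  ℤ₂-integralFactors : ∀ {W} → Unit ℤ₂ (Weierstrass.a₁ W) → Unit ℤ₂ (discriminant ℤ₂ W) → IntegralFactors ℤ₂ W
  ℤ₂-integralFactors a₁-unit Δ-unit = integralFactors ℤ₂ odd⇒unit ℤ₂-cubicFixedPoint (unit⇒odd a₁-unit) Δ-unit (squareClass-of Δ-unit)

-- Reduction and base change

module Homomorphism {c ℓ c′ ℓ′} (R : CommutativeRing c ℓ) (S : CommutativeRing c′ ℓ′)
  {f : CommutativeRing.Carrier R → CommutativeRing.Carrier S}
  (isHom : IsRingHomomorphism (CommutativeRing.rawRing R) (CommutativeRing.rawRing S) f) where
  private
    module R where
      open CommutativeRing R public
      open RingOps R public
      open WeierstrassIdentities R public
    module S where
      open CommutativeRing S public
      open RingOps S public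
      open WeierstrassIdentities S public
      open Algebra.Properties.Semiring.Exp semiring using (^-congˡ) public
      open Algebra.Properties.Semiring.Mult semiring using () renaming (×-congʳ to ·-congʳ) public
  open S using (_≈_; trans; sym)
  open IsRingHomomorphism isHom public

  ^-homo : ∀ x n → f (x R.^ n) ≈ f x S.^ n
  ^-homo x zero = 1#-homo
  ^-homo x (suc n) = trans (*-homo x (x R.^ n)) (S.*-congˡ (^-homo x n))

  ·-homo : ∀ n x → f (n R.· x) ≈ n S.· f x
  ·-homo zero x = 0#-homo
  ·-homo (suc n) x = trans (+-homo x (n R.· x)) (S.+-congˡ (·-homo n x))

  sub-homo : ∀ x y → f (x R.- y) ≈ f x S.- f y
  sub-homo x y = trans (+-homo x (R.- y)) (S.+-congˡ (-‿homo y))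

  unit-homo : ∀ {x} → Unit R x → Unit S (f x)
  unit-homo {x} (y , xy≈1) = f y , trans (sym (*-homo x y)) (trans (⟦⟧-cong xy≈1) 1#-homo)

  representative-homo : ∀ κ → f (representative R κ) ≈ representative S κ
  representative-homo ⟨1⟩ = 1#-homo
  representative-homo ⟨-3⟩ = trans (-‿homo _) (S.-‿cong (trans (·-homo 3 R.1#) (S.·-congʳ 3 1#-homo)))
  representative-homo ⟨-1⟩ = trans (-‿homo _) (S.-‿cong 1#-homo)
  representative-homo ⟨-5⟩ = trans (-‿homo _) (S.-‿cong (trans (·-homo 5 R.1#) (S.·-congʳ 5 1#-homo)))

  private
    b-homo : ∀ x a → f (x R.^ 2 R.+ 4 R.· a) ≈ f x S.^ 2 S.+ 4 S.· f a
    b-homo x a = trans (+-homo _ _) (S.+-cong (^-homo x 2) (·-homo 4 a))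

  b₂-homo : ∀ W → f (R.b₂ W) ≈ S.b₂ (mapW f W)
  b₂-homo W = b-homo a₁ a₂ where open Weierstrass W

  b₄-homo : ∀ W → f (R.b₄ W) ≈ S.b₄ (mapW f W)
  b₄-homo W = trans (+-homo _ _) (S.+-cong (·-homo 2 a₄) (*-homo a₁ a₃)) where open Weierstrass W

  b₆-homo : ∀ W → f (R.b₆ W) ≈ S.b₆ (mapW f W)
  b₆-homo W = b-homo a₃ a₆ where open Weierstrass W

  Factors-homo : ∀ {W p q e} → R.Factors W p q e → S.Factors (mapW f W) (f p) (f q) (f e)
  Factors-homo {W} {p} {q} {e} F = record
    { b₂-eq = trans (sym (b₂-homo W)) (trans (⟦⟧-cong b₂-eq)
        (trans (sub-homo _ e) (S.+-congʳ (·-homo 8 p))))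
    ; b₄-eq = trans (sym (b₄-homo W)) (trans (⟦⟧-cong b₄-eq)
        (trans (sub-homo _ _) (S.+-cong (·-homo 2 q) (S.-‿cong (*-homo e p)))))
    ; b₆-eq = trans (sym (b₆-homo W)) (trans (⟦⟧-cong b₆-eq) (trans (-‿homo _) (S.-‿cong (*-homo e q))))
    }
    where open R.Factors F

  resultant-homo : ∀ p q e → f (R.resultant p q e) ≈ S.resultant (f p) (f q) (f e)
  resultant-homo p q e = trans (+-homo _ _) (S.+-cong
    (trans (+-homo _ _) (S.+-cong (^-homo e 2) (trans (·-homo 8 _) (S.·-congʳ 8 (*-homo e p)))))
    (·-homo 16 q))

  Roots-homo : ∀ {W ρ g n} → R.Roots W ρ g n → S.Roots (mapW f W) (f ρ) (f g) (f n)
  Roots-homo {W} {ρ} {g} {n} H = record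
    { b₂-eq = trans (sym (b₂-homo W)) (trans (⟦⟧-cong b₂-eq) (trans (-‿homo _) (S.-‿cong
        (trans (·-homo 4 _) (S.·-congʳ 4 (trans (+-homo _ _) (S.+-congˡ (·-homo 2 g))))))))
    ; b₄-eq = trans (sym (b₄-homo W)) (trans (⟦⟧-cong b₄-eq) (trans (·-homo 2 _) (S.·-congʳ 2
        (trans (sub-homo _ n) (S.+-congʳ (trans (+-homo _ _)
          (S.+-cong (trans (·-homo 2 _) (S.·-congʳ 2 (*-homo ρ g))) (^-homo g 2))))))))
    ; b₆-eq = trans (sym (b₆-homo W)) (trans (⟦⟧-cong b₆-eq) (trans (-‿homo _) (S.-‿cong
        (trans (·-homo 4 _) (S.·-congʳ 4 (trans (*-homo ρ _) (S.*-congˡ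
          (trans (sub-homo _ n) (S.+-congʳ (^-homo g 2))))))))))
    }
    where open R.Roots H

-- Units in Heyting fields, and the embedding of ℤ₂ in ℚ₂

module _ {a k₁ k₂} (F : HeytingField a k₁ k₂) where
  open HeytingField F
  private
    module R = CommutativeRing (ringOf F)
    open Algebra.Properties.Ring R.ring using (-0#≈0#)

  #0⇒unit : ∀ {x} → x # 0# → Unit (ringOf F) x
  #0⇒unit {x} x#0 = let y , _ , dy≈1 = #⇒invertible x#0 in
    y , trans (*-congʳ (sym (trans (+-congˡ -0#≈0#) (+-identityʳ x)))) dy≈1

  unit⇒# : ∀ {x y} → Unit (ringOf F) (x - y) → x # y
  unit⇒# {x} {y} (z , dz≈1) = invertible⇒# (z , trans (*-comm z _) dz≈1 , dz≈1)

  1≉0 : ¬ (1# ≈ 0#)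
  1≉0 1≈0 = #-irrefl 1≈0 (unit⇒# (1# , trans (*-identityʳ _) (trans (+-congˡ -0#≈0#) (+-identityʳ 1#))))

  unit≉0 : ∀ {x} → Unit (ringOf F) x → ¬ (x ≈ 0#)
  unit≉0 {x} (y , xy≈1) x≈0 = 1≉0 (trans (sym xy≈1) (trans (*-congʳ x≈0) (R.zeroˡ y)))

  -- Tightness takes the place of deciding whether x is 0: to prove x ≈ 0 it is enough to refute
  -- that x is invertible.
  ¬unit⇒≈0 : ∀ {x} → ¬ Unit (ringOf F) x → x ≈ 0#
  ¬unit⇒≈0 {x} ¬u = proj₁ (tight x 0#) (λ x#0 → ¬u (#0⇒unit x#0))

opaque
  ℤ₂→ℚ₂-isRingHomomorphism : IsRingHomomorphism ℤ₂.rawRing (CommutativeRing.rawRing (ringOf ℚ₂)) ℤ₂→ℚ₂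
  ℤ₂→ℚ₂-isRingHomomorphism = record
    { isSemiringHomomorphism = record
      { isNearSemiringHomomorphism = record
        { +-isMonoidHomomorphism = record
          { isMagmaHomomorphism = record
            { isRelHomomorphism = record { cong = λ p → cross (ℤ₂.*-congʳ p) }
            ; homo = λ x y → cross (ℤ₂.*-congʳ (ℤ₂.sym (ℤ₂.+-cong (ℤ₂.*-identityʳ x) (ℤ₂.*-identityʳ y))))
            }
          ; ε-homo = ℚ₂.refl
          }
        ; *-homo = λ x y → cross ℤ₂.refl
        }
      ; 1#-homo = ℚ₂.refl
      }
    ; -‿homo = λ x → cross ℤ₂.refl
    }
    where open ℚ₂-Fractions using (cross)

module ℤ₂→ℚ₂ = Homomorphism ℤ₂ (ringOf ℚ₂) ℤ₂→ℚ₂-isRingHomomorphism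

opaque
  2-unit : Unit (ringOf ℚ₂) (ℚ₂.1# ℚ₂.+ ℚ₂.1#)
  2-unit = ½ , ℚ₂.trans (ℚ₂.*-congʳ {½} (ℚ₂.sym (ℤ₂→ℚ₂.+-homo ℤ₂.1# ℤ₂.1#)))
      (cross (lemma 2ℤ₂))
    where
    ½ : ℚ₂.Carrier
    ½ = ℤ₂.1# /2^ 1
    open ℚ₂-Fractions using (cross)
    lemma : ∀ x → x ℤ₂.* ℤ₂.1# ℤ₂.* ℤ₂.1# ℤ₂.≈ ℤ₂.1# ℤ₂.* (x ℤ₂.* ℤ₂.1#)
    lemma x = ℤ₂.trans (ℤ₂.*-identityʳ (x ℤ₂.* ℤ₂.1#)) (ℤ₂.sym (ℤ₂.*-identityˡ (x ℤ₂.* ℤ₂.1#)))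

opaque
  representative-nonsquare : ∀ κ → κ ≢ ⟨1⟩ → ∀ x → ¬ (x ℚ₂.* x ℚ₂.≈ representative (ringOf ℚ₂) κ)
  representative-nonsquare κ κ≢1 (z /2^ k) eq = representative-nonsquare-ℤ₂ κ κ≢1 k z
    (ℤ₂.trans (ℤ₂.sym (ℤ₂.*-identityʳ (z ℤ₂.* z))) (uncross eq′))
    where
    open ℚ₂-Fractions using (uncross)
    eq′ : ((z ℤ₂.* z) /2^ (k ℕ.+ k)) ℚ₂.≈ ℤ₂→ℚ₂ (representative ℤ₂ κ)
    eq′ = ℚ₂.trans eq (ℚ₂.sym (ℤ₂→ℚ₂.representative-homo κ))

open HenselIdentities ℤ₂ using (b₂-odd; factors; resultant-odd)
open ℤ₂^ using () renaming (_^_ to _^₂_)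

-- The roots of ψ are ρ and g ± h√d. In the closure, `separated` keeps ρ apart from the other two
-- and `h-unit` helps to keep those two apart from each other.
record RationalRoots {a ℓ} (S : CommutativeRing a ℓ) (W : Weierstrass (CommutativeRing.Carrier S)) : Set (a ⊔ ℓ) where
  open CommutativeRing S
  open WeierstrassIdentities S
  open RingOps S
  field
    κ         : SquareClass
    ρ g h     : Carrier
    isRoots   : Roots W ρ g (h ^ 2 * representative S κ)
    h-unit    : Unit S h
    separated : Unit S ((ρ - g) ^ 2 - h ^ 2 * representative S κ)

module _ {a ℓ a′ ℓ′} (R : CommutativeRing a ℓ) (S : CommutativeRing a′ ℓ′)
  {f : CommutativeRing.Carrier R → CommutativeRing.Carrier S}
  (isHom : IsRingHomomorphism (CommutativeRing.rawRing R) (CommutativeRing.rawRing S) f) where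
  open CommutativeRing S
  open WeierstrassIdentities S
  open RingOps S
  open Units S
  private module f = Homomorphism R S isHom

  rationalRoots : Unit S (1# + 1#) → ∀ {W W′ u r s t} → ChangeOfVariables S W (mapW f W′) u r s t → Unit S u →
    IntegralFactors R W′ → RationalRoots S W
  rationalRoots (½ , 2½≈1) {W} {W′} {u} {r} C u-unit I = record
    { κ = κ
    ; isRoots = Roots-cong n≈ (roots C (f.Factors-homo isFactors) 2·½≈1)
    ; h-unit = unit-* (unit-^ 2 u-unit) c-unit
    ; separated = unit-resp (trans (sym (separation u r _ _ _ 2·½≈1)) (+-congˡ (-‿cong n≈)))
        (unit-* (unit-* (unit-^ 4 u-unit) (unit-^ 4 (unit-factorʳ (1# , trans (*-identityʳ _) 2½≈1))))
          (unit-resp (f.resultant-homo p q e) (f.unit-homo resultant-unit)))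
    }
    where
    open IntegralFactors I
    2·½≈1 : 2 · ½ ≈ 1#
    2·½≈1 = trans (2·≈2* ½) 2½≈1
    square′ : f p ^ 2 - f q ≈ f c ^ 2 * representative S κ
    square′ = trans (sym (trans (f.sub-homo _ q) (+-congʳ (f.^-homo p 2))))
      (trans (f.⟦⟧-cong square) (trans (f.*-homo _ _) (*-cong (f.^-homo c 2) (f.representative-homo κ))))
    n≈ : u ^ 4 * (f p ^ 2 - f q) ≈ (u ^ 2 * f c) ^ 2 * representative S κ
    n≈ = scale u (f p) (f q) (f c) _ square′
    -- c divides 2 in R, and 2 becomes invertible in S.
    c-unit : Unit S (f c)
    c-unit = unit-factorˡ (unit-resp
      (trans (sym (trans (f.·-homo 2 _) (trans (2·≈2* _) (trans (*-congˡ f.1#-homo) (*-identityʳ _)))))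
        (trans (f.⟦⟧-cong (CommutativeRing.sym R (proj₂ c∣2))) (f.*-homo c _)))
      (½ , 2½≈1))

open HenselIdentities ℤ₂ using (b₂-odd; factors; resultant-odd)
open ℤ₂^ using () renaming (_^_ to _^₂_)

-- Ordinary reduction and the parity of `a₁`

module _ {c ℓ} (R : CommutativeRing c ℓ) where
  open CommutativeRing R
  open Algebra.Properties.Ring ring using (-0#≈0#)

  -- R/(2) has the same elements and operations as R, so Δ is the same term in both, and its
  -- vanishing in R/(2) says that it is even in R.
  even-discriminant : ∀ {W h k} → Weierstrass.a₁ W ≈ (1# + 1#) * h → Weierstrass.a₃ W ≈ (1# + 1#) * k →
                      ∃[ m ] discriminant R W ≈ (1# + 1#) * m
  even-discriminant {W} a₁-even a₃-even = 0⇒even (discriminant≈0 2≈0 W (even⇒0 a₁-even) (even⇒0 a₃-even))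
    where
    open Quotient R (1# + 1#) using (multiple; _≈ₘ_; quotientRing)
    open WeierstrassIdentities quotientRing using (discriminant≈0)
    even⇒0 : ∀ {x h} → x ≈ (1# + 1#) * h → x ≈ₘ 0#
    even⇒0 {x} {h} x-even = multiple h (trans (trans (+-congˡ -0#≈0#) (+-identityʳ x)) (trans x-even (*-comm _ h)))
    0⇒even : ∀ {x} → x ≈ₘ 0# → ∃[ h ] x ≈ (1# + 1#) * h
    0⇒even {x} (multiple q eq) = q , trans (sym (trans (+-congˡ -0#≈0#) (+-identityʳ x))) (trans eq (*-comm q _))
    2≈0 : 1# + 1# ≈ₘ 0#
    2≈0 = even⇒0 (sym (*-identityʳ _))

open HenselIdentities ℤ₂ using (b₂-odd; factors; resultant-odd)
open ℤ₂^ using () renaming (_^_ to _^₂_)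

-- On the reduction modulo 2, the tangent at a point of order 2 is vertical: a₁x + a₃ = 0 there.
module _ {a ℓ c ℓ₁ ℓ₂} (R : CommutativeRing a ℓ) (Ω : HeytingField c ℓ₁ ℓ₂)
  {ι : CommutativeRing.Carrier R → HeytingField.Carrier Ω} where
  open CommutativeRing R
  open Quotient R (1# + 1#)
  open HenselIdentities R using (2#)
  private module Ω = CommutativeRing (ringOf Ω)

  module _ (isHom : IsRingHomomorphism (CommutativeRing.rawRing quotientRing) Ω.rawRing ι)
    (parity : ∀ z → (∃[ h ] z ≈ 2# * h) ⊎ (∃[ h ] z ≈ 1# + 2# * h))
    (odd⇒unit : ∀ {z h} → z ≈ 1# + 2# * h → Unit R z)
    (even⇒nonunit : ∀ {z h} → z ≈ 2# * h → ¬ Unit R z)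
    (W : Weierstrass Carrier) where
    open Weierstrass W
    open Points Ω (mapW ι W)
    private
      module ι = Homomorphism quotientRing (ringOf Ω) isHom

      unit⇒unit : ∀ {x} → Unit R x → Unit quotientRing x
      unit⇒unit (y , xy≈1) = y , multiple 0# (trans (≈⇒-≈0 xy≈1) (sym (zeroˡ _)))
        where open LinearCombination R

      a₃≈0 : a₁ ≈ₘ 0# → 1# + 1# ≈ₘ 0# → ∀ P → TwoTorsion P → ¬ (P ≈ₚₜ 𝒪) → ι a₃ Ω.≈ Ω.0#
      a₃≈0 a₁≈0 2≈0 𝒪 _ P≉𝒪 = ⊥-elim (P≉𝒪 𝒪)
      a₃≈0 a₁≈0 2≈0 (affine x y _) (opposite _ eq) _ = modulo
        (Ω.1# ⊠ eq ⊞ (Ω.- x) ⊠ ιa₁≈0 ⊞ (Ω.- y) ⊠ ι2≈0)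
        (solve 4 (λ a₁ a₃ x y →
          a₃ := ♯ 0 :+ (♯ 1 :* (y :+ y :+ a₁ :* x :+ a₃ :- ♯ 0) :+ (:- x) :* (a₁ :- ♯ 0) :+ (:- y) :* (♯ 1 :+ ♯ 1 :- ♯ 0)))
          Ω.refl (ι a₁) (ι a₃) x y)
        where
        open LinearCombination (ringOf Ω)
        open IntegerCoefficients (ringOf Ω)
        ιa₁≈0 : ι a₁ Ω.≈ Ω.0#
        ιa₁≈0 = Ω.trans (ι.⟦⟧-cong a₁≈0) ι.0#-homo
        ι2≈0 : Ω.1# Ω.+ Ω.1# Ω.≈ Ω.0#
        ι2≈0 = Ω.trans (Ω.sym (Ω.trans (ι.+-homo 1# 1#) (Ω.+-cong ι.1#-homo ι.1#-homo)))
          (Ω.trans (ι.⟦⟧-cong 2≈0) ι.0#-homo)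

    -- Were a₁ even, a point of order 2 on the reduction would force a₃ = 0 there, excluding odd a₃
    -- (the supersingular case). With a₁ and a₃ both even, Δ would be even, against good reduction.
    a₁-unit : ∃[ P ] TwoTorsion P × ¬ (P ≈ₚₜ 𝒪) → Unit R (discriminant R W) → Unit R a₁
    a₁-unit (P , P-torsion , P≉𝒪) Δ-unit with parity a₁ | parity a₃
    ... | inj₂ (_ , a₁-odd) | _ = odd⇒unit a₁-odd
    ... | inj₁ (_ , a₁-even) | inj₂ (_ , a₃-odd) =
      ⊥-elim (unit≉0 Ω (ι.unit-homo (unit⇒unit (odd⇒unit a₃-odd)))
        (a₃≈0 (even⇒≈0 a₁-even) (even⇒≈0 (sym (*-identityʳ _))) P P-torsion P≉𝒪))
      where
      even⇒≈0 : ∀ {x h} → x ≈ 2# * h → x ≈ₘ 0#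
      even⇒≈0 {x} {h} x-even = multiple h (trans (trans (+-congˡ -0#≈0#) (+-identityʳ x)) (trans x-even (*-comm _ h)))
        where open Algebra.Properties.Ring ring using (-0#≈0#)
    ... | inj₁ (_ , a₁-even) | inj₁ (_ , a₃-even) =
      ⊥-elim (even⇒nonunit (proj₂ (even-discriminant R a₁-even a₃-even)) Δ-unit)

ordinary⇒a₁-unit : ∀ {c ℓ₁ ℓ₂} {𝔽̄₂ : AlgebraicClosure 𝔽₂ c ℓ₁ ℓ₂} {E : EllipticCurve ℚ₂} (red : GoodOrdinaryReduction 𝔽̄₂ E) →
                   Unit ℤ₂ (Weierstrass.a₁ (GoodOrdinaryReduction.model red))
ordinary⇒a₁-unit {𝔽̄₂ = 𝔽̄₂} red = a₁-unit ℤ₂ top isRingHomomorphism parity odd⇒unit even⇒nonunit model ordinary good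
  where
  open GoodOrdinaryReduction red
  open AlgebraicClosure 𝔽̄₂ using (top; isRingHomomorphism)

goodOrdinary⇒rationalRoots : ∀ {c ℓ₁ ℓ₂} {𝔽̄₂ : AlgebraicClosure 𝔽₂ c ℓ₁ ℓ₂} {E : EllipticCurve ℚ₂} →
  GoodOrdinaryReduction 𝔽̄₂ E → RationalRoots (ringOf ℚ₂) (EllipticCurve.equation E)
goodOrdinary⇒rationalRoots red = rationalRoots ℤ₂ (ringOf ℚ₂) ℤ₂→ℚ₂-isRingHomomorphism 2-unit change (#0⇒unit ℚ₂ u#0)
    (ℤ₂-integralFactors (ordinary⇒a₁-unit red) good)
  where open GoodOrdinaryReduction red

-- Subrings and adjunction

record Subring {c ℓ p} (R : CommutativeRing c ℓ) (B : Pred (CommutativeRing.Carrier R) p) : Set (c ⊔ ℓ ⊔ p) where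
  open CommutativeRing R
  field
    ≈-closed : ∀ {x y} → x ≈ y → B x → B y
    +-closed : ∀ {x y} → B x → B y → B (x + y)
    *-closed : ∀ {x y} → B x → B y → B (x * y)
    -‿closed : ∀ {x} → B x → B (- x)

module _ {c ℓ p} {R : CommutativeRing c ℓ} {B : Pred (CommutativeRing.Carrier R) p} (sub : Subring R B) where
  open CommutativeRing R
  open Polynomial R using (eval)
  open Subring sub
  open LinearCombination R
  open IntegerCoefficients R using (solve; _:=_; _:+_; _:*_; _:-_; :-_; ♯)

  private
    -- Horner's scheme in x: c accumulates the coefficients read so far. Multiplying c + y(a + yE) =
    -- 0 by x, with xy = 1, gives (cx + a) + yE = 0, which is shorter by one.
    integral-inverse′ : ∀ {c d x y} f → All B f → B c → d ≈ 1# → B x → x * y ≈ 1# → eval (c ∷ f ++ [ d ]) y ≈ 0# → B y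
    integral-inverse′ {c} {d} {x} {y} [] [] c∈B d≈1 x∈B xy≈1 root = ≈-closed (sym (modulo
      (1# ⊠ root ⊞ (- y) ⊠ d≈1)
      (solve 3 (λ c d y → y := :- c :+ (♯ 1 :* (c :+ y :* (d :+ y :* ♯ 0) :- ♯ 0) :+ (:- y) :* (d :- ♯ 1))) refl c d y)))
      (-‿closed c∈B)
    integral-inverse′ {c} {d} {x} {y} (a ∷ f) (a∈B ∷ f⊆B) c∈B d≈1 x∈B xy≈1 root =
      integral-inverse′ f f⊆B (+-closed (*-closed c∈B x∈B) a∈B) d≈1 x∈B xy≈1 (modulo
        (x ⊠ root ⊞ (- (a + y * E)) ⊠ xy≈1)
        (solve 5 (λ c x a y E →
          c :* x :+ a :+ y :* E := ♯ 0 :+ (x :* (c :+ y :* (a :+ y :* E) :- ♯ 0) :+ (:- (a :+ y :* E)) :* (x :* y :- ♯ 1)))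
          refl c x a y E))
      where
      E : Carrier
      E = eval (f ++ [ d ]) y

  -- From yⁿ + … + f₁y + f₀ = 0, multiplication by xⁿ⁻¹ gives y = - (f₀xⁿ⁻¹ + f₁xⁿ⁻² + … ).
  integral-inverse : ∀ {d x y} f → All B f → d ≈ 1# → B x → x * y ≈ 1# → eval (f ++ [ d ]) y ≈ 0# → B y
  -- The equation reads 1 = 0, so y = 0, and x - x shows that 0 lies in B.
  integral-inverse {d} {x} {y} [] [] d≈1 x∈B xy≈1 root = ≈-closed (sym (modulo
    (y ⊠ root ⊞ (- y) ⊠ d≈1)
    (solve 3 (λ x d y → y := x :- x :+ (y :* (d :+ y :* ♯ 0 :- ♯ 0) :+ (:- y) :* (d :- ♯ 1))) refl x d y)))
    (+-closed x∈B (-‿closed x∈B))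
  integral-inverse (a ∷ f) (a∈B ∷ f⊆B) = integral-inverse′ f f⊆B a∈B

module ExtensionProperties {a k₁ k₂ c ℓ₁ ℓ₂} {F : HeytingField a k₁ k₂} (K : Extension F c ℓ₁ ℓ₂) where
  open Extension K
  private
    module F = CommutativeRing (ringOf F)
    module K = CommutativeRing (ringOf top)
  module ι = Homomorphism (ringOf F) (ringOf top) isRingHomomorphism
  open LinearCombination (ringOf top) using (-≈0⇒≈; ≈⇒-≈0)

  ι-≈0 : ∀ {x} → ι x ≈ 0# → x F.≈ F.0#
  ι-≈0 ιx≈0 = ¬unit⇒≈0 F (λ u → unit≉0 top (ι.unit-homo u) ιx≈0)

  ι-injective : ∀ {x y} → ι x ≈ ι y → x F.≈ y
  ι-injective {x} {y} p = LinearCombination.-≈0⇒≈ (ringOf F) (ι-≈0 (K.trans (ι.sub-homo x y) (≈⇒-≈0 p)))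

  Base-subring : Subring (ringOf top) (Base K)
  Base-subring = record
    { ≈-closed = λ { x≈y (r , p) → r , K.trans p x≈y }
    ; +-closed = λ { (r , p) (s , q) → r F.+ s , K.trans (ι.+-homo r s) (K.+-cong p q) }
    ; *-closed = λ { (r , p) (s , q) → r F.* s , K.trans (ι.*-homo r s) (K.*-cong p q) }
    ; -‿closed = λ { (r , p) → F.- r , K.trans (ι.-‿homo r) (K.-‿cong p) }
    }

  Adjoin-subring : ∀ {p} {S : Pred Carrier p} → Subring (ringOf top) (Adjoin K S)
  Adjoin-subring = record { ≈-closed = resp ; +-closed = add ; *-closed = mul ; -‿closed = neg }

  Algebraic : Set _
  Algebraic = ∀ x → ∃[ f ] Polynomial.eval (ringOf top) (map ι (f ++ [ F.1# ])) x ≈ 0#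

  Adjoin-least : Algebraic → ∀ {p q} {S : Pred Carrier p} {B : Pred Carrier q} → Subring (ringOf top) B →
                 Base K ⊆ B → S ⊆ B → Adjoin K S ⊆ B
  Adjoin-least algebraic {S = S} {B} sub base⊆B S⊆B = go
    where
    module B = Subring sub
    go : Adjoin K S ⊆ B
    go (base r) = base⊆B (r , K.refl)
    go (gen s) = S⊆B s
    go (add p q) = B.+-closed (go p) (go q)
    go (mul p q) = B.*-closed (go p) (go q)
    go (neg p) = B.-‿closed (go p)
    go (resp e p) = B.≈-closed e (go p)
    -- The monic equation is that of the inverse y; the powers needed to solve it for y are those of
    -- x, which lies in B.
    go (inv {x} {y} p xy≈1) =
      let f , root = algebraic y in
      integral-inverse sub (map ι f) (map⁺ (All.universal (λ r → base⊆B (r , K.refl)) f)) ι.1#-homo (go p) xy≈1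
        (≡.subst (λ g → Polynomial.eval (ringOf top) g y ≈ 0#) (map-++ ι f [ F.1# ]) root)

  module _ {p c′ ℓ′} {S : Pred Carrier p} (A : Algebra (ringOf F) c′ ℓ′) where
    private
      module A where
        open Algebra A public
        open CommutativeRing (Algebra.ring A) public hiding (ring)

    -- The isomorphism sends z to a preimage under `ev`. The preimage is read off the membership
    -- proof; injectivity of `ev` makes it depend on the value z alone up to equality, and pulls
    -- each homomorphism law back from K.
    adjoin-≅ : {ev : A.Carrier → Carrier} → IsRingHomomorphism A.rawRing K.rawRing ev →
      (∀ {x y} → ev x ≈ ev y → x A.≈ y) → (∀ r → ev (A.ι r) ≈ ι r) →
      (∀ x → Adjoin K S (ev x)) → (∀ {z} → Adjoin K S z → ∃[ x ] ev x ≈ z) →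
      Extension.algebra (adjoin K S) ≅ A
    adjoin-≅ {ev} isHom ev-injective ev-ι ev∈ onto = φ , isIso , λ r →
        ev-injective (K.trans (ev-φ (ι r , base r)) (K.sym (ev-ι r)))
      where
      module ev = IsRingHomomorphism isHom
      φ : Σ Carrier (Adjoin K S) → A.Carrier
      φ (z , z∈) = proj₁ (onto z∈)
      ev-φ : ∀ z → ev (φ z) ≈ proj₁ z
      ev-φ (z , z∈) = proj₂ (onto z∈)
      isIso : IsRingIsomorphism (CommutativeRing.rawRing (ringOf (Extension.top (adjoin K S)))) A.rawRing φ
      isIso = record
        { isRingMonomorphism = record
          { isRingHomomorphism = record
            { isSemiringHomomorphism = record
              { isNearSemiringHomomorphism = record
                { +-isMonoidHomomorphism = record
                  { isMagmaHomomorphism = record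
                    { isRelHomomorphism = record
                      { cong = λ {x} {y} p → ev-injective (K.trans (ev-φ x) (K.trans p (K.sym (ev-φ y)))) }
                    ; homo = λ x y → ev-injective (K.trans (ev-φ _)
                        (K.sym (K.trans (ev.+-homo _ _) (K.+-cong (ev-φ x) (ev-φ y)))))
                    }
                  ; ε-homo = ev-injective (K.trans (ev-φ _) (K.sym ev.0#-homo))
                  }
                ; *-homo = λ x y → ev-injective (K.trans (ev-φ _)
                    (K.sym (K.trans (ev.*-homo _ _) (K.*-cong (ev-φ x) (ev-φ y)))))
                }
              ; 1#-homo = ev-injective (K.trans (ev-φ _) (K.sym ev.1#-homo))
              }
            ; -‿homo = λ x → ev-injective (K.trans (ev-φ _) (K.sym (K.trans (ev.-‿homo _) (K.-‿cong (ev-φ x)))))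
            }
          ; injective = λ {x} {y} p → K.trans (K.sym (ev-φ x)) (K.trans (ev.⟦⟧-cong p) (ev-φ y))
          }
        ; surjective = λ y → (ev y , ev∈ y) , λ {z} p → ev-injective (K.trans (ev-φ z) p)
        }

  module QuadraticElements {d : F.Carrier} {η : Carrier} (η²≈d : η * η ≈ ι d) where
    Quadratic : Pred Carrier (a ⊔ ℓ₁)
    Quadratic z = ∃[ x ] ∃[ y ] ι x + ι y * η ≈ z

    open LinearCombination (ringOf top)
    open IntegerCoefficients (ringOf top) using (solve; _:=_; _:+_; _:*_; _:-_; :-_; ♯)

    Base⊆Quadratic : Base K ⊆ Quadratic
    Base⊆Quadratic (r , p) = r , F.0# , K.trans (K.+-congˡ (K.trans (K.*-congʳ ι.0#-homo) (K.zeroˡ η))) (K.trans (K.+-identityʳ _) p)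

    Quadratic-subring : Subring (ringOf top) Quadratic
    Quadratic-subring = record
      { ≈-closed = λ { p (x , y , e) → x , y , K.trans e p }
      ; +-closed = λ { (x , y , e) (x′ , y′ , e′) → x F.+ x′ , y F.+ y′ ,
          K.trans (K.+-cong (ι.+-homo x x′) (K.*-congʳ (ι.+-homo y y′)))
            (K.trans (solve 5 (λ x y x′ y′ η → x :+ x′ :+ (y :+ y′) :* η := x :+ y :* η :+ (x′ :+ y′ :* η)) K.refl (ι x) (ι y) (ι x′) (ι y′) η)
              (K.+-cong e e′)) }
      ; *-closed = λ { (x , y , e) (x′ , y′ , e′) → x F.* x′ F.+ y F.* y′ F.* d , x F.* y′ F.+ y F.* x′ ,
          K.trans (K.+-cong (K.trans (ι.+-homo _ _) (K.+-cong (ι.*-homo x x′) (K.trans (ι.*-homo _ d) (K.*-congʳ (ι.*-homo y y′)))))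
              (K.*-congʳ (K.trans (ι.+-homo _ _) (K.+-cong (ι.*-homo x y′) (ι.*-homo y x′)))))
            (K.trans (modulo ((- (ι y * ι y′)) ⊠ η²≈d)
              (solve 6 (λ x y x′ y′ η d →
                x :* x′ :+ y :* y′ :* d :+ (x :* y′ :+ y :* x′) :* η
                := (x :+ y :* η) :* (x′ :+ y′ :* η) :+ (:- (y :* y′)) :* (η :* η :- d))
                K.refl (ι x) (ι y) (ι x′) (ι y′) η (ι d)))
              (K.*-cong e e′)) }
      ; -‿closed = λ { (x , y , e) → F.- x , F.- y ,
          K.trans (K.+-cong (ι.-‿homo x) (K.*-congʳ (ι.-‿homo y)))
            (K.trans (solve 3 (λ x y η → :- x :+ (:- y) :* η := :- (x :+ y :* η)) K.refl (ι x) (ι y) η) (K.-‿cong e)) }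
      }

    module _ (d-nonsquare : ∀ x → ¬ (x F.* x F.≈ d)) where
      η∉Base : ¬ Base K η
      η∉Base (r , p) = d-nonsquare r (ι-injective (K.trans (ι.*-homo r r) (K.trans (K.*-cong p p) η²≈d)))

      -- If y were invertible, η = -x/y would lie in F and d would be a square; so y is 0, and then
      -- so is x.
      independent : ∀ {x y} → ι x + ι y * η ≈ 0# → x F.≈ F.0# × y F.≈ F.0#
      independent {x} {y} e = ι-≈0 ιx≈0 , y≈0
        where
        y≈0 : y F.≈ F.0#
        y≈0 = ¬unit⇒≈0 F λ { (v , yv≈1) → η∉Base (F.- (v F.* x) , K.trans
          (K.trans (ι.-‿homo _) (K.-‿cong (ι.*-homo v x)))
          (modulo ((- ι v) ⊠ e ⊞ η ⊠ K.trans (K.sym (ι.*-homo y v)) (K.trans (ι.⟦⟧-cong yv≈1) ι.1#-homo))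
            (solve 4 (λ x y v η → :- (v :* x) := η :+ ((:- v) :* (x :+ y :* η :- ♯ 0) :+ η :* (y :* v :- ♯ 1))) K.refl (ι x) (ι y) (ι v) η))) }
        ιx≈0 : ι x ≈ 0#
        ιx≈0 = K.trans (K.sym (K.trans (K.+-congˡ (K.trans (K.*-congʳ (K.trans (ι.⟦⟧-cong y≈0) ι.0#-homo)) (K.zeroˡ η))) (K.+-identityʳ _))) e

-- Evaluation of polynomials and quotients by monic quadratics

module _ {a k₁ k₂ c ℓ₁ ℓ₂} {F : HeytingField a k₁ k₂} (K : Extension F c ℓ₁ ℓ₂) where
  open Extension K
  open ExtensionProperties K
  open LinearCombination (ringOf top)
  private
    module F where
      open CommutativeRing (ringOf F) public
      open Polynomial (ringOf F) public
    module K = CommutativeRing (ringOf top)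
    module F[X] = CommutativeRing (F.polynomialRing)

  evalAt : Carrier → F.Poly → Carrier
  evalAt θ [] = 0#
  evalAt θ (r ∷ f) = ι r + θ * evalAt θ f

  module _ (θ : Carrier) where
    private
      open IntegerCoefficients (ringOf top) using (solve; _:=_; _:+_; _:*_; _:-_; :-_; ♯)
      ev = evalAt θ

      ev-+ : ∀ f g → ev (f F.+ₚ g) ≈ ev f + ev g
      ev-+ [] g = K.sym (K.+-identityˡ _)
      ev-+ (x ∷ f) [] = K.sym (K.+-identityʳ _)
      ev-+ (x ∷ f) (y ∷ g) = K.trans (K.+-cong (ι.+-homo x y) (K.*-congˡ (ev-+ f g)))
        (solve 5 (λ x y θ f g → x :+ y :+ θ :* (f :+ g) := x :+ θ :* f :+ (y :+ θ :* g)) K.refl (ι x) (ι y) θ (ev f) (ev g))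

      ev-neg : ∀ f → ev (F.-ₚ f) ≈ - ev f
      ev-neg [] = solve 0 (♯ 0 := :- (♯ 0)) K.refl
      ev-neg (x ∷ f) = K.trans (K.+-cong (ι.-‿homo x) (K.*-congˡ (ev-neg f)))
        (solve 3 (λ x θ f → :- x :+ θ :* (:- f) := :- (x :+ θ :* f)) K.refl (ι x) θ (ev f))

      ev-· : ∀ y f → ev (y F.·ₚ f) ≈ ι y * ev f
      ev-· y [] = K.sym (K.zeroʳ _)
      ev-· y (x ∷ f) = K.trans (K.+-cong (ι.*-homo y x) (K.*-congˡ (ev-· y f)))
        (solve 4 (λ x y θ f → y :* x :+ θ :* (y :* f) := y :* (x :+ θ :* f)) K.refl (ι x) (ι y) θ (ev f))

      ev-* : ∀ f g → ev (f F.*ₚ g) ≈ ev f * ev g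
      ev-* [] g = K.sym (K.zeroˡ _)
      ev-* (x ∷ f) g = K.trans (ev-+ (x F.·ₚ g) (F.0# ∷ f F.*ₚ g))
        (K.trans (K.+-cong (ev-· x g) (K.+-cong ι.0#-homo (K.*-congˡ (ev-* f g))))
          (solve 4 (λ x θ f g → x :* g :+ (♯ 0 :+ θ :* (f :* g)) := (x :+ θ :* f) :* g) K.refl (ι x) θ (ev f) (ev g)))

      ev-≈0 : ∀ f → (∀ n → F.coeff f n F.≈ F.0#) → ev f ≈ 0#
      ev-≈0 [] _ = K.refl
      ev-≈0 (x ∷ f) f≈0 = K.trans (K.+-cong (K.trans (ι.⟦⟧-cong (f≈0 0)) ι.0#-homo)
        (K.*-congˡ (ev-≈0 f (f≈0 ∘ suc)))) (K.trans (K.+-identityˡ _) (K.zeroʳ θ))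

      ev-sub : ∀ f g → ev (f F.+ₚ F.-ₚ g) ≈ ev f - ev g
      ev-sub f g = K.trans (ev-+ f (F.-ₚ g)) (K.+-congˡ (ev-neg g))

      ev-cong : ∀ {f g} → f F.≈ₚ g → ev f ≈ ev g
      ev-cong {f} {g} f≈g = -≈0⇒≈ (K.trans (K.sym (ev-sub f g))
        (ev-≈0 (f F.+ₚ F.-ₚ g) (F.coeff≈ (LinearCombination.≈⇒-≈0 F.polynomialRing f≈g))))

      coeff-+ : ∀ f g n → F.coeff (f F.+ₚ g) n F.≈ F.coeff f n F.+ F.coeff g n
      coeff-+ [] g n = F.sym (F.+-identityˡ _)
      coeff-+ (a ∷ f) [] n = F.sym (F.+-identityʳ _)
      coeff-+ (a ∷ f) (b ∷ g) zero = F.refl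
      coeff-+ (a ∷ f) (b ∷ g) (suc n) = coeff-+ f g n

    module _ (s t : F.Carrier) (root : ev (t ∷ s ∷ F.1# ∷ []) ≈ 0#) where
      private
        m : F.Poly
        m = t ∷ s ∷ F.1# ∷ []
        A = ringOf F [X]/ m
        module A = CommutativeRing (Algebra.ring A)
        open Quotient F.polynomialRing m using (multiple; _≈ₘ_)

        -- Division by m = X² + sX + t, by recursion on the dividend: if f = x + yX + qm, then X² =
        -- m - sX - t turns z + Xf into (z - ty) + (x - sy)X + (y + Xq)m.
        divide : ∀ f → ∃[ x ] ∃[ y ] ∃[ q ] f F.≈ₚ (x ∷ y ∷ []) F.+ₚ q F.*ₚ m
        divide [] = F.0# , F.0# , [] , F.coeffwise λ { 0 → F.refl ; 1 → F.refl ; (suc (suc n)) → F.refl }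
        divide (z ∷ f) = let x , y , q , eq = divide f in
          z F.- t F.* y , x F.- s F.* y , y ∷ q , F.coeffwise (coeffs x y (q F.*ₚ m) eq)
          where
          open IntegerCoefficients (ringOf F) using () renaming (solve to solveF; _:=_ to _:=F_; _:+_ to _:+F_; _:*_ to _:*F_; _:-_ to _:-F_; ♯ to #F)
          coeffs : ∀ x y g → f F.≈ₚ (x ∷ y ∷ []) F.+ₚ g → ∀ n → F.coeff (z ∷ f) n
            F.≈ F.coeff (((z F.- t F.* y) ∷ (x F.- s F.* y) ∷ []) F.+ₚ (y F.·ₚ m F.+ₚ (F.0# ∷ g))) n
          coeffs x y g eq n = F.trans (low n) (F.sym (F.trans
            (coeff-+ ((z F.- t F.* y) ∷ (x F.- s F.* y) ∷ []) (y F.·ₚ m F.+ₚ (F.0# ∷ g)) n)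
            (F.+-congˡ (coeff-+ (y F.·ₚ m) (F.0# ∷ g) n))))
            where
            f≈ : ∀ n → F.coeff f n F.≈ F.coeff (x ∷ y ∷ []) n F.+ F.coeff g n
            f≈ n = F.trans (F.coeff≈ eq n) (coeff-+ (x ∷ y ∷ []) g n)
            low : ∀ n → F.coeff (z ∷ f) n F.≈ F.coeff ((z F.- t F.* y) ∷ (x F.- s F.* y) ∷ []) n
              F.+ (F.coeff (y F.·ₚ m) n F.+ F.coeff (F.0# ∷ g) n)
            low 0 = solveF 3 (λ z t y → z :=F z :-F t :*F y :+F (y :*F t :+F #F 0)) F.refl z t y
            low 1 = F.trans (f≈ 0) (solveF 4 (λ x s y g → x :+F g :=F x :-F s :*F y :+F (y :*F s :+F g)) F.refl x s y (F.coeff g 0))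
            low 2 = F.trans (f≈ 1) (solveF 2 (λ y g → y :+F g :=F #F 0 :+F (y :*F #F 1 :+F g)) F.refl y (F.coeff g 1))
            low (suc (suc (suc n))) = F.trans (f≈ (suc (suc n))) (F.+-congˡ (F.sym (F.+-identityˡ _)))

      evalAt-isRingHomomorphism : IsRingHomomorphism A.rawRing K.rawRing ev
      evalAt-isRingHomomorphism = record
        { isSemiringHomomorphism = record
          { isNearSemiringHomomorphism = record
            { +-isMonoidHomomorphism = record
              { isMagmaHomomorphism = record
                { isRelHomomorphism = record { cong = cong-≈ₘ }
                ; homo = ev-+
                }
              ; ε-homo = K.refl
              }
            ; *-homo = ev-*
            }
          ; 1#-homo = K.trans (K.+-cong ι.1#-homo (K.zeroʳ θ)) (K.+-identityʳ 1#)
          }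
        ; -‿homo = ev-neg
        }
        where
        cong-≈ₘ : ∀ {f g} → f ≈ₘ g → ev f ≈ ev g
        cong-≈ₘ {f} {g} (multiple q eq) = -≈0⇒≈ (K.trans (K.sym (ev-sub f g))
          (K.trans (ev-cong eq) (K.trans (ev-* q m) (K.trans (K.*-congˡ root) (K.zeroʳ _)))))

      -- The difference of f and g is congruent modulo m to some x + yX, whose value x + yθ is 0;
      -- independence of 1 and θ then kills this remainder.
      evalAt-injective : (∀ {x y} → ι x + ι y * θ ≈ 0# → x F.≈ F.0# × y F.≈ F.0#) →
                         ∀ {f g} → ev f ≈ ev g → f A.≈ g
      evalAt-injective independent {f} {g} p with divide (f F.+ₚ F.-ₚ g)
      ... | x , y , q , eq = LinearCombination.-≈0⇒≈ (Algebra.ring A) f-g≈0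
        where
        f-g≈xy : f F.+ₚ F.-ₚ g ≈ₘ (x ∷ y ∷ [])
        f-g≈xy = multiple q (F[X].trans (F[X].+-congʳ eq)
          (F[X].trans (F[X].+-congʳ (F[X].+-comm (x ∷ y ∷ []) (q F.*ₚ m)))
            (F[X].trans (F[X].+-assoc (q F.*ₚ m) (x ∷ y ∷ []) _) (F[X].trans (F[X].+-congˡ (F[X].-‿inverseʳ (x ∷ y ∷ []))) (F[X].+-identityʳ _)))))
        xy≈0 : x F.≈ F.0# × y F.≈ F.0#
        xy≈0 = independent (K.trans
          (solve 3 (λ x y θ → x :+ y :* θ := x :+ θ :* (y :+ θ :* ♯ 0)) K.refl (ι x) (ι y) θ)
          (K.trans (K.sym (IsRingHomomorphism.⟦⟧-cong evalAt-isRingHomomorphism f-g≈xy))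
            (K.trans (ev-sub f g) (≈⇒-≈0 p))))
        f-g≈0 : f F.+ₚ F.-ₚ g A.≈ A.0#
        f-g≈0 = A.trans f-g≈xy (multiple [] (LinearCombination.≈⇒-≈0 F.polynomialRing {x ∷ y ∷ []} {[]}
          (F.coeffwise λ { 0 → proj₁ xy≈0 ; 1 → proj₂ xy≈0 ; (suc (suc n)) → F.refl })))

  module _ {d : F.Carrier} {η : Carrier} (η²≈d : η * η ≈ ι d) (d-nonsquare : ∀ x → ¬ (x F.* x F.≈ d)) where
    open QuadraticElements η²≈d

    hasDegree-2 : (∀ z → Quadratic z) → HasDegree K 2
    hasDegree-2 all = basis , span , indep
      where
      open IntegerCoefficients (ringOf top) using (solve; _:=_; _:+_; _:*_; ♯)
      basis : Vector Carrier 2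
      basis 0F = 1#
      basis 1F = η
      expand : ∀ x y → x * 1# + (y * η + 0#) ≈ x + y * η
      expand x y = solve 3 (λ x y η → x :* ♯ 1 :+ (y :* η :+ ♯ 0) := x :+ y :* η) K.refl x y η
      span : ∀ z → ∃[ v ] ι (v 0F) * 1# + (ι (v 1F) * η + 0#) ≈ z
      span z = let x , y , e = all z in (λ { 0F → x ; 1F → y }) , K.trans (expand (ι x) (ι y)) e
      indep : ∀ (v : Vector F.Carrier 2) → ι (v 0F) * 1# + (ι (v 1F) * η + 0#) ≈ 0# → ∀ i → v i F.≈ F.0#
      indep v e = λ { 0F → proj₁ both ; 1F → proj₂ both }
        where
        both : v 0F F.≈ F.0# × v 1F F.≈ F.0#
        both = independent d-nonsquare (K.trans (K.sym (expand (ι (v 0F)) (ι (v 1F)))) e)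

    -- θ = η - 1 generates the quotient by X² + 2X + t when t = 1 - d.
    module _ {t : F.Carrier} (t≈1-d : t F.≈ F.1# F.- d) where
      open RingOps (ringOf F)
      private
        θ : Carrier
        θ = η - 1#
        open IntegerCoefficients (ringOf top) using (solve; _:=_; _:+_; _:*_; _:-_; :-_; ♯)
        root : evalAt θ (t ∷ 2 · F.1# ∷ F.1# ∷ []) ≈ 0#
        root = modulo (1# ⊠ η²≈d ⊞ 1# ⊠ ιt ⊞ (η - 1#) ⊠ ι2 ⊞ ((η - 1#) * (η - 1#)) ⊠ ι.1#-homo)
          (solve 5 (λ η d t 2′ 1′ → let θ = η :- ♯ 1 in
            t :+ θ :* (2′ :+ θ :* (1′ :+ θ :* ♯ 0))
            := ♯ 0 :+ (♯ 1 :* (η :* η :- d) :+ ♯ 1 :* (t :- (♯ 1 :- d)) :+ θ :* (2′ :- (♯ 1 :+ ♯ 1)) :+ θ :* θ :* (1′ :- ♯ 1)))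
            K.refl η (ι d) (ι t) (ι (2 · F.1#)) (ι F.1#))
          where
          ιt : ι t ≈ 1# - ι d
          ιt = K.trans (ι.⟦⟧-cong t≈1-d) (K.trans (ι.sub-homo F.1# d) (K.+-congʳ ι.1#-homo))
          ι2 : ι (2 · F.1#) ≈ 1# + 1#
          ι2 = K.trans (ι.+-homo _ _) (K.+-cong ι.1#-homo (K.trans (ι.⟦⟧-cong (F.+-identityʳ F.1#)) ι.1#-homo))
        hom = evalAt-isRingHomomorphism θ (2 · F.1#) t root

      -- Evaluation sends X to η - 1, so a constant X would put η into the base field. This shows
      -- that the quotient is larger than the base.
      X-nonconstant : ∀ r → ¬ (CommutativeRing._≈_ (Algebra.ring (ringOf F [X]/ (t ∷ 2 · F.1# ∷ F.1# ∷ []))) (F.0# ∷ F.1# ∷ []) (r ∷ []))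
      X-nonconstant r X≈r = η∉Base d-nonsquare (r F.+ F.1# , K.trans (ι.+-homo r F.1#)
        (modulo ((- 1#) ⊠ IsRingHomomorphism.⟦⟧-cong hom X≈r ⊞ 1# ⊠ ι.0#-homo ⊞ η ⊠ ι.1#-homo)
          (solve 4 (λ r η 0′ 1′ → let θ = η :- ♯ 1 in
            r :+ 1′ := η :+ (:- (♯ 1) :* (0′ :+ θ :* (1′ :+ θ :* ♯ 0) :- (r :+ θ :* ♯ 0)) :+ ♯ 1 :* (0′ :- ♯ 0) :+ η :* (1′ :- ♯ 1)))
            K.refl (ι r) η (ι F.0#) (ι F.1#))))

      adjoin-≅-quotient : ∀ {p} {S : Pred Carrier p} → Adjoin K S ⊆ Quadratic → Adjoin K S η →
        Extension.algebra (adjoin K S) ≅ ringOf F [X]/ (t ∷ 2 · F.1# ∷ F.1# ∷ [])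
      adjoin-≅-quotient {S = S} quadratic η∈ = adjoin-≅ (ringOf F [X]/ (t ∷ 2 · F.1# ∷ F.1# ∷ [])) hom
        (evalAt-injective θ (2 · F.1#) t root independent′)
        (λ r → K.trans (K.+-congˡ (K.zeroʳ θ)) (K.+-identityʳ (ι r)))
        ev∈
        onto
        where
        θ∈ : Adjoin K S θ
        θ∈ = add η∈ (neg (resp ι.1#-homo (base F.1#)))
        ev∈ : ∀ f → Adjoin K S (evalAt θ f)
        ev∈ [] = resp ι.0#-homo (base F.0#)
        ev∈ (r ∷ f) = add (base r) (mul θ∈ (ev∈ f))
        onto : ∀ {z} → Adjoin K S z → ∃[ f ] evalAt θ f ≈ z
        -- x + yη = (x + y) + yθ.
        onto z∈ = let x , y , e = quadratic z∈ in (x F.+ y) ∷ y ∷ [] , K.trans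
          (K.+-congʳ (ι.+-homo x y))
          (K.trans (solve 3 (λ x y η → x :+ y :+ (η :- ♯ 1) :* (y :+ (η :- ♯ 1) :* ♯ 0) := x :+ y :* η) K.refl (ι x) (ι y) η) e)
        independent′ : ∀ {x y} → ι x + ι y * θ ≈ 0# → x F.≈ F.0# × y F.≈ F.0#
        independent′ {x} {y} e =
          let x-y≈0 , y≈0 = independent d-nonsquare (K.trans (K.+-congʳ (ι.sub-homo x y))
                (K.trans (solve 3 (λ x y η → x :- y :+ y :* η := x :+ y :* (η :- ♯ 1)) K.refl (ι x) (ι y) η) e)) in
          F.trans (LinearCombination.-≈0⇒≈ (ringOf F) x-y≈0) y≈0 , y≈0

-- The unramified quadratic extension

-- The norm of p + qω, where ω² + ω + 1 = 0.
module Norm {c ℓ} (R : CommutativeRing c ℓ) where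
  open CommutativeRing R
  open LinearCombination R
  open HenselIdentities R using (2#)
  open IntegerCoefficients R using (solve; _:=_; _:+_; _:*_; _:-_; :-_; ♯)

  norm : Carrier → Carrier → Carrier
  norm p q = p * p - p * q + q * q

  norm-sym : ∀ p q → norm p q ≈ norm q p
  norm-sym p q = solve 2 (λ p q → p :* p :- p :* q :+ q :* q := q :* q :- q :* p :+ p :* p) refl p q

  -- Together with the next lemma: p² - pq + q² is anisotropic modulo 2, hence odd unless p and q
  -- are both even. This is the irreducibility of X² + X + 1 over 𝔽₂.
  norm-odd-even : ∀ {p q x y} → p ≈ 1# + 2# * x → q ≈ 2# * y → ∃[ h ] norm p q ≈ 1# + 2# * h
  norm-odd-even {p} {q} {x} {y} H₁ H₂ = _ , modulo ((p + (1# + 2# * x) - q) ⊠ H₁ ⊞ (q + 2# * y - (1# + 2# * x)) ⊠ H₂)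
    (solve 4 (λ p q x y → let two = ♯ 1 :+ ♯ 1 ; p′ = ♯ 1 :+ two :* x ; q′ = two :* y in
      p :* p :- p :* q :+ q :* q
      := ♯ 1 :+ two :* (two :* (x :+ x :* x) :- y :- two :* (x :* y) :+ two :* (y :* y))
        :+ ((p :+ p′ :- q) :* (p :- p′) :+ (q :+ q′ :- p′) :* (q :- q′))) refl p q x y)

  norm-odd-odd : ∀ {p q x y} → p ≈ 1# + 2# * x → q ≈ 1# + 2# * y → ∃[ h ] norm p q ≈ 1# + 2# * h
  norm-odd-odd {p} {q} {x} {y} H₁ H₂ = _ , modulo ((p + (1# + 2# * x) - q) ⊠ H₁ ⊞ (q + (1# + 2# * y) - (1# + 2# * x)) ⊠ H₂)
    (solve 4 (λ p q x y → let two = ♯ 1 :+ ♯ 1 ; p′ = ♯ 1 :+ two :* x ; q′ = ♯ 1 :+ two :* y in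
      p :* p :- p :* q :+ q :* q
      := ♯ 1 :+ two :* (x :+ y :+ two :* (x :* x) :+ two :* (y :* y) :- two :* (x :* y))
        :+ ((p :+ p′ :- q) :* (p :- p′) :+ (q :+ q′ :- p′) :* (q :- q′))) refl p q x y)

IsCubeRoot : ∀ {c ℓ} (R : CommutativeRing c ℓ) → CommutativeRing.Carrier R → Set ℓ
IsCubeRoot R ω = ω * ω + ω + 1# ≈ 0# where open CommutativeRing R

module EisensteinOrder {a ℓ a′ ℓ′} (R : CommutativeRing a ℓ) (S : CommutativeRing a′ ℓ′)
  {f : CommutativeRing.Carrier R → CommutativeRing.Carrier S}
  (isHom : IsRingHomomorphism (CommutativeRing.rawRing R) (CommutativeRing.rawRing S) f)
  {ω : CommutativeRing.Carrier S}
  (ω-root : IsCubeRoot S ω) where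
  open CommutativeRing S hiding (zero)
  open RingOps S using (_^_)
  open Units S
  open HenselIdentities S using (2#)
  open LinearCombination S
  open IntegerCoefficients S using (solve; _:=_; _:+_; _:*_; _:-_; :-_; ♯)
  open Polynomial S using (eval)
  private
    module R where
      open CommutativeRing R public
      open HenselIdentities R public using (2#)
      open Norm R public
    module f = Homomorphism R S isHom

  Order : Pred Carrier (a ⊔ ℓ′)
  Order z = ∃[ p ] ∃[ q ] f p + f q * ω ≈ z

  IntegralOver : Pred Carrier (a ⊔ ℓ′)
  IntegralOver z = ∃[ g ] eval (map f g ++ [ 1# ]) z ≈ 0#

  image⊆Order : ∀ r → Order (f r)
  image⊆Order r = r , R.0# , trans (+-congˡ (trans (*-congʳ f.0#-homo) (zeroˡ ω))) (+-identityʳ _)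

  ω∈Order : Order ω
  ω∈Order = R.0# , R.1# , trans (+-cong f.0#-homo (trans (*-congʳ f.1#-homo) (*-identityˡ ω))) (+-identityˡ ω)

  Order-subring : Subring S Order
  Order-subring = record
    { ≈-closed = λ { e (p , q , e′) → p , q , trans e′ e }
    ; +-closed = λ { (p , q , e) (p′ , q′ , e′) → p R.+ p′ , q R.+ q′ ,
        trans (+-cong (f.+-homo p p′) (*-congʳ (f.+-homo q q′)))
          (trans (solve 5 (λ p q p′ q′ ω → p :+ p′ :+ (q :+ q′) :* ω := p :+ q :* ω :+ (p′ :+ q′ :* ω)) refl (f p) (f q) (f p′) (f q′) ω)
            (+-cong e e′)) }
    ; *-closed = λ { (p , q , e) (p′ , q′ , e′) → p R.* p′ R.- q R.* q′ , p R.* q′ R.+ q R.* p′ R.- q R.* q′ ,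
        trans (+-cong (trans (f.sub-homo _ _) (+-cong (f.*-homo p p′) (-‿cong (f.*-homo q q′))))
            (*-congʳ (trans (f.sub-homo _ _) (+-cong (trans (f.+-homo _ _) (+-cong (f.*-homo p q′) (f.*-homo q p′))) (-‿cong (f.*-homo q q′))))))
          (trans (modulo ((- (f q * f q′)) ⊠ ω-root)
            (solve 5 (λ p q p′ q′ ω →
              p :* p′ :- q :* q′ :+ (p :* q′ :+ q :* p′ :- q :* q′) :* ω
              := (p :+ q :* ω) :* (p′ :+ q′ :* ω) :+ (:- (q :* q′)) :* (ω :* ω :+ ω :+ ♯ 1 :- ♯ 0))
              refl (f p) (f q) (f p′) (f q′) ω))
            (*-cong e e′)) }
    ; -‿closed = λ { (p , q , e) → R.- p , R.- q ,
        trans (+-cong (f.-‿homo p) (*-congʳ (f.-‿homo q)))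
          (trans (solve 3 (λ p q ω → :- p :+ (:- q) :* ω := :- (p :+ q :* ω)) refl (f p) (f q) ω) (-‿cong e)) }
    }

  2^-Order : ∀ k → Order (2# ^ k)
  2^-Order zero = Subring.≈-closed Order-subring f.1#-homo (image⊆Order R.1#)
  2^-Order (suc k) = *-closed (+-closed (2^-Order zero) (2^-Order zero)) (2^-Order k)
    where open Subring Order-subring

  private
    norm-homo : ∀ p q → f (R.norm p q) ≈ f p * f p - f p * f q + f q * f q
    norm-homo p q = trans (f.+-homo _ _) (+-cong
      (trans (f.sub-homo _ _) (+-cong (f.*-homo p p) (-‿cong (f.*-homo p q)))) (f.*-homo q q))

  -- The conjugate of p + qω is (p - q) - qω.
  Order⇒integral : Order ⊆ IntegralOver
  Order⇒integral {z} (p , q , e) = R.norm p q ∷ q R.- (p R.+ p) ∷ [] , modulo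
    (1# ⊠ norm-homo p q ⊞ z ⊠ trans (f.sub-homo _ _) (+-congˡ (-‿cong (f.+-homo p p)))
      ⊞ (f q - f p - f p + z + (f p + f q * ω)) ⊠ sym e ⊞ (f q * f q) ⊠ ω-root)
    (solve 6 (λ p q ω z N T →
      N :+ z :* (T :+ z :* (♯ 1 :+ z :* ♯ 0))
      := ♯ 0 :+ (♯ 1 :* (N :- (p :* p :- p :* q :+ q :* q)) :+ z :* (T :- (q :- (p :+ p)))
        :+ (q :- p :- p :+ z :+ (p :+ q :* ω)) :* (z :- (p :+ q :* ω)) :+ q :* q :* (ω :* ω :+ ω :+ ♯ 1 :- ♯ 0)))
      refl (f p) (f q) ω z (f (R.norm p q)) (f (q R.- (p R.+ p))))

  Order-inverse : ∀ p q → Unit R (R.norm p q) → ∃[ v ] Order v × (f p + f q * ω) * v ≈ 1#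
  Order-inverse p q (n , Nn≈1) = (f p - f q - f q * ω) * f n ,
    *-closed (p R.- q , R.- q , +-cong (f.sub-homo p q) (trans (*-congʳ (f.-‿homo q)) (sym (-‿distribˡ-* (f q) ω))))
      (image⊆Order n) ,
    modulo (1# ⊠ trans (*-congʳ (sym (norm-homo p q))) (trans (sym (f.*-homo _ n)) (trans (f.⟦⟧-cong Nn≈1) f.1#-homo))
        ⊞ (- (f q * f q * f n)) ⊠ ω-root)
      (solve 4 (λ p q ω n →
        (p :+ q :* ω) :* ((p :- q :- q :* ω) :* n)
        := ♯ 1 :+ (♯ 1 :* ((p :* p :- p :* q :+ q :* q) :* n :- ♯ 1) :+ (:- (q :* q :* n)) :* (ω :* ω :+ ω :+ ♯ 1 :- ♯ 0)))
        refl (f p) (f q) ω (f n))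
    where
    open Subring Order-subring
    open Algebra.Properties.Ring ring using (-‿distribˡ-*)

  module _
    (parity : ∀ z → (∃[ h ] z R.≈ R.2# R.* h) ⊎ (∃[ h ] z R.≈ R.1# R.+ R.2# R.* h))
    (odd⇒unit : ∀ {z h} → z R.≈ R.1# R.+ R.2# R.* h → Unit R z)
    (2-unit : Unit S 2#) (2-nonunit : ∀ {z} → Order z → ¬ (2# * z ≈ 1#)) where
    private
      -- An element p + qω with p, q both even is divisible by 2; otherwise its norm is odd and the
      -- conjugate over the norm inverts it.
      even⊎unit : ∀ {z} → Order z → (∃[ w ] Order w × z ≈ 2# * w) ⊎ (∃[ v ] Order v × z * v ≈ 1#)
      even⊎unit {z} (p , q , e) with parity p | parity q
      ... | inj₁ (x , p-even) | inj₁ (y , q-even) = inj₁ (f x + f y * ω , (x , y , refl) ,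
        trans (sym e) (modulo (1# ⊠ half p-even ⊞ ω ⊠ half q-even)
          (solve 5 (λ p q x y ω → let two = ♯ 1 :+ ♯ 1 in
            p :+ q :* ω := two :* (x :+ y :* ω) :+ (♯ 1 :* (p :- two :* x) :+ ω :* (q :- two :* y)))
            refl (f p) (f q) (f x) (f y) ω)))
        where
        half : ∀ {p x} → p R.≈ R.2# R.* x → f p ≈ 2# * f x
        half p-even = trans (f.⟦⟧-cong p-even) (trans (f.*-homo _ _)
          (*-congʳ (trans (f.+-homo _ _) (+-cong f.1#-homo f.1#-homo))))
      ... | inj₁ (_ , p-even) | inj₂ (_ , q-odd) = inj₂ (
        let v , v∈ , zv≈1 = Order-inverse p q (odd⇒unit (R.trans (R.norm-sym p q) (proj₂ (R.norm-odd-even q-odd p-even)))) in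
        v , v∈ , trans (*-congʳ (sym e)) zv≈1)
      ... | inj₂ (_ , p-odd) | inj₁ (_ , q-even) = inj₂ (
        let v , v∈ , zv≈1 = Order-inverse p q (odd⇒unit (proj₂ (R.norm-odd-even p-odd q-even))) in
        v , v∈ , trans (*-congʳ (sym e)) zv≈1)
      ... | inj₂ (_ , p-odd) | inj₂ (_ , q-odd) = inj₂ (
        let v , v∈ , zv≈1 = Order-inverse p q (odd⇒unit (proj₂ (R.norm-odd-odd p-odd q-odd))) in
        v , v∈ , trans (*-congʳ (sym e)) zv≈1)

    -- An integral x with 2ᵏ⁺¹x a unit v⁻¹ of the order would be in the order, as the inverse
    -- of 2ᵏ⁺¹v; but then 2 would be a unit of the order.
    unramified : ∀ k {x} → Order (x * 2# ^ k) → IntegralOver x →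
      (∃[ y ] IntegralOver y × x * y ≈ 1#) ⊎ (∃[ y ] IntegralOver y × x ≈ 2# * y)
    unramified zero {x} x∈ _ with even⊎unit x∈
    ... | inj₁ (w , w∈ , e) = inj₂ (w , Order⇒integral w∈ , trans (sym (*-identityʳ x)) e)
    ... | inj₂ (v , v∈ , e) = inj₁ (v , Order⇒integral v∈ , trans (*-congʳ (sym (*-identityʳ x))) e)
    unramified (suc k) {x} x∈ x-integral@(g , root) with even⊎unit x∈
    ... | inj₁ (w , w∈ , e) = unramified k (≈-closed (sym halved) w∈) x-integral
      where
      open Subring Order-subring
      halved : x * 2# ^ k ≈ w
      halved = -≈0⇒≈ (unit-cancelˡ 2-unit (modulo (1# ⊠ e)
        (solve 4 (λ x b k w → b :* (x :* k :- w) := ♯ 0 :+ ♯ 1 :* (x :* (b :* k) :- b :* w)) refl x 2# (2# ^ k) w)))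
    ... | inj₂ (v , v∈ , e) = ⊥-elim (2-nonunit (*-closed x∈O (*-closed 2^k∈ v∈))
        (trans (solve 4 (λ x b k v → b :* (x :* (k :* v)) := x :* (b :* k) :* v) refl x 2# (2# ^ k) v) e))
      where
      open Subring Order-subring
      2^k∈ = 2^-Order k
      x∈O : Order x
      x∈O = integral-inverse Order-subring (map f g) (map⁺ (All.universal image⊆Order g)) refl
        (*-closed (2^-Order (suc k)) v∈)
        (trans (solve 3 (λ x b v → b :* v :* x := x :* b :* v) refl x (2# ^ suc k) v) e) root

private
  two^ : ∀ k → ℤ₂→ℚ₂ (RingOps._^_ ℤ₂ 2ℤ₂ k) ℚ₂.≈ RingOps._^_ (ringOf ℚ₂) (ℚ₂.1# ℚ₂.+ ℚ₂.1#) k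
  two^ k = ℚ₂.trans (ℤ₂→ℚ₂.^-homo 2ℤ₂ k) (^-congˡ k (ℤ₂→ℚ₂.+-homo ℤ₂.1# ℤ₂.1#))
    where open Algebra.Properties.Semiring.Exp (CommutativeRing.semiring (ringOf ℚ₂)) using (^-congˡ)

opaque
  clearDenominator : ∀ x → ∃[ k ] ∃[ z ] x ℚ₂.* RingOps._^_ (ringOf ℚ₂) (ℚ₂.1# ℚ₂.+ ℚ₂.1#) k ℚ₂.≈ ℤ₂→ℚ₂ z
  clearDenominator (z /2^ k) = k , z , ℚ₂.trans (ℚ₂.*-congˡ {z /2^ k} (ℚ₂.sym (two^ k)))
      (cross (ℤ₂.trans (ℤ₂.*-identityʳ (z ℤ₂.* 2^k)) (ℤ₂.reflexive (cong (λ n → z ℤ₂.* RingOps._^_ ℤ₂ 2ℤ₂ n) (≡.sym (ℕₚ.+-identityʳ k))))))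
    where
    open ℚ₂-Fractions using (cross)
    2^k : ℤ₂.Carrier
    2^k = RingOps._^_ ℤ₂ 2ℤ₂ k

  even≉1 : ∀ z → ¬ (ℤ₂→ℚ₂ (2ℤ₂ ℤ₂.* z) ℚ₂.≈ ℚ₂.1#)
  even≉1 z eq = even⇒nonunit {2ℤ₂ ℤ₂.* z} {z} ℤ₂.refl (ℤ₂.1# , ℤ₂.trans (uncross eq) (ℤ₂.*-identityʳ ℤ₂.1#))
    where open ℚ₂-Fractions using (uncross)

module _ {c ℓ₁ ℓ₂} (M : Extension ℚ₂ c ℓ₁ ℓ₂) where
  open Extension M
  open ExtensionProperties M
  private
    module M where
      open CommutativeRing (ringOf top) public
      open RingOps (ringOf top) public
      open Units (ringOf top) public
    module ℤ₂→M where
      isHom : IsRingHomomorphism ℤ₂.rawRing M.rawRing (ι ∘ ℤ₂→ℚ₂)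
      isHom = Algebra.Morphism.Construct.Composition.isRingHomomorphism M.trans ℤ₂→ℚ₂-isRingHomomorphism isRingHomomorphism
      open Homomorphism ℤ₂ (ringOf top) isHom public
    open LinearCombination (ringOf top)
    open IntegerCoefficients (ringOf top) using (solve; _:=_; _:+_; _:*_; _:-_; :-_; _:×_; ♯)

  module _ {η : Carrier} (η²≈-3 : η * η ≈ ι (representative (ringOf ℚ₂) ⟨-3⟩)) where
    open QuadraticElements η²≈-3
    private
      ½ : Carrier
      ½ = ι (proj₁ 2-unit)

      2*½≈1 : (1# + 1#) * ½ ≈ 1#
      2*½≈1 = M.trans (M.*-congʳ (M.sym (M.trans (ι.+-homo _ _) (M.+-cong ι.1#-homo ι.1#-homo))))
        (M.trans (M.sym (ι.*-homo _ _)) (M.trans (ι.⟦⟧-cong (proj₂ 2-unit)) ι.1#-homo))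

      -- As η is a square root of -3, this is the primitive cube root of unity (-1 + √-3)/2.
      ω : Carrier
      ω = ½ * (η - 1#)

      η≈ : η ≈ 1# + (1# + 1#) * ω
      η≈ = modulo ((1# - η) ⊠ 2*½≈1)
        (solve 2 (λ η h → let two = ♯ 1 :+ ♯ 1 in
          η := ♯ 1 :+ two :* (h :* (η :- ♯ 1)) :+ (♯ 1 :- η) :* (two :* h :- ♯ 1)) M.refl η ½)

      ω-root : ω * ω + ω + 1# ≈ 0#
      ω-root = modulo ((½ * ½) ⊠ M.trans η²≈-3 (ι.representative-homo ⟨-3⟩) ⊞ (- (1# + ½ * η + ½)) ⊠ 2*½≈1)
        (solve 2 (λ η h → let two = ♯ 1 :+ ♯ 1 ; ω = h :* (η :- ♯ 1) in
          ω :* ω :+ ω :+ ♯ 1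
          := ♯ 0 :+ (h :* h :* (η :* η :- :- (3 :× (♯ 1))) :+ (:- (♯ 1 :+ h :* η :+ h)) :* (two :* h :- ♯ 1)))
          M.refl η ½)

      open EisensteinOrder ℤ₂ (ringOf top) ℤ₂→M.isHom ω-root

      module Q = CommutativeRing (ringOf ℚ₂)
      j : ℤ₂.Carrier → ℚ₂.Carrier
      j = ℤ₂→ℚ₂

      nonsquare : ∀ x → ¬ (x ℚ₂.* x ℚ₂.≈ representative (ringOf ℚ₂) ⟨-3⟩)
      nonsquare = representative-nonsquare ⟨-3⟩ (λ ())

      -- In terms of η = 1 + 2ω, 2(p + qω) = 1 reads (2p - 1 - q) + qη = 0. Independence gives q = 0
      -- and 2p = 1, impossible in ℤ₂.
      2-nonunit : ∀ {z} → Order z → ¬ ((1# + 1#) * z ≈ 1#)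
      2-nonunit {z} (p , q , e) 2z≈1 = even≉1 p (Q-sum (proj₁ parts) (proj₂ parts))
        where
        open LinearCombination (ringOf ℚ₂) using () renaming (-≈0⇒≈ to Q--≈0⇒≈)
        open Algebra.Properties.Ring Q.ring using (-0#≈0#)
        2p : ι (j (2ℤ₂ ℤ₂.* p)) ≈ (1# + 1#) * ι (j p)
        2p = M.trans (ℤ₂→M.*-homo 2ℤ₂ p) (M.*-congʳ (M.trans (ℤ₂→M.+-homo ℤ₂.1# ℤ₂.1#) (M.+-cong ℤ₂→M.1#-homo ℤ₂→M.1#-homo)))
        parts : j (2ℤ₂ ℤ₂.* p) ℚ₂.- ℚ₂.1# ℚ₂.- j q ℚ₂.≈ ℚ₂.0# × j q ℚ₂.≈ ℚ₂.0#
        parts = independent nonsquare (M.trans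
          (M.+-congʳ (M.trans (ι.sub-homo _ _) (M.+-congʳ (M.trans (ι.sub-homo _ _) (M.+-congˡ (M.-‿cong ι.1#-homo))))))
          (modulo (1# ⊠ 2z≈1 ⊞ (1# + 1#) ⊠ e ⊞ ι (j q) ⊠ η≈ ⊞ 1# ⊠ 2p)
            (solve 6 (λ p q z η ω p₂ → let two = ♯ 1 :+ ♯ 1 in
              p₂ :- ♯ 1 :- q :+ q :* η
              := ♯ 0 :+ (♯ 1 :* (two :* z :- ♯ 1) :+ two :* (p :+ q :* ω :- z) :+ q :* (η :- (♯ 1 :+ two :* ω))
                :+ ♯ 1 :* (p₂ :- two :* p)))
              M.refl (ι (j p)) (ι (j q)) z η ω (ι (j (2ℤ₂ ℤ₂.* p))))))
        Q-sum : ∀ {x y} → x ℚ₂.- ℚ₂.1# ℚ₂.- y ℚ₂.≈ ℚ₂.0# → y ℚ₂.≈ ℚ₂.0# → x ℚ₂.≈ ℚ₂.1#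
        Q-sum {x} {y} h₁ h₂ = Q--≈0⇒≈ (Q.trans (Q--≈0⇒≈ h₁) h₂)

      2^_⟨M⟩ : ℕ → Carrier
      2^ k ⟨M⟩ = (1# + 1#) M.^ k

      clear : ∀ {x k z} → x ℚ₂.* RingOps._^_ (ringOf ℚ₂) (ℚ₂.1# ℚ₂.+ ℚ₂.1#) k ℚ₂.≈ j z → ι x * 2^ k ⟨M⟩ ≈ ι (j z)
      clear {x} {k} eq = M.trans (M.*-congˡ (M.sym (M.trans (ι.^-homo _ k)
          (^-congˡ k (M.trans (ι.+-homo _ _) (M.+-cong ι.1#-homo ι.1#-homo))))))
        (M.trans (M.sym (ι.*-homo x _)) (ι.⟦⟧-cong eq))
        where open Algebra.Properties.Semiring.Exp M.semiring using (^-congˡ)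

      -- Clearing the denominators 2ᵏ of a and 2ˡ of b turns a + bη into z2ˡ + wη2ᵏ, and η = 1 + 2ω
      -- lies in the order.
      integralMultiple : ∀ {x} → Quadratic x → ∃[ k ] Order (x * 2^ k ⟨M⟩)
      integralMultiple {x} (a , b , e) =
        let k , z , az = clearDenominator a
            l , w , bw = clearDenominator b
        in k ℕ.+ l , ≈-closed
          (M.trans
            (modulo ((- 2^ l ⟨M⟩) ⊠ clear {a} {k} {z} az ⊞ (- (η * 2^ k ⟨M⟩)) ⊠ clear {b} {l} {w} bw ⊞ (2^ k ⟨M⟩ * 2^ l ⟨M⟩) ⊠ e)
              (solve 8 (λ A B Z W η x Tk Tl →
                Z :* Tl :+ W :* η :* Tk := x :* (Tk :* Tl)
                  :+ ((:- Tl) :* (A :* Tk :- Z) :+ (:- (η :* Tk)) :* (B :* Tl :- W) :+ Tk :* Tl :* (A :+ B :* η :- x)))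
                M.refl (ι a) (ι b) (ι (j z)) (ι (j w)) η x (2^ k ⟨M⟩) (2^ l ⟨M⟩)))
            (M.*-congˡ (M.sym (^-homo-* (1# + 1#) k l))))
          (+-closed (*-closed (image⊆Order z) (2^-Order l)) (*-closed (*-closed (image⊆Order w) η∈Order) (2^-Order k)))
        where
        open Algebra.Properties.Semiring.Exp M.semiring using (^-homo-*)
        open Subring Order-subring
        1∈Order : Order 1#
        1∈Order = 2^-Order 0
        η∈Order : Order η
        η∈Order = ≈-closed (M.sym η≈) (+-closed 1∈Order (*-closed (+-closed 1∈Order 1∈Order) ω∈Order))

    unramifiedQuadratic : (∀ z → Quadratic z) → UnramifiedQuadratic M
    unramifiedQuadratic all = hasDegree-2 M η²≈-3 nonsquare all ,
      λ x x-integral → let k , x∈ = integralMultiple (all x) in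
        unramified parity odd⇒unit (½ , 2*½≈1) 2-nonunit k x∈ x-integral

-- Points of order 2 over a field containing 1/2

module _ {c ℓ₁ ℓ₂} (Ω : HeytingField c ℓ₁ ℓ₂) where
  open HeytingField Ω
  open LinearCombination (ringOf Ω)
  open Units (ringOf Ω)
  private
    module Ω = CommutativeRing (ringOf Ω)
    open RingOps (ringOf Ω)
    open WeierstrassIdentities (ringOf Ω)
    open IntegerCoefficients (ringOf Ω) using (solve; _:=_; _:+_; _:*_; _:-_; :-_; _:×_; _:^_; ♯)
    open Algebra.Properties.Semiring.Mult Ω.semiring using () renaming (×-congʳ to ·-congʳ)

  #⇒unit : ∀ {x y} → x # y → Unit (ringOf Ω) (x - y)
  #⇒unit x#y = let z , _ , p = #⇒invertible x#y in z , p

  -- Equality with a root cannot be tested, but cotransitivity of e₁ # e₂ shows x apart from one of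
  -- the two. That factor is cancelled, and the same is done with the remaining pair.
  root-of-product : ∀ {x e₁ e₂ e₃} → e₁ # e₂ → e₁ # e₃ → e₂ # e₃ →
    (x - e₁) * ((x - e₂) * (x - e₃)) ≈ 0# → x ≈ e₁ ⊎ x ≈ e₂ ⊎ x ≈ e₃
  root-of-product {x} {e₁} {e₂} {e₃} e₁#e₂ e₁#e₃ e₂#e₃ p with #-cotrans e₁#e₂ x
  ... | inj₁ e₁#x = go (unit-cancelˡ (#⇒unit (#-sym e₁#x)) p)
    where
    go : (x - e₂) * (x - e₃) ≈ 0# → x ≈ e₁ ⊎ x ≈ e₂ ⊎ x ≈ e₃
    go q with #-cotrans e₂#e₃ x
    ... | inj₁ e₂#x = inj₂ (inj₂ (-≈0⇒≈ (unit-cancelˡ (#⇒unit (#-sym e₂#x)) q)))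
    ... | inj₂ x#e₃ = inj₂ (inj₁ (-≈0⇒≈ (unit-cancelˡ (#⇒unit x#e₃) (Ω.trans (*-comm _ _) q))))
  ... | inj₂ x#e₂ = go (unit-cancelˡ (#⇒unit x#e₂) (Ω.trans
      (solve 3 (λ a b c → b :* (a :* c) := a :* (b :* c)) Ω.refl (x - e₁) (x - e₂) (x - e₃)) p))
    where
    go : (x - e₁) * (x - e₃) ≈ 0# → x ≈ e₁ ⊎ x ≈ e₂ ⊎ x ≈ e₃
    go q with #-cotrans e₁#e₃ x
    ... | inj₁ e₁#x = inj₂ (inj₂ (-≈0⇒≈ (unit-cancelˡ (#⇒unit (#-sym e₁#x)) q)))
    ... | inj₂ x#e₃ = inj₁ (-≈0⇒≈ (unit-cancelˡ (#⇒unit x#e₃) (Ω.trans (*-comm _ _) q)))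

  -- The points of order 2 are those with 2y + a₁x + a₃ = 0, over the zeros x of ψ.
  module HalfPoints {½ : Carrier} (2½≈1 : (1# + 1#) * ½ ≈ 1#) (W : Weierstrass Carrier) where
    open Weierstrass W
    open Points Ω W

    ordinate : Carrier → Carrier
    ordinate x = - (½ * (a₁ * x + a₃))

    ordinate-cong : ∀ {x x′} → x ≈ x′ → ordinate x ≈ ordinate x′
    ordinate-cong p = -‿cong (*-congˡ (+-congʳ (*-congˡ p)))

    vertical⇒ordinate : ∀ {x y} → y + y + a₁ * x + a₃ ≈ 0# → y ≈ ordinate x
    vertical⇒ordinate {x} {y} p = modulo (½ ⊠ p ⊞ (- y) ⊠ 2½≈1)
      (solve 5 (λ a₁ a₃ x y h →
        y := :- (h :* (a₁ :* x :+ a₃)) :+ (h :* (y :+ y :+ a₁ :* x :+ a₃ :- ♯ 0) :+ (:- y) :* ((♯ 1 :+ ♯ 1) :* h :- ♯ 1)))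
        Ω.refl a₁ a₃ x y ½)

    ordinate-vertical : ∀ x → ordinate x + ordinate x + a₁ * x + a₃ ≈ 0#
    ordinate-vertical x = modulo ((- (a₁ * x + a₃)) ⊠ 2½≈1)
      (solve 4 (λ a₁ a₃ x h → let y = :- (h :* (a₁ :* x :+ a₃)) in
        y :+ y :+ a₁ :* x :+ a₃ := ♯ 0 :+ (:- (a₁ :* x :+ a₃)) :* ((♯ 1 :+ ♯ 1) :* h :- ♯ 1))
        Ω.refl a₁ a₃ x ½)

    private
      4-cancel : ∀ {x} → 4 · x ≈ 0# → x ≈ 0#
      4-cancel {x} p = unit-cancelˡ (½ , 2½≈1) (unit-cancelˡ (½ , 2½≈1) (Ω.trans
        (solve 1 (λ x → (♯ 1 :+ ♯ 1) :* ((♯ 1 :+ ♯ 1) :* x) := 4 :× x) Ω.refl x) p))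

      square-vertical : ∀ {x y} → y + y + a₁ * x + a₃ ≈ 0# → (2 · y + a₁ * x + a₃) ^ 2 ≈ 0#
      square-vertical {x} {y} p = modulo ((2 · y + a₁ * x + a₃) ⊠ p)
        (solve 4 (λ a₁ a₃ x y →
          (2 :× y :+ a₁ :* x :+ a₃) :^ 2 := ♯ 0 :+ (2 :× y :+ a₁ :* x :+ a₃) :* (y :+ y :+ a₁ :* x :+ a₃ :- ♯ 0))
          Ω.refl a₁ a₃ x y)

    -- In `square≈ψ` both the square and ψ(x) vanish, which leaves 4 times the curve equation.
    ψ≈0⇒equation : ∀ x → ψ W x ≈ 0# → let y = ordinate x in
      y ^ 2 + a₁ * x * y + a₃ * y ≈ x ^ 3 + a₂ * x ^ 2 + a₄ * x + a₆
    ψ≈0⇒equation x p = -≈0⇒≈ (4-cancel (modulo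
      ((- 1#) ⊠ square≈ψ W x (ordinate x) ⊞ 1# ⊠ square-vertical (ordinate-vertical x) ⊞ (- 1#) ⊠ p)
      (solve 4 (λ s r P l → 4 :× (l :- r) := ♯ 0 :+ (:- (♯ 1) :* (s :+ 4 :× r :- (P :+ 4 :× l)) :+ ♯ 1 :* (s :- ♯ 0) :+ :- (♯ 1) :* (P :- ♯ 0)))
        Ω.refl ((2 · (ordinate x) + a₁ * x + a₃) ^ 2) (x ^ 3 + a₂ * x ^ 2 + a₄ * x + a₆) (ψ W x) ((ordinate x) ^ 2 + a₁ * x * (ordinate x) + a₃ * (ordinate x)))))

    halfPoint : ∀ x → ψ W x ≈ 0# → Σ Point TwoTorsion
    halfPoint x p = affine x (ordinate x) (ψ≈0⇒equation x p) , opposite Ω.refl (ordinate-vertical x)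

    vertical⇒ψ≈0 : ∀ {x y} → y ^ 2 + a₁ * x * y + a₃ * y ≈ x ^ 3 + a₂ * x ^ 2 + a₄ * x + a₆ →
      y + y + a₁ * x + a₃ ≈ 0# → ψ W x ≈ 0#
    vertical⇒ψ≈0 {x} {y} e p = modulo ((- 1#) ⊠ square≈ψ W x y ⊞ 1# ⊠ square-vertical {x} {y} p ⊞ (- (4 · 1#)) ⊠ e)
      (solve 4 (λ s r P l → P := ♯ 0 :+ (:- (♯ 1) :* (s :+ 4 :× r :- (P :+ 4 :× l)) :+ ♯ 1 :* (s :- ♯ 0) :+ (:- (4 :× (♯ 1))) :* (l :- r)))
        Ω.refl ((2 · y + a₁ * x + a₃) ^ 2) (x ^ 3 + a₂ * x ^ 2 + a₄ * x + a₆) (ψ W x) (y ^ 2 + a₁ * x * y + a₃ * y))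

    module _ {e₁ e₂ e₃ : Carrier} (e₁#e₂ : e₁ # e₂) (e₁#e₃ : e₁ # e₃) (e₂#e₃ : e₂ # e₃)
      (ψ-splits : ∀ x → ψ W x ≈ 4 · ((x - e₁) * ((x - e₂) * (x - e₃)))) where
      private
        vanishes : ∀ {x} → (x - e₁) * ((x - e₂) * (x - e₃)) ≈ 0# → ψ W x ≈ 0#
        vanishes {x} p = Ω.trans (ψ-splits x) (Ω.trans (·-congʳ 4 p) (solve 0 (4 :× (♯ 0) := ♯ 0) Ω.refl))
        v₁ : ψ W e₁ ≈ 0#
        v₁ = vanishes (solve 3 (λ a b c → (a :- a) :* ((a :- b) :* (a :- c)) := ♯ 0) Ω.refl e₁ e₂ e₃)
        v₂ : ψ W e₂ ≈ 0#
        v₂ = vanishes (solve 3 (λ a b c → (b :- a) :* ((b :- b) :* (b :- c)) := ♯ 0) Ω.refl e₁ e₂ e₃)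
        v₃ : ψ W e₃ ≈ 0#
        v₃ = vanishes (solve 3 (λ a b c → (c :- a) :* ((c :- b) :* (c :- c)) := ♯ 0) Ω.refl e₁ e₂ e₃)

      twoTorsion : Fin 4 → Σ Point TwoTorsion
      twoTorsion 0F = 𝒪 , 𝒪ˡ 𝒪
      twoTorsion 1F = halfPoint e₁ v₁
      twoTorsion 2F = halfPoint e₂ v₂
      twoTorsion 3F = halfPoint e₃ v₃

      twoTorsion-injective : ∀ {i j} → proj₁ (twoTorsion i) ≈ₚₜ proj₁ (twoTorsion j) → i ≡ j
      twoTorsion-injective {0F} {0F} _ = ≡.refl
      twoTorsion-injective {1F} {1F} _ = ≡.refl
      twoTorsion-injective {2F} {2F} _ = ≡.refl
      twoTorsion-injective {3F} {3F} _ = ≡.refl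
      twoTorsion-injective {0F} {1F} ()
      twoTorsion-injective {0F} {2F} ()
      twoTorsion-injective {0F} {3F} ()
      twoTorsion-injective {1F} {0F} ()
      twoTorsion-injective {2F} {0F} ()
      twoTorsion-injective {3F} {0F} ()
      twoTorsion-injective {1F} {2F} (affine p _) = ⊥-elim (#-irrefl p e₁#e₂)
      twoTorsion-injective {1F} {3F} (affine p _) = ⊥-elim (#-irrefl p e₁#e₃)
      twoTorsion-injective {2F} {1F} (affine p _) = ⊥-elim (#-irrefl (Ω.sym p) e₁#e₂)
      twoTorsion-injective {2F} {3F} (affine p _) = ⊥-elim (#-irrefl p e₂#e₃)
      twoTorsion-injective {3F} {1F} (affine p _) = ⊥-elim (#-irrefl (Ω.sym p) e₁#e₃)
      twoTorsion-injective {3F} {2F} (affine p _) = ⊥-elim (#-irrefl (Ω.sym p) e₂#e₃)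

      abscissa : ∀ {x y e} → TwoTorsion (affine x y e) → x ≈ e₁ ⊎ x ≈ e₂ ⊎ x ≈ e₃
      abscissa {x} {y} {e} (opposite _ v) = root-of-product e₁#e₂ e₁#e₃ e₂#e₃
        (4-cancel (Ω.trans (Ω.sym (ψ-splits x)) (vertical⇒ψ≈0 {x} {y} e v)))

      twoTorsion-onto : ∀ P → TwoTorsion P → ∃[ i ] proj₁ (twoTorsion i) ≈ₚₜ P
      twoTorsion-onto 𝒪 _ = 0F , 𝒪
      twoTorsion-onto (affine x y e) t@(opposite _ v) = locate (abscissa {e = e} t)
        where
        y≈ : ∀ {x′} → x ≈ x′ → ordinate x′ ≈ y
        y≈ p = Ω.sym (Ω.trans (vertical⇒ordinate v) (ordinate-cong p))
        locate : x ≈ e₁ ⊎ x ≈ e₂ ⊎ x ≈ e₃ → ∃[ i ] proj₁ (twoTorsion i) ≈ₚₜ affine x y e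
        locate (inj₁ p) = 1F , affine (Ω.sym p) (y≈ p)
        locate (inj₂ (inj₁ p)) = 2F , affine (Ω.sym p) (y≈ p)
        locate (inj₂ (inj₂ p)) = 3F , affine (Ω.sym p) (y≈ p)

      -- At a point of order 2 the ordinate is linear in the abscissa with coefficients from ½, a₁
      -- and a₃, so membership of the abscissa suffices.
      Coordinate-twoTorsion : ∀ {p} {B : Pred Carrier p} → Subring (ringOf Ω) B → B ½ → B a₁ → B a₃ →
        ∀ P → TwoTorsion P → (∀ {x y e} → P ≡ affine x y e → B x) → Coordinate P ⊆ B
      Coordinate-twoTorsion sub ½∈ a₁∈ a₃∈ (affine x y e) (opposite _ v) x∈ = λ
        { (inj₁ z≈x) → ≈-closed (Ω.sym z≈x) (x∈ ≡.refl)
        ; (inj₂ z≈y) → ≈-closed (Ω.sym (Ω.trans z≈y (vertical⇒ordinate v)))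
            (-‿closed (*-closed ½∈ (+-closed (*-closed a₁∈ (x∈ ≡.refl)) a₃∈)))
        }
        where open Subring sub
      Coordinate-twoTorsion sub ½∈ a₁∈ a₃∈ 𝒪 _ _ (lift ())

-- Telling a quadratic extension from its base field

module _ {a k₁ k₂ c ℓ₁ ℓ₂} {F : HeytingField a k₁ k₂} (M : Extension F c ℓ₁ ℓ₂) where
  open Extension M
  open ExtensionProperties M
  private
    module F = CommutativeRing (ringOf F)
    module M = CommutativeRing (ringOf top)
    open IntegerCoefficients (ringOf top) using (solve; _:=_; _:+_; _:*_; _:-_; :-_; ♯)
    open LinearCombination (ringOf top)

  -- If the basis vectors were the images of r₀ and r₁, the relation r₁e₀ - r₀e₁ = 0 would give r₀ =
  -- 0, hence e₀ = 0, and then 1·e₀ + 0·e₁ = 0 contradicts independence.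
  degree-2⇒not-Base : HasDegree M 2 → ¬ (∀ z → Base M z)
  degree-2⇒not-Base (e , _ , independent) all =
    unit≉0 F (F.1# , F.*-identityʳ F.1#) (independent u u-dependent 0F)
    where
    r₀ r₁ : F.Carrier
    r₀ = proj₁ (all (e 0F))
    r₁ = proj₁ (all (e 1F))
    v u : Fin 2 → F.Carrier
    v = λ { 0F → r₁ ; 1F → F.- r₀ }
    u = λ { 0F → F.1# ; 1F → F.0# }
    v≈0 : ∀ i → v i F.≈ F.0#
    v≈0 = independent v (modulo
      (e 0F ⊠ proj₂ (all (e 1F)) ⊞ (- e 1F) ⊠ proj₂ (all (e 0F)) ⊞ e 1F ⊠ ι.-‿homo r₀)
      (solve 5 (λ r₀ r₁ n e₀ e₁ →
        r₁ :* e₀ :+ (n :* e₁ :+ ♯ 0) := ♯ 0 :+ (e₀ :* (r₁ :- e₁) :+ (:- e₁) :* (r₀ :- e₀) :+ e₁ :* (n :- :- r₀)))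
        M.refl (ι r₀) (ι r₁) (ι (F.- r₀)) (e 0F) (e 1F)))
    e₀≈0 : e 0F ≈ 0#
    e₀≈0 = modulo ((- 1#) ⊠ proj₂ (all (e 0F)) ⊞ (- 1#) ⊠ M.trans (M.sym (ι.-‿homo r₀)) (M.trans (ι.⟦⟧-cong (v≈0 1F)) ι.0#-homo))
      (solve 2 (λ e₀ r₀ → e₀ := ♯ 0 :+ (:- (♯ 1) :* (r₀ :- e₀) :+ :- (♯ 1) :* (:- r₀ :- ♯ 0))) M.refl (e 0F) (ι r₀))
    u-dependent : ι (u 0F) * e 0F + (ι (u 1F) * e 1F + 0#) ≈ 0#
    u-dependent = modulo (ι F.1# ⊠ e₀≈0 ⊞ e 1F ⊠ ι.0#-homo)
      (solve 4 (λ o z e₀ e₁ → o :* e₀ :+ (z :* e₁ :+ ♯ 0) := ♯ 0 :+ (o :* (e₀ :- ♯ 0) :+ e₁ :* (z :- ♯ 0)))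
        M.refl (ι F.1#) (ι F.0#) (e 0F) (e 1F))

≅-refl : ∀ {a k c ℓ} {R : CommutativeRing a k} {A : Algebra R c ℓ} → A ≅ A
≅-refl {A = A} = id , Algebra.Morphism.Construct.Identity.isRingIsomorphism rawRing refl , λ _ → refl
  where open CommutativeRing (Algebra.ring A) using (rawRing; refl)

-- Surjectivity of the structure map is the invariant by which ℚ₂ is distinguished from the three
-- quadratic fields.
≅-Base : ∀ {a k c ℓ c′ ℓ′} {R : CommutativeRing a k} {A : Algebra R c ℓ} {B : Algebra R c′ ℓ′} → A ≅ B →
  (∀ x → ∃[ r ] CommutativeRing._≈_ (Algebra.ring A) (Algebra.ι A r) x) →
  ∀ y → ∃[ r ] CommutativeRing._≈_ (Algebra.ring B) (Algebra.ι B r) y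
≅-Base {B = B} (φ , isIso , φι) all y =
  let x , φx≈y = IsRingIsomorphism.surjective isIso y
      r , ιr≈x = all x
  in r , B.trans (B.sym (φι r)) (φx≈y ιr≈x)
  where module B = CommutativeRing (Algebra.ring B)

-- The field of 2-torsion

IsSquareRoot : ∀ {c ℓ} (R : CommutativeRing c ℓ) → CommutativeRing.Carrier R → CommutativeRing.Carrier R → Set ℓ
IsSquareRoot R x y = x * x ≈ y where open CommutativeRing R

module SquareRoot {a k₁ k₂ c ℓ₁ ℓ₂} {F : HeytingField a k₁ k₂} (Ω : AlgebraicClosure F c ℓ₁ ℓ₂) where
  open AlgebraicClosure Ω
  private
    module Ω = CommutativeRing (ringOf top)
    open IntegerCoefficients (ringOf top) using (solve; _:=_; _:+_; _:*_; _:-_; :-_; ♯)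
    open LinearCombination (ringOf top)

  sqrt : ∀ x → ∃[ η ] η * η ≈ x
  sqrt x = let η , root = algebraicallyClosed (- x) (0# ∷ []) in η , modulo (1# ⊠ root)
    (solve 2 (λ x η → η :* η := x :+ ♯ 1 :* (:- x :+ η :* (♯ 0 :+ η :* (♯ 1 :+ η :* ♯ 0)) :- ♯ 0)) Ω.refl x η)

module TwoTorsionField {a k₁ k₂ c ℓ₁ ℓ₂} {F : HeytingField a k₁ k₂} (Ω : AlgebraicClosure F c ℓ₁ ℓ₂)
  (2-unit : Unit (ringOf F) (HenselIdentities.2# (ringOf F)))
  {W : Weierstrass (HeytingField.Carrier F)} (rationalRoots : RationalRoots (ringOf F) W)
  (d-unit : Unit (ringOf F) (representative (ringOf F) (RationalRoots.κ rationalRoots)))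
  {η : AlgebraicClosure.Carrier Ω}
  (η²≈d : IsSquareRoot (ringOf (AlgebraicClosure.top Ω)) η
    (AlgebraicClosure.ι Ω (representative (ringOf F) (RationalRoots.κ rationalRoots)))) where
  open AlgebraicClosure Ω
  open ExtensionProperties extension
  open RationalRoots rationalRoots
  open QuadraticElements η²≈d
  open Points top (mapW ι W)
  private
    module F where
      open CommutativeRing (ringOf F) public
      open RingOps (ringOf F) public
    module Ω = CommutativeRing (ringOf top)
    open RingOps (ringOf top)
    open Units (ringOf top)
    open WeierstrassIdentities (ringOf top)
    open IntegerCoefficients (ringOf top) using (solve; _:=_; _:+_; _:*_; _:-_; :-_; _:^_; ♯)
    open LinearCombination (ringOf top)
    open Algebra.Properties.Semiring.Mult Ω.semiring using () renaming (×-congʳ to ·-congʳ)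

    d ½ : F.Carrier
    d = representative (ringOf F) κ
    ½ = proj₁ 2-unit

    2ι½≈1 : (1# + 1#) * ι ½ ≈ 1#
    2ι½≈1 = Ω.trans (Ω.*-congʳ (Ω.sym (Ω.trans (ι.+-homo _ _) (Ω.+-cong ι.1#-homo ι.1#-homo))))
      (Ω.trans (Ω.sym (ι.*-homo _ _)) (Ω.trans (ι.⟦⟧-cong (proj₂ 2-unit)) ι.1#-homo))

    e₁ e₂ e₃ : Carrier
    e₁ = ι ρ
    e₂ = ι g + ι h * η
    e₃ = ι g - ι h * η

    ιh²d : ι (h F.^ 2 F.* d) ≈ ι h ^ 2 * ι d
    ιh²d = Ω.trans (ι.*-homo _ d) (Ω.*-congʳ (ι.^-homo h 2))

    ψ-splits : ∀ x → ψ (mapW ι W) x ≈ 4 · ((x - e₁) * ((x - e₂) * (x - e₃)))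
    ψ-splits x = Ω.trans (ψ-roots (ι.Roots-homo isRoots) x) (·-congʳ 4 (Ω.*-congˡ (modulo
      ((- 1#) ⊠ ιh²d ⊞ (ι h ^ 2) ⊠ η²≈d)
      (solve 6 (λ x g h η d n →
        (x :- g) :^ 2 :- n := (x :- (g :+ h :* η)) :* (x :- (g :- h :* η))
          :+ (:- (♯ 1) :* (n :- h :^ 2 :* d) :+ h :^ 2 :* (η :* η :- d)))
        Ω.refl x (ι g) (ι h) η (ι d) (ι (h F.^ 2 F.* d))))))

    -- The product is (ρ - g)² - h²d, invertible by `separated`; a factor of a unit is a unit, so e₁
    -- is apart from both e₂ and e₃. For e₂ and e₃ the difference is 2hη, and η is a unit because η²
    -- = d is.
    e₁-e₂e₃ : Unit (ringOf top) ((e₁ - e₂) * (e₁ - e₃))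
    e₁-e₂e₃ = unit-resp
      (Ω.trans (ι.sub-homo _ _) (modulo
        (1# ⊠ Ω.trans (ι.^-homo _ 2) (Ω.*-cong (ι.sub-homo ρ g) (Ω.*-congʳ (ι.sub-homo ρ g))) ⊞ (- 1#) ⊠ ιh²d ⊞ (ι h ^ 2) ⊠ η²≈d)
        (solve 7 (λ s ρ g h η d n →
          s :- n := (ρ :- (g :+ h :* η)) :* (ρ :- (g :- h :* η))
            :+ (♯ 1 :* (s :- (ρ :- g) :^ 2) :+ :- (♯ 1) :* (n :- h :^ 2 :* d) :+ h :^ 2 :* (η :* η :- d)))
          Ω.refl (ι ((ρ F.- g) F.^ 2)) (ι ρ) (ι g) (ι h) η (ι d) (ι (h F.^ 2 F.* d)))))
      (ι.unit-homo separated)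

    e₁#e₂ : e₁ # e₂
    e₁#e₂ = unit⇒# top (unit-factorˡ e₁-e₂e₃)
    e₁#e₃ : e₁ # e₃
    e₁#e₃ = unit⇒# top (unit-factorʳ e₁-e₂e₃)
    e₂#e₃ : e₂ # e₃
    e₂#e₃ = unit⇒# top (unit-resp
      (solve 3 (λ g h η → (♯ 1 :+ ♯ 1) :* (h :* η) := g :+ h :* η :- (g :- h :* η)) Ω.refl (ι g) (ι h) η)
      (unit-* (ι ½ , 2ι½≈1) (unit-* (ι.unit-homo h-unit) (unit-factorˡ (unit-resp (Ω.sym η²≈d) (ι.unit-homo d-unit))))))

    open HalfPoints top 2ι½≈1 (mapW ι W)

  points : Fin 4 → Σ Point TwoTorsion
  points = twoTorsion e₁#e₂ e₁#e₃ e₂#e₃ ψ-splits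

  points-injective : ∀ {i j} → proj₁ (points i) ≈ₚₜ proj₁ (points j) → i ≡ j
  points-injective = twoTorsion-injective e₁#e₂ e₁#e₃ e₂#e₃ ψ-splits

  points-onto : ∀ P → TwoTorsion P → ∃[ i ] proj₁ (points i) ≈ₚₜ P
  points-onto = twoTorsion-onto e₁#e₂ e₁#e₃ e₂#e₃ ψ-splits

  private
    Coordinate⊆ : ∀ {p} {B : Pred Carrier p} → Subring (ringOf top) B → Base extension ⊆ B →
      ∀ P → TwoTorsion P → (∀ {x y e} → P ≡ affine x y e → B x) → Coordinate P ⊆ B
    Coordinate⊆ sub base⊆ = Coordinate-twoTorsion e₁#e₂ e₁#e₃ e₂#e₃ ψ-splits sub
      (base⊆ (½ , Ω.refl)) (base⊆ (_ , Ω.refl)) (base⊆ (_ , Ω.refl))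

  Field : Fin 4 → Pred Carrier _
  Field i = Adjoin extension (Coordinate (proj₁ (points i)))

  Coordinates : Pred Carrier _
  Coordinates z = ∃[ P ] TwoTorsion P × Coordinate P z

  Coordinates⊆Quadratic : Coordinates ⊆ Quadratic
  Coordinates⊆Quadratic (P , t , z∈) = Coordinate⊆ Quadratic-subring Base⊆Quadratic P t
      (λ { {x} {y} {e} ≡.refl → x∈ (abscissa e₁#e₂ e₁#e₃ e₂#e₃ ψ-splits {e = e} t) }) z∈
    where
    x∈ : ∀ {x} → x ≈ e₁ ⊎ x ≈ e₂ ⊎ x ≈ e₃ → Quadratic x
    x∈ (inj₁ p) = Base⊆Quadratic (ρ , Ω.sym p)
    x∈ (inj₂ (inj₁ p)) = g , h , Ω.sym p
    x∈ (inj₂ (inj₂ p)) = g , F.- h , Ω.trans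
      (Ω.+-congˡ (Ω.trans (Ω.*-congʳ (ι.-‿homo h)) (solve 2 (λ h η → (:- h) :* η := :- (h :* η)) Ω.refl (ι h) η))) (Ω.sym p)

  adjoined⊆Quadratic : Adjoin extension Coordinates ⊆ Quadratic
  adjoined⊆Quadratic = Adjoin-least algebraic Quadratic-subring Base⊆Quadratic Coordinates⊆Quadratic

  private
    -- The sign s = ±1 treats e₂ and e₃ together: η = ((g + shη) - g) · s/h.
    generates : ∀ {p} {S : Pred Carrier p} {s} → Adjoin extension S (ι g + s * (ι h * η)) → s * s ≈ 1# → Adjoin extension S s →
                Adjoin extension S η
    generates {s = s} e∈ s²≈1 s∈ = let h⁻¹ , hh⁻¹≈1 = h-unit in
      resp (Ω.sym (modulo
          ((ι h * ι h⁻¹ * η) ⊠ Ω.sym s²≈1 ⊞ (- η) ⊠ Ω.trans (Ω.sym (ι.*-homo h h⁻¹)) (Ω.trans (ι.⟦⟧-cong hh⁻¹≈1) ι.1#-homo))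
          (solve 5 (λ g h h⁻¹ η s →
            η := (g :+ s :* (h :* η) :- g) :* (s :* h⁻¹)
              :+ (h :* h⁻¹ :* η :* (♯ 1 :- s :* s) :+ (:- η) :* (h :* h⁻¹ :- ♯ 1)))
            Ω.refl (ι g) (ι h) (ι h⁻¹) η s)))
        (mul (add e∈ (neg (base g))) (mul s∈ (base h⁻¹)))

    1∈ : ∀ {p} {S : Pred Carrier p} → Adjoin extension S 1#
    1∈ = resp ι.1#-homo (base F.1#)

    η∈-e₂ : ∀ {p} {S : Pred Carrier p} → Adjoin extension S e₂ → Adjoin extension S η
    η∈-e₂ {S = S} e₂∈ = generates {S = S} {s = 1#} (resp (Ω.+-congˡ (Ω.sym (Ω.*-identityˡ _))) e₂∈) (Ω.*-identityˡ 1#) 1∈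

    η∈-e₃ : ∀ {p} {S : Pred Carrier p} → Adjoin extension S e₃ → Adjoin extension S η
    η∈-e₃ {S = S} e₃∈ = generates {S = S} {s = - 1#}
      (resp (solve 3 (λ g h η → g :- h :* η := g :+ :- (♯ 1) :* (h :* η)) Ω.refl (ι g) (ι h) η) e₃∈)
      (solve 0 (:- (♯ 1) :* :- (♯ 1) := ♯ 1) Ω.refl) (neg 1∈)

  η∈Field-2 : Field 2F η
  η∈Field-2 = η∈-e₂ {S = Coordinate (proj₁ (points 2F))} (gen (inj₁ Ω.refl))

  η∈Field-3 : Field 3F η
  η∈Field-3 = η∈-e₃ {S = Coordinate (proj₁ (points 3F))} (gen (inj₁ Ω.refl))

  Field⊆adjoined : ∀ i → Field i ⊆ Adjoin extension Coordinates
  Field⊆adjoined i = Adjoin-least algebraic {S = Coordinate (proj₁ (points i))} (Adjoin-subring {S = Coordinates})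
    (λ { (r , p) → resp p (base r) })
    (λ z∈ → gen (proj₁ (points i) , proj₂ (points i) , z∈))

  η∈adjoined : Adjoin extension Coordinates η
  η∈adjoined = Field⊆adjoined 2F η∈Field-2

  Field-0 : Field 0F ≐ Base extension
  Field-0 = Adjoin-least algebraic Base-subring id (λ { (lift ()) }) , λ { (r , p) → resp p (base r) }

  Field-1 : Field 1F ≐ Base extension
  Field-1 = Adjoin-least algebraic Base-subring id
      (Coordinate⊆ Base-subring id (proj₁ (points 1F)) (proj₂ (points 1F)) (λ { ≡.refl → ρ , Ω.refl }))
    , λ { (r , p) → resp p (base r) }

  module _ (i : Fin 4) (η∈ : Field i η) where
    Field-η : Field i ≐ Adjoin extension Coordinates
    Field-η = Field⊆adjoined i , λ z∈ → let x , y , e = adjoined⊆Quadratic z∈ in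
      resp e (add (base x) (mul (base y) η∈))

    Field-η≢Base : (∀ x → ¬ (x F.* x F.≈ d)) → ¬ (Field i ≐ Base extension)
    Field-η≢Base nonsquare (Field⊆Base , _) = η∉Base nonsquare (Field⊆Base η∈)

-- Classification over ℚ₂

module _ {c ℓ} (R : CommutativeRing c ℓ) where
  open CommutativeRing R
  open RingOps R
  open IntegerCoefficients R using (solve; _:=_; _:-_; :-_; _:×_; ♯)

  -- X² + 2X + t = (X + 1)² - (1 - t), so the constant terms 2 and 6 of `L₁` and `L₂` belong to the
  -- square classes of -1 and -5.
  2≈1--1 : 2 · 1# ≈ 1# - representative R ⟨-1⟩
  2≈1--1 = solve 0 (2 :× (♯ 1) := ♯ 1 :- :- (♯ 1)) refl

  6≈1--5 : 6 · 1# ≈ 1# - representative R ⟨-5⟩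
  6≈1--5 = solve 0 (6 :× (♯ 1) := ♯ 1 :- :- (5 :× (♯ 1))) refl

representative-unit : ∀ κ → Unit (ringOf ℚ₂) (representative (ringOf ℚ₂) κ)
representative-unit κ = Units.unit-resp (ringOf ℚ₂) (ℤ₂→ℚ₂.representative-homo κ)
  (ℤ₂→ℚ₂.unit-homo (odd⇒unit (proj₂ (HenselIdentities.representative-odd ℤ₂ κ))))

module _ {c ℓ₁ ℓ₂} (ℚ̄₂ : AlgebraicClosure ℚ₂ c ℓ₁ ℓ₂) (E : EllipticCurve ℚ₂)
  (r : RationalRoots (ringOf ℚ₂) (EllipticCurve.equation E)) where
  open AlgebraicClosure ℚ̄₂ 
  open ExtensionProperties extension
  open TwoTorsionPoints ℚ̄₂ E
  open RationalRoots r using (κ)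
  private
    module Ω = CommutativeRing (ringOf top)
    K = Extension.algebra ℚ₂⟮E[2]⟯

  module _ {η : Carrier} (η²≈d : η * η ≈ ι (representative (ringOf ℚ₂) κ)) where
    open QuadraticElements η²≈d
    private
      module T = TwoTorsionField ℚ̄₂ 2-unit r (representative-unit κ) η²≈d

    ℚ₂⟨E[2]⟩⊆Quadratic : ℚ₂⟨E[2]⟩ ⊆ Quadratic
    ℚ₂⟨E[2]⟩⊆Quadratic = T.adjoined⊆Quadratic

    η∈ℚ₂⟨E[2]⟩ : ℚ₂⟨E[2]⟩ η
    η∈ℚ₂⟨E[2]⟩ = T.η∈adjoined

    ℚ₂⟨E[2]⟩⊆Base : Base extension η → ℚ₂⟨E[2]⟩ ⊆ ⟨ℚ₂⟩
    ℚ₂⟨E[2]⟩⊆Base η∈Base z∈ = let x , y , e = ℚ₂⟨E[2]⟩⊆Quadratic z∈ in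
      ≈-closed e (+-closed (x , Ω.refl) (*-closed (y , Ω.refl) η∈Base))
      where open Subring Base-subring

    fourPoints : (∀ x → ¬ (x ℚ₂.* x ℚ₂.≈ representative (ringOf ℚ₂) κ)) →
      Σ (Bijection (≡.setoid (Fin 4)) E[2]) λ P →
       let open Bijection P using (to) in
       (ℚ₂⟨ to 0F ⟩ ≐ ⟨ℚ₂⟩) × (ℚ₂⟨ to 1F ⟩ ≐ ⟨ℚ₂⟩)
       × (ℚ₂⟨ to 2F ⟩ ≐ ℚ₂⟨E[2]⟩) × (ℚ₂⟨ to 3F ⟩ ≐ ℚ₂⟨E[2]⟩)
       × ¬ (ℚ₂⟨ to 2F ⟩ ≐ ⟨ℚ₂⟩) × ¬ (ℚ₂⟨ to 3F ⟩ ≐ ⟨ℚ₂⟩)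
    fourPoints nonsquare = bijection , T.Field-0 , T.Field-1 , T.Field-η 2F T.η∈Field-2 , T.Field-η 3F T.η∈Field-3 ,
        T.Field-η≢Base 2F T.η∈Field-2 nonsquare , T.Field-η≢Base 3F T.η∈Field-3 nonsquare
      where
      module E[2] = Setoid E[2]
      bijection : Bijection (≡.setoid (Fin 4)) E[2]
      bijection = record
        { to = T.points
        ; cong = λ { {i} ≡.refl → E[2].refl {T.points i} }
        ; bijective = T.points-injective , λ (P , t) → let i , p = T.points-onto P t in i , λ { ≡.refl → p }
        }

  split-≅ : ℚ₂⟨E[2]⟩ ⊆ ⟨ℚ₂⟩ → K ≅ ℚ₂-algebra
  split-≅ rational = adjoin-≅ ℚ₂-algebra isRingHomomorphism ι-injective (λ _ → Ω.refl) base rational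

  module _ (rational : ℚ₂⟨E[2]⟩ ⊆ ⟨ℚ₂⟩) where
    private
      K-rational : ∀ x → ∃[ r ] CommutativeRing._≈_ (Algebra.ring K) (Algebra.ι K r) x
      K-rational (z , z∈) = rational z∈

      -- `κ` here is the class defining `L₁` or `L₂`, not the class of the curve; the closure
      -- supplies a square root η of its representative, at which the quotient can be evaluated.
      ≇quotient : ∀ κ → κ ≢ ⟨1⟩ → ∀ {t} → t ℚ₂.≈ ℚ₂.1# ℚ₂.- representative (ringOf ℚ₂) κ →
        ¬ (K ≅ ringOf ℚ₂ [X]/ (t ∷ RingOps._·_ (ringOf ℚ₂) 2 ℚ₂.1# ∷ ℚ₂.1# ∷ []))
      ≇quotient κ κ≢1 {t} t≈1-d iso =
        let B = ringOf ℚ₂ [X]/ (t ∷ RingOps._·_ (ringOf ℚ₂) 2 ℚ₂.1# ∷ ℚ₂.1# ∷ [])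
            η , η²≈d = SquareRoot.sqrt ℚ̄₂ (ι (representative (ringOf ℚ₂) κ))
            s , s≈X = ≅-Base {A = K} {B = B} iso K-rational (ℚ₂.0# ∷ ℚ₂.1# ∷ [])
        in X-nonconstant extension η²≈d (representative-nonsquare κ κ≢1) t≈1-d s
             (CommutativeRing.sym (Algebra.ring B) s≈X)

    -- Each alternative would make the structure map of a quadratic extension surjective: the degree
    -- refutes this for ℚ₄, the class of X for `L₁` and `L₂`.
    split-≇ : ¬ (ℚ₂⟮E[2]⟯ ≅ℚ₄ ⊎ K ≅ L₁ ⊎ K ≅ L₂)
    split-≇ (inj₁ (M , (degree , _) , iso)) = degree-2⇒not-Base M degree (≅-Base {A = K} {B = Extension.algebra M} iso K-rational)
    split-≇ (inj₂ (inj₁ iso)) = ≇quotient ⟨-1⟩ (λ ()) (2≈1--1 (ringOf ℚ₂)) iso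
    split-≇ (inj₂ (inj₂ iso)) = ≇quotient ⟨-5⟩ (λ ()) (6≈1--5 (ringOf ℚ₂)) iso

  private
    η : Carrier
    η = proj₁ (SquareRoot.sqrt ℚ̄₂ (ι (representative (ringOf ℚ₂) κ)))

    η²≈d : η * η ≈ ι (representative (ringOf ℚ₂) κ)
    η²≈d = proj₂ (SquareRoot.sqrt ℚ̄₂ (ι (representative (ringOf ℚ₂) κ)))

    rational : κ ≡ ⟨1⟩ → ℚ₂⟨E[2]⟩ ⊆ ⟨ℚ₂⟩
    -- For d = 1 the square root is taken to be 1, visibly in ℚ₂, in place of the η chosen in the
    -- closure.
    rational κ≡1 = ℚ₂⟨E[2]⟩⊆Base {1#}
      (Ω.trans (Ω.*-identityʳ 1#) (Ω.trans (Ω.sym ι.1#-homo)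
        (Ω.reflexive (cong (λ κ → ι (representative (ringOf ℚ₂) κ)) (≡.sym κ≡1)))))
      (ℚ₂.1# , ι.1#-homo)

    -- ℚ₂(E[2]) itself serves as the unramified quadratic extension, with the identity as
    -- isomorphism.
    unramified-≅ : κ ≡ ⟨-3⟩ → ℚ₂⟮E[2]⟯ ≅ℚ₄
    unramified-≅ κ≡-3 = ℚ₂⟮E[2]⟯ ,
      unramifiedQuadratic ℚ₂⟮E[2]⟯ {η , η∈ℚ₂⟨E[2]⟩ η²≈d}
        (≡.subst (λ κ → η * η ≈ ι (representative (ringOf ℚ₂) κ)) κ≡-3 η²≈d)
        (λ { (z , z∈) → ℚ₂⟨E[2]⟩⊆Quadratic η²≈d z∈ }) ,
      ≅-refl {A = K}

    quotient-≅ : ∀ {t} → κ ≢ ⟨1⟩ → t ℚ₂.≈ ℚ₂.1# ℚ₂.- representative (ringOf ℚ₂) κ →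
      K ≅ ringOf ℚ₂ [X]/ (t ∷ RingOps._·_ (ringOf ℚ₂) 2 ℚ₂.1# ∷ ℚ₂.1# ∷ [])
    quotient-≅ κ≢1 t≈1-d = adjoin-≅-quotient extension η²≈d (representative-nonsquare κ κ≢1) t≈1-d
      (ℚ₂⟨E[2]⟩⊆Quadratic η²≈d) (η∈ℚ₂⟨E[2]⟩ η²≈d)

    -- The class belongs to the given `r` and cannot be replaced there; the match is on a copy `κ′`,
    -- and the equation carries the result back.
    classify : ∀ κ′ → κ ≡ κ′ → K ≅ ℚ₂-algebra ⊎ ℚ₂⟮E[2]⟯ ≅ℚ₄ ⊎ K ≅ L₁ ⊎ K ≅ L₂
    classify ⟨1⟩ eq = inj₁ (split-≅ (rational eq))
    classify ⟨-3⟩ eq = inj₂ (inj₁ (unramified-≅ eq))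
    classify ⟨-1⟩ eq = inj₂ (inj₂ (inj₁ (quotient-≅ (λ eq′ → case (≡.trans (≡.sym eq) eq′) of λ ())
      (≡.subst (λ κ → RingOps._·_ (ringOf ℚ₂) 2 ℚ₂.1# ℚ₂.≈ ℚ₂.1# ℚ₂.- representative (ringOf ℚ₂) κ) (≡.sym eq) (2≈1--1 (ringOf ℚ₂))))))
    classify ⟨-5⟩ eq = inj₂ (inj₂ (inj₂ (quotient-≅ (λ eq′ → case (≡.trans (≡.sym eq) eq′) of λ ())
      (≡.subst (λ κ → RingOps._·_ (ringOf ℚ₂) 6 ℚ₂.1# ℚ₂.≈ ℚ₂.1# ℚ₂.- representative (ringOf ℚ₂) κ) (≡.sym eq) (6≈1--5 (ringOf ℚ₂))))))

  classification : K ≅ ℚ₂-algebra ⊎ ℚ₂⟮E[2]⟯ ≅ℚ₄ ⊎ K ≅ L₁ ⊎ K ≅ L₂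
  classification = classify κ ≡.refl

  -- The class of 1 would make ℚ₂(E[2]) equal to ℚ₂, which `split-≇` excludes; representatives of
  -- the other classes are not squares.
  nonsquare : ℚ₂⟮E[2]⟯ ≅ℚ₄ ⊎ K ≅ L₁ ⊎ K ≅ L₂ → ∀ x → ¬ (x ℚ₂.* x ℚ₂.≈ representative (ringOf ℚ₂) κ)
  nonsquare nontrivial = representative-nonsquare κ (λ κ≡1 → split-≇ (rational κ≡1) nontrivial)

open import Relation.Binary.PropositionalEquality using (setoid)

theorem2p4 :
    ∀ {c ℓ₁ ℓ₂ c′ ℓ₁′ ℓ₂′}
      (ℚ̄₂ : AlgebraicClosure ℚ₂ c ℓ₁ ℓ₂) (𝔽̄₂ : AlgebraicClosure 𝔽₂ c′ ℓ₁′ ℓ₂′)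
      (E : EllipticCurve ℚ₂) → GoodOrdinaryReduction 𝔽̄₂ E →
    let open TwoTorsionPoints ℚ̄₂ E
        K = Extension.algebra ℚ₂⟮E[2]⟯
    in
    (K ≅ ℚ₂-algebra ⊎ ℚ₂⟮E[2]⟯ ≅ℚ₄ ⊎ K ≅ L₁ ⊎ K ≅ L₂)
    ×
    (ℚ₂⟮E[2]⟯ ≅ℚ₄ ⊎ K ≅ L₁ ⊎ K ≅ L₂ →
     Σ (Bijection (setoid (Fin 4)) E[2]) λ P →
       let open Bijection P using (to) in
       (ℚ₂⟨ to 0F ⟩ ≐ ⟨ℚ₂⟩) × (ℚ₂⟨ to 1F ⟩ ≐ ⟨ℚ₂⟩)
       × (ℚ₂⟨ to 2F ⟩ ≐ ℚ₂⟨E[2]⟩) × (ℚ₂⟨ to 3F ⟩ ≐ ℚ₂⟨E[2]⟩)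
       × ¬ (ℚ₂⟨ to 2F ⟩ ≐ ⟨ℚ₂⟩) × ¬ (ℚ₂⟨ to 3F ⟩ ≐ ⟨ℚ₂⟩))
theorem2p4 ℚ̄₂ 𝔽̄₂ E red =
  let r = goodOrdinary⇒rationalRoots red
      _ , η²≈d = SquareRoot.sqrt ℚ̄₂ _
  in classification ℚ̄₂ E r , λ nontrivial → fourPoints ℚ̄₂ E r η²≈d (nonsquare ℚ̄₂ E r nontrivial)
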